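{- Let $R$ be an order in $K$ and let $S$ be an over-order of $R$. Let $T$ be any over-order of $S$ such that $S^tT$ is invertible as a fractional $T$-ideal. Let $\mathfrak f$ be an ideal contained in $S$ such that $T\subseteq(\mathfrak f:\mathfrak f)$. Then every class in $\mathcal{W}_S(R)$ has a representative $I$ satisfying $\mathfrak f\subseteq I\subseteq T$.
   Context: An order is a commutative reduced ring $R$ with unit that is free and finitely generated as a $\mathbb{Z}$-module; its total quotient ring $K$ is a finite product of number fields, and $R$ is called an order in $K$. A fractional $R$-ideal is a finitely generated sub-$R$-module $I$ of $K$ with $I\otimes_{\mathbb{Z}}\mathbb{Q}=K$. For fractional $R$-ideals $I,J$, $IJ$ is the usual product and $(I:J)=\{x\in K: xJ\subseteq I\}$ (the same formula is used for $(\mathfrak f:\mathfrak f)$). An over-order of $R$ is a fractional $R$-ideal that is a subring of $K$ (so it contains $R$). The multiplicator ring of $I$ is $(I:I)$. A fractional $T$-ideal $I$ is invertible (as a fractional $T$-ideal) if $IJ=T$ for some fractional $T$-ideal $J$. The trace dual of $S$ is $S^t=\{x\in K:\mathrm{Tr}_{K/\mathbb{Q}}(xS)\subseteq\mathbb{Z}\}$, where $\mathrm{Tr}_{K/\mathbb{Q}}(x)$ is the trace of multiplication by $x$ on $K$. Two fractional $R$-ideals $I,J$ are weakly equivalent if they satisfy the following equivalent conditions: $I_{\mathfrak p}\simeq J_{\mathfrak p}$ as $R_{\mathfrak p}$-modules for every maximal ideal $\mathfrak p$ of $R$; $1\in (I:J)(J:I)$; $I$ and $J$ have the same multiplicator ring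 $S$ and $I=LJ$ for some invertible fractional $S$-ideal $L$. $\mathcal{W}_S(R)$ is the set of weak equivalence classes of fractional $R$-ideals $I$ with $(I:I)=S$. -}

module Defs where

open import Level using (Level; _⊔_; Lift) renaming (suc to lsuc)
open import Algebra.Bundles using (CommutativeRing)
open import Algebra.Morphism.Structures using (module RingMorphisms)
import Algebra.Properties.Ring as RingProperties
import Algebra.Properties.CommutativeSemigroup as CommutativeSemigroupProperties
import Algebra.Properties.Semiring.Exp as Exp
import Algebra.Properties.Semiring.Mult as Mult
import Algebra.Properties.Semiring.Sum as Sum
open import Data.Fin.Base using (Fin; zero; suc)
open import Data.Integer.Base as ℤ using (ℤ; +_; -[1+_])
import Data.Integer.Properties as ℤₚ
open import Data.Nat.Base as ℕ using (ℕ; zero; suc)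
open import Data.Product.Base using (∃; ∃₂; _×_; _,_; proj₁; proj₂)
open import Data.Rational.Base as ℚ using (ℚ; 0ℚ; ↥_)
open import Data.Rational.Literals using (fromℤ)
import Data.Rational.Properties as ℚₚ
open import Data.Sum.Base using ([_,_]′)
open import Data.Vec.Functional using (Vector; map; zipWith; _∷_)
open import Function.Base using (_∘_)
open import Relation.Binary.Bundles using (Setoid)
open import Relation.Binary.PropositionalEquality as ≡ using (_≡_)
import Relation.Binary.Reasoning.Setoid as SetoidReasoning
open import Relation.Unary using (Pred; _∈_; _⊆_; _≐_)

private variable
  a r c ℓ : Level

module Scalars (A : CommutativeRing c ℓ) where
  open CommutativeRing A
  open Mult semiring using () renaming (_×_ to _×ᴬ_)
  open Sum semiring using (sum)

  infixr 8 _·ℤ_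
  _·ℤ_ : ℤ → Carrier → Carrier
  (+ n)    ·ℤ x = n ×ᴬ x
  -[1+ n ] ·ℤ x = - (suc n ×ᴬ x)

  -- `X` is ℤ or ℚ below, acting on the additive group of `A` by `_·_`.
  record IsBasis {X : Set} (0X : X) (_·_ : X → Carrier → Carrier)
                 {n : ℕ} (b : Vector Carrier n) : Set (c ⊔ ℓ) where
    field
      spans       : ∀ x → ∃ λ (k : Vector X n) → x ≈ sum (zipWith _·_ k b)
      independent : ∀ (k : Vector X n) → sum (zipWith _·_ k b) ≈ 0# →
                    ∀ i → k i ≡ 0X

module _ (A : CommutativeRing c ℓ) where
  open CommutativeRing A
  open Scalars A
  open Exp semiring using (_^_)

  Reduced : Set (c ⊔ ℓ)
  Reduced = ∀ x n → x ^ n ≈ 0# → x ≈ 0#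

  NonZeroDivisor : Carrier → Set (c ⊔ ℓ)
  NonZeroDivisor s = ∀ x → s * x ≈ 0# → x ≈ 0#

  record IsOrder : Set (c ⊔ ℓ) where
    field
      reduced : Reduced
      rank    : ℕ
      basis   : Vector Carrier rank
      isBasis : IsBasis (+ 0) _·ℤ_ basis

record IsTotalQuotientRing (R : CommutativeRing a r) (K : CommutativeRing c ℓ)
       (ι : CommutativeRing.Carrier R → CommutativeRing.Carrier K) :
       Set (a ⊔ r ⊔ c ⊔ ℓ) where
  private
    module R = CommutativeRing R
    module K = CommutativeRing K
  open RingMorphisms R.rawRing K.rawRing using (IsRingMonomorphism)
  field
    isRingMonomorphism : IsRingMonomorphism ι
    inverse  : ∀ s → NonZeroDivisor R s → ∃ λ y → ι s K.* y K.≈ K.1#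
    fraction : ∀ x → ∃₂ λ s t → NonZeroDivisor R s × ι s K.* x K.≈ ι t

module _ (R : CommutativeRing a r) (isOrder : IsOrder R) where
  open CommutativeRing R
  open IsOrder isOrder
  open Scalars R
  open Mult semiring using (×-assoc-*; ×-congʳ; ×-assocˡ) renaming (_×_ to _×ᴿ_)
  open Sum semiring using (sum; sum-cong-≋; *-distribˡ-sum; sum-replicate-zero)
  open RingProperties ring using (-‿distribʳ-*)
  open SetoidReasoning setoid

  1×-* : ∀ n x → (n ×ᴿ 1#) * x ≈ n ×ᴿ x
  1×-* n x = trans (×-assoc-* n 1# x) (×-congʳ n (*-identityˡ x))

  ·ℤ-assoc : ∀ d z x →
             (suc d ×ᴿ 1#) * (z ·ℤ x) ≈ ((+ suc d) ℤ.* z) ·ℤ x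
  ·ℤ-assoc d (+ n) x = begin
    (suc d ×ᴿ 1#) * (n ×ᴿ x)   ≈⟨ 1×-* (suc d) _ ⟩
    suc d ×ᴿ (n ×ᴿ x)          ≈⟨ ×-assocˡ x (suc d) n ⟩
    (+ (suc d ℕ.* n)) ·ℤ x
      ≡⟨ ≡.cong (_·ℤ x) (ℤₚ.pos-* (suc d) n) ⟩
    ((+ suc d) ℤ.* (+ n)) ·ℤ x ∎
  ·ℤ-assoc d -[1+ n ] x = begin
    (suc d ×ᴿ 1#) * - (suc n ×ᴿ x)    ≈⟨ -‿distribʳ-* _ _ ⟨
    - ((suc d ×ᴿ 1#) * (suc n ×ᴿ x))  ≈⟨ -‿cong (1×-* (suc d) _) ⟩
    - (suc d ×ᴿ (suc n ×ᴿ x))         ≈⟨ -‿cong (×-assocˡ x (suc d) (suc n)) ⟩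
    ((+ suc d) ℤ.* -[1+ n ]) ·ℤ x     ∎

  suc×1-nonZeroDivisor : ∀ d → NonZeroDivisor R (suc d ×ᴿ 1#)
  suc×1-nonZeroDivisor d x dx≈0 = begin
    x                           ≈⟨ x≈ ⟩
    sum (zipWith _·ℤ_ k basis)  ≈⟨ sum-cong-≋ {rank} (λ i → reflexive (≡.cong (_·ℤ basis i) (k≡0 i))) ⟩
    sum {rank} (λ _ → 0#)       ≈⟨ sum-replicate-zero rank ⟩
    0#                          ∎
    where
    k  = proj₁ (IsBasis.spans isBasis x)
    x≈ = proj₂ (IsBasis.spans isBasis x)

    dk : Vector ℤ rank
    dk i = (+ suc d) ℤ.* k i

    dk≡0 : ∀ i → dk i ≡ + 0
    dk≡0 = IsBasis.independent isBasis dk (begin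
      sum (zipWith _·ℤ_ dk basis)
        ≈⟨ sum-cong-≋ (λ i → ·ℤ-assoc d (k i) (basis i)) ⟨
      sum (map ((suc d ×ᴿ 1#) *_) (zipWith _·ℤ_ k basis))
        ≈⟨ *-distribˡ-sum _ (zipWith _·ℤ_ k basis) ⟨
      (suc d ×ᴿ 1#) * sum (zipWith _·ℤ_ k basis)
        ≈⟨ *-congˡ x≈ ⟨
      (suc d ×ᴿ 1#) * x
        ≈⟨ dx≈0 ⟩
      0# ∎)

    k≡0 : ∀ i → k i ≡ + 0
    k≡0 i = [ (λ ()) , (λ e → e) ]′ (ℤₚ.i*j≡0⇒i≡0∨j≡0 (+ suc d) (dk≡0 i))

module InTotalQuotientRing
  (R : CommutativeRing a r) (isOrder : IsOrder R)
  (K : CommutativeRing c ℓ)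
  (ι : CommutativeRing.Carrier R → CommutativeRing.Carrier K)
  (isTotalQuotientRing : IsTotalQuotientRing R K ι)
  where

  private
    module R = CommutativeRing R
    module Rˣ = Mult R.semiring
    module ℚΣ = Sum (CommutativeRing.semiring ℚₚ.+-*-commutativeRing)
  open CommutativeRing K hiding (zero)
  open Scalars K
  open Sum semiring using (sum; sum-cong-≋; *-distribˡ-sum)
  open IsTotalQuotientRing isTotalQuotientRing

  infixr 8 _·ℚ_
  _·ℚ_ : ℚ → Carrier → Carrier
  q ·ℚ x = (↥ q ·ℤ x) * d⁻¹
    where
    d = ℚ.ℚ.denominator-1 q
    d⁻¹ = proj₁ (inverse (suc d Rˣ.× R.1#) (suc×1-nonZeroDivisor R isOrder d))

  -- Matrix of multiplication by `x` in some ℚ-basis of `K`: column `j` holds the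
  -- coordinates of `x * basis j`.
  record HasTrace (x : Carrier) (q : ℚ) : Set (c ⊔ ℓ) where
    field
      {dim}   : ℕ
      basis   : Vector Carrier dim
      isBasis : IsBasis 0ℚ _·ℚ_ basis
      matrix  : Fin dim → Fin dim → ℚ
      columns : ∀ j → x * basis j ≈ sum (λ i → matrix i j ·ℚ basis i)
      trace   : q ≡ ℚΣ.sum (λ i → matrix i i)

  κ : Level
  κ = a ⊔ r ⊔ c ⊔ ℓ

  Subset : Set (lsuc κ)
  Subset = Pred Carrier κ

  -- Image of `R` in `K`, lifted to the universe level of `Subset`.
  Rᴷ : Subset
  Rᴷ x = Lift κ (∃ λ s → ι s ≈ x)

  infixl 7 _∙_
  infix 6 _∶_

  _∙_ : Subset → Subset → Subset
  (I ∙ J) x = ∃ λ n → ∃₂ λ (u v : Vector Carrier n) →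
    (∀ i → u i ∈ I) × (∀ i → v i ∈ J) × x ≈ sum (zipWith _*_ u v)

  _∶_ : Subset → Subset → Subset
  (I ∶ J) x = ∀ y → y ∈ J → x * y ∈ I

  -- `T` is meant to be a subring of `K`; closure under negation then follows
  -- from -1 ∈ T.
  record IsSubmodule (T I : Subset) : Set κ where
    field
      resp     : ∀ {x y} → x ≈ y → x ∈ I → y ∈ I
      0∈       : 0# ∈ I
      +-closed : ∀ {x y} → x ∈ I → y ∈ I → x + y ∈ I
      *-closed : ∀ {t x} → t ∈ T → x ∈ I → t * x ∈ I

  FinitelyGenerated : (T I : Subset) → Set κ
  FinitelyGenerated T I = ∃₂ λ n (g : Vector Carrier n) → (∀ i → g i ∈ I) ×
    (∀ {x} → x ∈ I → ∃ λ (t : Vector Carrier n) →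
      (∀ i → t i ∈ T) × x ≈ sum (zipWith _*_ t g))

  -- Surjectivity of I ⊗ ℚ → K; injectivity is automatic because K is
  -- torsion-free.
  Full : Subset → Set κ
  Full I = ∀ x → ∃ λ n → ∃₂ λ (q : Vector ℚ n) (y : Vector Carrier n) →
    (∀ i → y i ∈ I) × x ≈ sum (zipWith _·ℚ_ q y)

  record IsFractionalIdeal (T I : Subset) : Set κ where
    field
      isSubmodule       : IsSubmodule T I
      finitelyGenerated : FinitelyGenerated T I
      full              : Full I
    open IsSubmodule isSubmodule public

  record IsOverOrder (T S : Subset) : Set κ where
    field
      isFractionalIdeal : IsFractionalIdeal T S
      1∈                : 1# ∈ S
      *-closed          : ∀ {x y} → x ∈ S → y ∈ S → x * y ∈ S

  record IsIdeal (S 𝔣 : Subset) : Set κ where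
    field
      isSubmodule : IsSubmodule S 𝔣
      contained   : 𝔣 ⊆ S

  -- `I` is not itself required to be a fractional T-ideal: for I = Sᵗ ∙ T this is
  -- automatic.
  Invertible : (T I : Subset) → Set (lsuc κ)
  Invertible T I = ∃ λ J → IsFractionalIdeal T J × I ∙ J ≐ T

  infix 9 _ᵗ
  _ᵗ : Subset → Subset
  (S ᵗ) x = ∀ y → y ∈ S → ∃ λ (z : ℤ) → HasTrace (x * y) (fromℤ z)

  WeaklyEquivalent : Subset → Subset → Set κ
  WeaklyEquivalent I J = 1# ∈ (I ∶ J) ∙ (J ∶ I)

  record IdealWithMultiplicatorRing (S : Subset) : Set (lsuc κ) where
    field
      ideal             : Subset
      isFractionalIdeal : IsFractionalIdeal Rᴷ ideal
      multiplicatorRing : ideal ∶ ideal ≐ S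
    open IsFractionalIdeal isFractionalIdeal public

  open CommutativeSemigroupProperties *-commutativeSemigroup using (interchange)

  ∙-resp : ∀ {I J x y} → x ≈ y → x ∈ I ∙ J → y ∈ I ∙ J
  ∙-resp x≈y (n , u , v , u∈ , v∈ , eq) =
    n , u , v , u∈ , v∈ , trans (sym x≈y) eq

  ∙-cons : ∀ {I J u v x} → u ∈ I → v ∈ J → x ∈ I ∙ J → u * v + x ∈ I ∙ J
  ∙-cons {u = u₀} {v₀} u₀∈ v₀∈ (n , u , v , u∈ , v∈ , eq) =
    suc n , u₀ ∷ u , v₀ ∷ v ,
    (λ { zero → u₀∈ ; (suc i) → u∈ i }) , (λ { zero → v₀∈ ; (suc i) → v∈ i }) ,
    +-congˡ eq

  ∙-+ : ∀ {I J x} n (u v : Vector Carrier n) →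
        (∀ i → u i ∈ I) → (∀ i → v i ∈ J) → x ∈ I ∙ J →
        sum (zipWith _*_ u v) + x ∈ I ∙ J
  ∙-+ {I} {J} zero u v u∈ v∈ x∈ = ∙-resp {I} {J} (sym (+-identityˡ _)) x∈
  ∙-+ {I} {J} (suc n) u v u∈ v∈ x∈ = ∙-resp {I} {J} (sym (+-assoc _ _ _))
    (∙-cons {I} {J} (u∈ zero) (v∈ zero)
      (∙-+ {I} {J} n (u ∘ suc) (v ∘ suc) (u∈ ∘ suc) (v∈ ∘ suc) x∈))

  -- (I J)(I′ J′) ⊆ A B as soon as I I′ ⊆ A and J J′ ⊆ B elementwise.
  ∙-* : ∀ {I J I′ J′ A B} →
        (∀ {x y} → x ∈ I → y ∈ I′ → x * y ∈ A) →
        (∀ {x y} → x ∈ J → y ∈ J′ → x * y ∈ B) →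
        ∀ {x y} → x ∈ I ∙ J → y ∈ I′ ∙ J′ → x * y ∈ A ∙ B
  ∙-* {I} {J} {A = A} {B} f g {y = y} (m , u , v , u∈ , v∈ , x≈)
      (n , u′ , v′ , u′∈ , v′∈ , y≈) =
    ∙-resp {A} {B} (*-congʳ (sym x≈)) (go m u v u∈ v∈)
    where
    go : ∀ m (u v : Vector Carrier m) → (∀ i → u i ∈ I) → (∀ i → v i ∈ J) →
         sum (zipWith _*_ u v) * y ∈ A ∙ B
    go zero u v u∈ v∈ =
      0 , (λ ()) , (λ ()) , (λ ()) , (λ ()) , zeroˡ y
    go (suc m) u v u∈ v∈ = ∙-resp {A} {B}
      (sym (trans (distribʳ _ _ _) (+-congʳ (trans (*-congˡ y≈)
        (trans (*-distribˡ-sum _ (zipWith _*_ u′ v′))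
          (sum-cong-≋ (λ i →
            interchange (u zero) (v zero) (u′ i) (v′ i))))))))
      (∙-+ {A} {B} n (map (u zero *_) u′) (map (v zero *_) v′)
        (λ i → f (u∈ zero) (u′∈ i)) (λ i → g (v∈ zero) (v′∈ i))
        (go m (u ∘ suc) (v ∘ suc) (u∈ ∘ suc) (v∈ ∘ suc)))

  ∶-trans : ∀ {S} (I J L : IdealWithMultiplicatorRing S) →
            let open IdealWithMultiplicatorRing in
            ∀ {x y} → x ∈ ideal I ∶ ideal J → y ∈ ideal J ∶ ideal L →
            x * y ∈ ideal I ∶ ideal L
  ∶-trans I J L x∈ y∈ _ z∈ =
    IdealWithMultiplicatorRing.resp I (sym (*-assoc _ _ _)) (x∈ _ (y∈ _ z∈))

  weaklyEquivalent-refl : ∀ {S} (I : IdealWithMultiplicatorRing S) →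
    let open IdealWithMultiplicatorRing in WeaklyEquivalent (ideal I) (ideal I)
  weaklyEquivalent-refl I =
    1 , (λ _ → 1#) , (λ _ → 1#) , (λ _ → 1∈) , (λ _ → 1∈) ,
    sym (trans (+-identityʳ _) (*-identityˡ _))
    where
    open IdealWithMultiplicatorRing I
    1∈ : 1# ∈ ideal ∶ ideal
    1∈ _ y∈ = resp (sym (*-identityˡ _)) y∈

  weaklyEquivalent-sym : ∀ {I J} → WeaklyEquivalent I J → WeaklyEquivalent J I
  weaklyEquivalent-sym (n , u , v , u∈ , v∈ , eq) =
    n , v , u , v∈ , u∈ , trans eq (sum-cong-≋ (λ i → *-comm (u i) (v i)))

  weaklyEquivalent-trans : ∀ {S} (I J L : IdealWithMultiplicatorRing S) →
    let open IdealWithMultiplicatorRing in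
    WeaklyEquivalent (ideal I) (ideal J) →
    WeaklyEquivalent (ideal J) (ideal L) →
    WeaklyEquivalent (ideal I) (ideal L)
  weaklyEquivalent-trans I J L p q =
    ∙-resp {ideal I ∶ ideal L} {ideal L ∶ ideal I} (*-identityˡ 1#)
      (∙-* {ideal I ∶ ideal J} {ideal J ∶ ideal I}
           {ideal J ∶ ideal L} {ideal L ∶ ideal J}
           {ideal I ∶ ideal L} {ideal L ∶ ideal I}
        (∶-trans I J L)
        (λ x∈ y∈ _ z∈ → resp L (trans (sym (*-assoc _ _ _)) (*-congʳ (*-comm _ _)))
                             (y∈ _ (x∈ _ z∈)))
        p q)
    where open IdealWithMultiplicatorRing

  -- The equivalence classes of this setoid are the weak equivalence classes of
  -- fractional R-ideals with multiplicator ring S.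
  𝒲 : Subset → Setoid (lsuc κ) κ
  𝒲 S = record
    { Carrier       = IdealWithMultiplicatorRing S
    ; _≈_           = λ I J → WeaklyEquivalent (ideal I) (ideal J)
    ; isEquivalence = record
      { refl  = λ {I} → weaklyEquivalent-refl I
      ; sym   = λ {I} {J} → weaklyEquivalent-sym {ideal I} {ideal J}
      ; trans = λ {I} {J} {L} → weaklyEquivalent-trans I J L
      }
    }
    where open IdealWithMultiplicatorRing

{-# OPTIONS --safe #-}
module Submission where

-- Double duality for the trace form gives Sᵗ = I Iᵗ, so if Sᵗ T is invertible over T then so is I T,
-- that is 1 ∈ I (T : I). Choose an integer ν > 0 with ν T ⊆ S. As T/νT is finite, the invertible
-- ideal I T is principal modulo ν: there are x ∈ (T : I) and y ∈ I T with 1 - x y ∈ ν T. Then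
-- J = x I + ν T lies between ν T and T and satisfies J T = T, hence 𝔣 = 𝔣 T = 𝔣 J T = 𝔣 J ⊆ J; it is
-- weakly equivalent to I because x ∈ (J : I), y ∈ (I : J) and ν T ⊆ (I : J) (J : I).
-- Nondegeneracy of the trace form is not taken from the reducedness of K but from the
-- invertibility of Sᵗ T: the radical of the form lies in Sᵗ.

open import Defs
open import Level using (Level; _⊔_; lift)
open import Algebra.Bundles using (CommutativeRing)
open import Algebra.Morphism.Structures using (module RingMorphisms)
import Algebra.Properties.AbelianGroup as AbelianGroupProperties
import Algebra.Properties.Ring as RingProperties
import Algebra.Properties.Semiring.Exp as Exp
import Algebra.Properties.Semiring.Mult as Mult
import Algebra.Properties.Semiring.Mult.TCOptimised as Multᵒ
import Algebra.Properties.Semiring.Sum as Sum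
import Algebra.Solver.Ring as RingSolver
open import Algebra.Solver.Ring.AlmostCommutativeRing
  using (fromCommutativeRing; _-Raw-AlmostCommutative⟶_)
open import Data.Fin.Base as Fin using (Fin; zero; suc; toℕ)
import Data.Fin.Properties as Finₚ
open import Data.Integer.Base as ℤ using (ℤ; +_; -[1+_])
import Data.Integer.Divisibility.Signed as ℤᵈ
import Data.Integer.DivMod as ℤDivMod
import Data.Integer.Properties as ℤₚ
import Data.Integer.Solver as ℤS
open import Data.List.Base as List using (List; []; _∷_; _++_; cartesianProductWith; tabulate; length; lookup)
open import Data.List.Membership.Propositional using () renaming (_∈_ to _∈ₗ_)
open import Data.List.Membership.Propositional.Properties using
  ( ∈-++⁺ˡ; ∈-++⁺ʳ; ∈-++⁻; ∈-map⁺; ∈-map⁻; ∈-tabulate⁺; ∈-tabulate⁻; ∈-lookup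
  ; ∈-cartesianProductWith⁺; ∈-cartesianProductWith⁻ )
open import Data.List.Relation.Unary.All as All using (All; []; _∷_)
import Data.List.Relation.Unary.All.Properties as Allₚ
open import Data.List.Relation.Unary.Any using (here; there)
open import Data.Maybe.Base using (Maybe; just; nothing)
open import Data.Nat.Base as ℕ using (ℕ; zero; suc)
import Data.Nat.Coprimality as Coprimality
import Data.Nat.GCD as ℕgcd
import Data.Nat.Properties as ℕₚ
open import Data.Product.Base using (∃; ∃₂; _×_; _,_; proj₁; proj₂)
open import Data.Rational.Base as ℚ using (ℚ; 0ℚ; 1ℚ; ↥_; ↧_; toℚᵘ; mkℚ)
open import Data.Rational.Literals using (fromℤ)
import Data.Rational.Properties as ℚₚ
import Data.Rational.Solver as ℚS
import Data.Rational.Unnormalised.Base as ℚᵘ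
open import Data.Rational.Unnormalised.Base using (mkℚᵘ; *≡*)
import Data.Rational.Unnormalised.Properties as ℚᵘₚ
open import Data.Sum.Base using (_⊎_; inj₁; inj₂)
open import Data.Vec.Functional using (Vector; map; zipWith)
open import Function.Base using (_∘_)
open import Relation.Binary.Bundles using (Setoid)
open import Relation.Binary.PropositionalEquality as ≡ using (_≡_; _≢_)
import Relation.Binary.Reasoning.Setoid as SetoidReasoning
open import Relation.Nullary using (Dec; yes; no)
open import Relation.Nullary.Decidable using (decidable-stable)
open import Relation.Unary using (Pred; _∈_; _⊆_; _≐_)

-- Equality in `K` is not assumed decidable and no `ℚ`-basis of `K` is given: the trace is a
-- relation, and each `HasTrace` carries a basis of its own. A basis is therefore read off from an
-- element of `Sᵗ`, which exists unless `K` is the zero ring, and case distinctions are made on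
-- rational values of linear forms. Lattices are handled through generating lists: a linear form
-- cuts a lattice into its kernel and one further vector, because its image in `ℚ` is cyclic.
--
-- Double duality enters as `(I Iᵗ)ᵗ ⊆ (I : I)`. If `L` is the given inverse of `Sᵗ T`, then
-- `Iᵗ T L` lies in `(T : I)`, since `I Iᵗ ⊆ Sᵗ`, and so `1 ∈ Sᵗ T L` becomes `1 ∈ I (T : I)`.
--
-- Principality modulo `ν` is usually proved with the maximal ideals above `ν` and the Chinese
-- remainder theorem. Here idempotents of `T/νT` replace the maximal ideals: in a finite ring every
-- element has an idempotent power, and the terms of a relation `1 = Σ vⱼ uⱼ` are used up one by
-- one, each enlarging the idempotent that a single product `x y` represents.

private
  module ℚRing = RingProperties (CommutativeRing.ring ℚₚ.+-*-commutativeRing)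
  module ℚΣ = Sum (CommutativeRing.semiring ℚₚ.+-*-commutativeRing)

-- Integer scalars and a ring solver with integer coefficients.

module IntegerAction {c ℓ : Level} (A : CommutativeRing c ℓ) where
  open CommutativeRing A
  open Scalars A
  open Mult semiring using () renaming (_×_ to _×ᵤ_)
  open Multᵒ semiring using (×-homo-+; ×1-homo-*; ×ᵤ≈×; 1+×) renaming (_×_ to _×ₒ_)
  open RingProperties ring using (-‿distribˡ-*; -‿distribʳ-*; -‿involutive; -0#≈0#)
  open AbelianGroupProperties +-abelianGroup using (⁻¹-∙-comm)
  open SetoidReasoning setoid

  -- The optimised multiple makes `⟦ + 1 ⟧` reduce to `1#`, so that the solver constant `con (+ 1)`
  -- is literally the unit of the ring.
  ⟦_⟧ : ℤ → Carrier
  ⟦ + n ⟧      = n ×ₒ 1#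
  ⟦ -[1+ n ] ⟧ = - (suc n ×ₒ 1#)

  ⟦⊖⟧ : ∀ m n → ⟦ m ℤ.⊖ n ⟧ ≈ m ×ₒ 1# - n ×ₒ 1#
  ⟦⊖⟧ m zero = begin
    ⟦ m ℤ.⊖ 0 ⟧    ≡⟨ ≡.cong ⟦_⟧ (ℤₚ.⊖-≥ {m} {0} ℕ.z≤n) ⟩
    m ×ₒ 1#         ≈⟨ +-identityʳ _ ⟨
    m ×ₒ 1# + 0#    ≈⟨ +-congˡ -0#≈0# ⟨
    m ×ₒ 1# - 0#    ∎
  ⟦⊖⟧ zero (suc n) = sym (+-identityˡ _)
  ⟦⊖⟧ (suc m) (suc n) = begin
    ⟦ suc m ℤ.⊖ suc n ⟧                  ≡⟨ ≡.cong ⟦_⟧ (ℤₚ.[1+m]⊖[1+n]≡m⊖n m n) ⟩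
    ⟦ m ℤ.⊖ n ⟧                          ≈⟨ ⟦⊖⟧ m n ⟩
    m ×ₒ 1# - n ×ₒ 1#                      ≈⟨ +-congʳ (+-identityʳ _) ⟨
    m ×ₒ 1# + 0# - n ×ₒ 1#                 ≈⟨ +-congʳ (+-congˡ (-‿inverseʳ 1#)) ⟨
    m ×ₒ 1# + (1# - 1#) - n ×ₒ 1#          ≈⟨ +-congʳ (trans (sym (+-assoc _ _ _)) (+-congʳ (+-comm _ _))) ⟩
    1# + m ×ₒ 1# - 1# - n ×ₒ 1#            ≈⟨ +-assoc _ _ _ ⟩
    1# + m ×ₒ 1# + (- 1# - n ×ₒ 1#)        ≈⟨ +-congˡ (⁻¹-∙-comm _ _) ⟩
    1# + m ×ₒ 1# - (1# + n ×ₒ 1#)          ≈⟨ +-cong (1+× m 1#) (-‿cong (1+× n 1#)) ⟨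
    suc m ×ₒ 1# - suc n ×ₒ 1#              ∎

  ⟦⟧-homo-+ : ∀ i j → ⟦ i ℤ.+ j ⟧ ≈ ⟦ i ⟧ + ⟦ j ⟧
  ⟦⟧-homo-+ (+ m)    (+ n)    = ×-homo-+ 1# m n
  ⟦⟧-homo-+ (+ m)    -[1+ n ] = ⟦⊖⟧ m (suc n)
  ⟦⟧-homo-+ -[1+ m ] (+ n)    = trans (⟦⊖⟧ n (suc m)) (+-comm _ _)
  ⟦⟧-homo-+ -[1+ m ] -[1+ n ] = begin
    - (suc (suc (m ℕ.+ n)) ×ₒ 1#)    ≡⟨ ≡.cong (λ k → - (k ×ₒ 1#)) (≡.cong suc (≡.sym (ℕₚ.+-suc m n))) ⟩
    - ((suc m ℕ.+ suc n) ×ₒ 1#)      ≈⟨ -‿cong (×-homo-+ 1# (suc m) (suc n)) ⟩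
    - (suc m ×ₒ 1# + suc n ×ₒ 1#)     ≈⟨ ⁻¹-∙-comm _ _ ⟨
    - (suc m ×ₒ 1#) - suc n ×ₒ 1#     ∎

  ⟦⟧-homo-neg : ∀ i → ⟦ ℤ.- i ⟧ ≈ - ⟦ i ⟧
  ⟦⟧-homo-neg (+ zero)  = sym -0#≈0#
  ⟦⟧-homo-neg (+ suc n) = refl
  ⟦⟧-homo-neg -[1+ n ]  = sym (-‿involutive _)

  ⟦+⟧-homo-* : ∀ m j → ⟦ + m ℤ.* j ⟧ ≈ ⟦ + m ⟧ * ⟦ j ⟧
  ⟦+⟧-homo-* m (+ n) = trans (reflexive (≡.cong ⟦_⟧ (≡.sym (ℤₚ.pos-* m n)))) (×1-homo-* m n)
  ⟦+⟧-homo-* m -[1+ n ] = begin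
    ⟦ + m ℤ.* -[1+ n ] ⟧        ≡⟨ ≡.cong ⟦_⟧ (ℤₚ.neg-distribʳ-* (+ m) (+ suc n)) ⟨
    ⟦ ℤ.- (+ m ℤ.* + suc n) ⟧   ≈⟨ ⟦⟧-homo-neg (+ m ℤ.* + suc n) ⟩
    - ⟦ + m ℤ.* + suc n ⟧       ≈⟨ -‿cong (⟦+⟧-homo-* m (+ suc n)) ⟩
    - (⟦ + m ⟧ * ⟦ + suc n ⟧)   ≈⟨ -‿distribʳ-* _ _ ⟩
    ⟦ + m ⟧ * ⟦ -[1+ n ] ⟧      ∎

  ⟦⟧-homo-* : ∀ i j → ⟦ i ℤ.* j ⟧ ≈ ⟦ i ⟧ * ⟦ j ⟧
  ⟦⟧-homo-* (+ m) j = ⟦+⟧-homo-* m j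
  ⟦⟧-homo-* -[1+ m ] j = begin
    ⟦ -[1+ m ] ℤ.* j ⟧          ≡⟨ ≡.cong ⟦_⟧ (ℤₚ.neg-distribˡ-* (+ suc m) j) ⟨
    ⟦ ℤ.- (+ suc m ℤ.* j) ⟧     ≈⟨ ⟦⟧-homo-neg (+ suc m ℤ.* j) ⟩
    - ⟦ + suc m ℤ.* j ⟧         ≈⟨ -‿cong (⟦+⟧-homo-* (suc m) j) ⟩
    - (⟦ + suc m ⟧ * ⟦ j ⟧)     ≈⟨ -‿distribˡ-* _ _ ⟩
    ⟦ -[1+ m ] ⟧ * ⟦ j ⟧        ∎

  ×ᵤ≈⟦⟧* : ∀ n x → n ×ᵤ x ≈ ⟦ + n ⟧ * x
  ×ᵤ≈⟦⟧* n x = begin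
    n ×ᵤ x           ≈⟨ Mult.×-congʳ semiring n (*-identityˡ x) ⟨
    n ×ᵤ (1# * x)    ≈⟨ Mult.×-assoc-* semiring n 1# x ⟨
    (n ×ᵤ 1#) * x    ≈⟨ *-congʳ (×ᵤ≈× n 1#) ⟩
    (n ×ₒ 1#) * x     ∎

  ·ℤ≈⟦⟧* : ∀ z x → z ·ℤ x ≈ ⟦ z ⟧ * x
  ·ℤ≈⟦⟧* (+ n)    x = ×ᵤ≈⟦⟧* n x
  ·ℤ≈⟦⟧* -[1+ n ] x = trans (-‿cong (×ᵤ≈⟦⟧* (suc n) x)) (-‿distribˡ-* _ _)

  ℤ⟶A : CommutativeRing.rawRing ℤₚ.+-*-commutativeRing -Raw-AlmostCommutative⟶ fromCommutativeRing A
  ℤ⟶A = record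
    { ⟦_⟧    = ⟦_⟧
    ; +-homo = ⟦⟧-homo-+
    ; *-homo = ⟦⟧-homo-*
    ; -‿homo = ⟦⟧-homo-neg
    ; 0-homo = refl
    ; 1-homo = refl
    }

  ⟦⟧-weaklyDecidable : ∀ i j → Maybe (⟦ i ⟧ ≈ ⟦ j ⟧)
  ⟦⟧-weaklyDecidable i j with i ℤₚ.≟ j
  ... | yes i≡j = just (reflexive (≡.cong ⟦_⟧ i≡j))
  ... | no  _   = nothing

  module Solver = RingSolver
    (CommutativeRing.rawRing ℤₚ.+-*-commutativeRing) (fromCommutativeRing A) ℤ⟶A ⟦⟧-weaklyDecidable

  -- Indexed by the predecessor, in step with `denominator-1`: `d ⁻¹` inverts `suc d`.
  record PositiveIntegersInvertible : Set (c ⊔ ℓ) where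
    field
      _⁻¹        : ℕ → Carrier
      ⁻¹-inverse : ∀ d → ⟦ + suc d ⟧ * d ⁻¹ ≈ 1#

-- The homomorphism from the rationals to a ring in which positive integers are invertible.

module RationalScalars {c ℓ : Level} (K : CommutativeRing c ℓ)
  (invertible : IntegerAction.PositiveIntegersInvertible K) where
  open CommutativeRing K
  open IntegerAction K
  open PositiveIntegersInvertible invertible
  open Solver using (solve; _:+_; _:*_; _:=_; _:-_)
  open SetoidReasoning setoid

  -- Defined before normalisation: for unnormalised fractions the numerator and denominator of a sum
  -- or product are explicit, and compatibility with `≃` then carries the laws over to `ℚ`.
  φᵘ : ℚᵘ.ℚᵘ → Carrier
  φᵘ (mkℚᵘ n d) = ⟦ n ⟧ * d ⁻¹

  φ : ℚ → Carrier
  φ q = φᵘ (toℚᵘ q)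

  clear : ∀ p → ⟦ ℚᵘ.↧ p ⟧ * φᵘ p ≈ ⟦ ℚᵘ.↥ p ⟧
  clear (mkℚᵘ n d) = begin
    ⟦ + suc d ⟧ * (⟦ n ⟧ * d ⁻¹)  ≈⟨ solve 3 (λ a b c → a :* (b :* c) := b :* (a :* c)) refl _ _ _ ⟩
    ⟦ n ⟧ * (⟦ + suc d ⟧ * d ⁻¹)  ≈⟨ *-congˡ (⁻¹-inverse d) ⟩
    ⟦ n ⟧ * 1#                    ≈⟨ *-identityʳ _ ⟩
    ⟦ n ⟧                         ∎

  ↧-cancel : ∀ p x y → ⟦ ℚᵘ.↧ p ⟧ * x ≈ ⟦ ℚᵘ.↧ p ⟧ * y → x ≈ y
  ↧-cancel (mkℚᵘ n d) x y eq = begin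
    x                            ≈⟨ inv x ⟨
    d ⁻¹ * (⟦ + suc d ⟧ * x)     ≈⟨ *-congˡ eq ⟩
    d ⁻¹ * (⟦ + suc d ⟧ * y)     ≈⟨ inv y ⟩
    y                            ∎
    where
    inv : ∀ z → d ⁻¹ * (⟦ + suc d ⟧ * z) ≈ z
    inv z = begin
      d ⁻¹ * (⟦ + suc d ⟧ * z)  ≈⟨ solve 3 (λ a b c → a :* (b :* c) := (b :* a) :* c) refl _ _ _ ⟩
      (⟦ + suc d ⟧ * d ⁻¹) * z  ≈⟨ *-congʳ (⁻¹-inverse d) ⟩
      1# * z                    ≈⟨ *-identityˡ z ⟩
      z                         ∎

  φᵘ-cong : ∀ {p q} → p ℚᵘ.≃ q → φᵘ p ≈ φᵘ q
  φᵘ-cong {p} {q} (*≡* eq) = ↧-cancel p _ _ (↧-cancel q _ _ (begin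
    ⟦ ℚᵘ.↧ q ⟧ * (⟦ ℚᵘ.↧ p ⟧ * φᵘ p)  ≈⟨ *-congˡ (clear p) ⟩
    ⟦ ℚᵘ.↧ q ⟧ * ⟦ ℚᵘ.↥ p ⟧           ≈⟨ *-comm _ _ ⟩
    ⟦ ℚᵘ.↥ p ⟧ * ⟦ ℚᵘ.↧ q ⟧           ≈⟨ ⟦⟧-homo-* (ℚᵘ.↥ p) (ℚᵘ.↧ q) ⟨
    ⟦ ℚᵘ.↥ p ℤ.* ℚᵘ.↧ q ⟧             ≡⟨ ≡.cong ⟦_⟧ eq ⟩
    ⟦ ℚᵘ.↥ q ℤ.* ℚᵘ.↧ p ⟧             ≈⟨ ⟦⟧-homo-* (ℚᵘ.↥ q) (ℚᵘ.↧ p) ⟩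
    ⟦ ℚᵘ.↥ q ⟧ * ⟦ ℚᵘ.↧ p ⟧           ≈⟨ *-congʳ (clear q) ⟨
    ⟦ ℚᵘ.↧ q ⟧ * φᵘ q * ⟦ ℚᵘ.↧ p ⟧    ≈⟨ solve 3 (λ a b c → a :* b :* c := a :* (c :* b)) refl _ _ _ ⟩
    ⟦ ℚᵘ.↧ q ⟧ * (⟦ ℚᵘ.↧ p ⟧ * φᵘ q)  ∎))

  φᵘ-homo-+ : ∀ p q → φᵘ (p ℚᵘ.+ q) ≈ φᵘ p + φᵘ q
  φᵘ-homo-+ p@record{} q@record{} = ↧-cancel (p ℚᵘ.+ q) _ _ (begin
    ⟦ ℚᵘ.↧ (p ℚᵘ.+ q) ⟧ * φᵘ (p ℚᵘ.+ q)   ≈⟨ clear (p ℚᵘ.+ q) ⟩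
    ⟦ n ℤ.* e ℤ.+ m ℤ.* d ⟧               ≈⟨ ⟦⟧-homo-+ (n ℤ.* e) (m ℤ.* d) ⟩
    ⟦ n ℤ.* e ⟧ + ⟦ m ℤ.* d ⟧             ≈⟨ +-cong (⟦⟧-homo-* n e) (⟦⟧-homo-* m d) ⟩
    ⟦ n ⟧ * ⟦ e ⟧ + ⟦ m ⟧ * ⟦ d ⟧         ≈⟨ +-cong (*-congʳ (clear p)) (*-congʳ (clear q)) ⟨
    (⟦ d ⟧ * φᵘ p) * ⟦ e ⟧ + (⟦ e ⟧ * φᵘ q) * ⟦ d ⟧
      ≈⟨ solve 4 (λ d e x y → (d :* x) :* e :+ (e :* y) :* d := (d :* e) :* (x :+ y)) refl _ _ _ _ ⟩
    (⟦ d ⟧ * ⟦ e ⟧) * (φᵘ p + φᵘ q)       ≈⟨ *-congʳ (⟦⟧-homo-* d e) ⟨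
    ⟦ ℚᵘ.↧ (p ℚᵘ.+ q) ⟧ * (φᵘ p + φᵘ q)   ∎)
    where n = ℚᵘ.↥ p; d = ℚᵘ.↧ p; m = ℚᵘ.↥ q; e = ℚᵘ.↧ q

  φᵘ-homo-* : ∀ p q → φᵘ (p ℚᵘ.* q) ≈ φᵘ p * φᵘ q
  φᵘ-homo-* p@record{} q@record{} = ↧-cancel (p ℚᵘ.* q) _ _ (begin
    ⟦ ℚᵘ.↧ (p ℚᵘ.* q) ⟧ * φᵘ (p ℚᵘ.* q)   ≈⟨ clear (p ℚᵘ.* q) ⟩
    ⟦ n ℤ.* m ⟧                           ≈⟨ ⟦⟧-homo-* n m ⟩
    ⟦ n ⟧ * ⟦ m ⟧                         ≈⟨ *-cong (clear p) (clear q) ⟨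
    (⟦ d ⟧ * φᵘ p) * (⟦ e ⟧ * φᵘ q)
      ≈⟨ solve 4 (λ d e x y → (d :* x) :* (e :* y) := (d :* e) :* (x :* y)) refl _ _ _ _ ⟩
    (⟦ d ⟧ * ⟦ e ⟧) * (φᵘ p * φᵘ q)       ≈⟨ *-congʳ (⟦⟧-homo-* d e) ⟨
    ⟦ ℚᵘ.↧ (p ℚᵘ.* q) ⟧ * (φᵘ p * φᵘ q)   ∎)
    where n = ℚᵘ.↥ p; d = ℚᵘ.↧ p; m = ℚᵘ.↥ q; e = ℚᵘ.↧ q

  φ-homo-+ : ∀ p q → φ (p ℚ.+ q) ≈ φ p + φ q
  φ-homo-+ p q = trans (φᵘ-cong (ℚₚ.toℚᵘ-homo-+ p q)) (φᵘ-homo-+ (toℚᵘ p) (toℚᵘ q))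

  φ-homo-* : ∀ p q → φ (p ℚ.* q) ≈ φ p * φ q
  φ-homo-* p q = trans (φᵘ-cong (ℚₚ.toℚᵘ-homo-* p q)) (φᵘ-homo-* (toℚᵘ p) (toℚᵘ q))

  φ-fromℤ : ∀ z → φ (fromℤ z) ≈ ⟦ z ⟧
  φ-fromℤ z = trans (sym (*-identityˡ _)) (clear (mkℚᵘ z 0))

  φ-1 : φ 1ℚ ≈ 1#
  φ-1 = φ-fromℤ (+ 1)

  φ-0 : φ 0ℚ ≈ 0#
  φ-0 = zeroˡ _

  φ-homo-neg : ∀ q → φ (ℚ.- q) ≈ - φ q
  φ-homo-neg q = begin
    φ (ℚ.- q)                   ≈⟨ solve 2 (λ a b → a := (a :+ b) :- b) refl _ _ ⟩
    φ (ℚ.- q) + φ q - φ q       ≈⟨ +-congʳ (φ-homo-+ (ℚ.- q) q) ⟨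
    φ (ℚ.- q ℚ.+ q) - φ q       ≡⟨ ≡.cong (λ r → φ r - φ q) (ℚₚ.+-inverseˡ q) ⟩
    φ 0ℚ - φ q                  ≈⟨ +-congʳ φ-0 ⟩
    0# - φ q                    ≈⟨ +-identityˡ _ ⟩
    - φ q                       ∎

-- Integers inside the rationals, and cyclic subgroups of the rationals.

fromℤ-+ : ∀ i j → fromℤ (i ℤ.+ j) ≡ fromℤ i ℚ.+ fromℤ j
fromℤ-+ i j = ℚₚ.toℚᵘ-injective (ℚᵘₚ.≃-trans
  (*≡* (≡.cong (ℤ._* + 1) (≡.sym (≡.cong₂ ℤ._+_ (ℤₚ.*-identityʳ i) (ℤₚ.*-identityʳ j)))))
  (ℚᵘₚ.≃-sym (ℚₚ.toℚᵘ-homo-+ (fromℤ i) (fromℤ j))))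

fromℤ-* : ∀ i j → fromℤ (i ℤ.* j) ≡ fromℤ i ℚ.* fromℤ j
fromℤ-* i j = ℚₚ.toℚᵘ-injective (ℚᵘₚ.≃-sym (ℚₚ.toℚᵘ-homo-* (fromℤ i) (fromℤ j)))

fromℤ-neg : ∀ i → fromℤ (ℤ.- i) ≡ ℚ.- fromℤ i
fromℤ-neg (+ zero)  = ≡.refl
fromℤ-neg (+ suc _) = ≡.refl
fromℤ-neg -[1+ _ ]  = ≡.refl

1/suc : ℕ → ℚ
1/suc d = mkℚ (+ 1) d (Coprimality.1-coprimeTo (suc d))

fromℤ-1/suc : ∀ d → fromℤ (+ suc d) ℚ.* 1/suc d ≡ 1ℚ
fromℤ-1/suc d = ℚₚ.toℚᵘ-injective (ℚᵘₚ.≃-trans (ℚₚ.toℚᵘ-homo-* (fromℤ (+ suc d)) (1/suc d))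
  (*≡* (≡.cong (λ k → + suc k) (≡.trans
    (≡.trans (≡.cong (ℕ._* 1) (ℕₚ.*-identityʳ d)) (ℕₚ.*-identityʳ d))
    (≡.sym (≡.trans (ℕₚ.+-identityʳ (d ℕ.+ 0)) (ℕₚ.+-identityʳ d)))))))

↥*1/suc : ∀ p → p ≡ fromℤ (↥ p) ℚ.* 1/suc (ℚ.ℚ.denominator-1 p)
↥*1/suc p@(mkℚ n d _) = ℚₚ.toℚᵘ-injective (ℚᵘₚ.≃-sym (ℚᵘₚ.≃-trans (ℚₚ.toℚᵘ-homo-* (fromℤ n) (1/suc d))
  (*≡* (≡.cong₂ ℤ._*_ (ℤₚ.*-identityʳ n) (≡.cong (λ k → + suc k) (≡.sym (ℕₚ.+-identityʳ d)))))))

bézout-ℤ : ∀ a c → ∃ λ d → (∃₂ λ i j → d ≡ i ℤ.* a ℤ.+ j ℤ.* c) × d ℤᵈ.∣ a × d ℤᵈ.∣ c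
bézout-ℤ a c with ℕgcd.Bézout.lemma ℤ.∣ a ∣ ℤ.∣ c ∣
... | ℕgcd.Bézout.result d g identity =
  + d , combination identity , ℤᵈ.∣ᵤ⇒∣ (proj₁ (GCD.commonDivisor g)) , ℤᵈ.∣ᵤ⇒∣ (proj₂ (GCD.commonDivisor g))
  where
  module GCD = ℕgcd.GCD
  open ℤS.+-*-Solver
  open ≡.≡-Reasoning

  scale-abs : ∀ n i → ∃ λ k → + (n ℕ.* ℤ.∣ i ∣) ≡ k ℤ.* i
  scale-abs n i with ℤₚ.+∣i∣≡i⊎+∣i∣≡-i i
  ... | inj₁ eq = + n , ≡.trans (ℤₚ.pos-* n _) (≡.cong (+ n ℤ.*_) eq)
  ... | inj₂ eq = ℤ.- (+ n) , ≡.trans (ℤₚ.pos-* n _) (≡.trans (≡.cong (+ n ℤ.*_) eq)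
    (≡.trans (≡.sym (ℤₚ.neg-distribʳ-* (+ n) i)) (ℤₚ.neg-distribˡ-* (+ n) i)))

  subtract : ∀ x y z → + x ℤ.+ y ≡ z → + x ≡ z ℤ.+ ℤ.- y
  subtract x y z eq = ≡.trans (solve 2 (λ x y → x := (x :+ y) :+ (:- y)) ≡.refl (+ x) y) (≡.cong (ℤ._+ ℤ.- y) eq)

  combination : ℕgcd.Bézout.Identity d ℤ.∣ a ∣ ℤ.∣ c ∣ → ∃₂ λ i j → + d ≡ i ℤ.* a ℤ.+ j ℤ.* c
  combination (ℕgcd.Bézout.+- x y eq) with scale-abs x a | scale-abs y c
  ... | i , i-eq | j , j-eq = i , ℤ.- j , (begin
    + d                            ≡⟨ subtract d (+ (y ℕ.* ℤ.∣ c ∣)) _ (≡.cong +_ eq) ⟩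
    + (x ℕ.* ℤ.∣ a ∣) ℤ.+ ℤ.- + (y ℕ.* ℤ.∣ c ∣)  ≡⟨ ≡.cong₂ (λ u v → u ℤ.+ ℤ.- v) i-eq j-eq ⟩
    i ℤ.* a ℤ.+ ℤ.- (j ℤ.* c)      ≡⟨ ≡.cong (λ w → i ℤ.* a ℤ.+ w) (ℤₚ.neg-distribˡ-* j c) ⟩
    i ℤ.* a ℤ.+ ℤ.- j ℤ.* c        ∎)
  combination (ℕgcd.Bézout.-+ x y eq) with scale-abs x a | scale-abs y c
  ... | i , i-eq | j , j-eq = ℤ.- i , j , (begin
    + d                            ≡⟨ subtract d (+ (x ℕ.* ℤ.∣ a ∣)) _ (≡.cong +_ eq) ⟩
    + (y ℕ.* ℤ.∣ c ∣) ℤ.+ ℤ.- + (x ℕ.* ℤ.∣ a ∣)  ≡⟨ ≡.cong₂ (λ u v → u ℤ.+ ℤ.- v) j-eq i-eq ⟩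
    j ℤ.* c ℤ.+ ℤ.- (i ℤ.* a)
      ≡⟨ solve 4 (λ i a j c → j :* c :+ (:- (i :* a)) := (:- i) :* a :+ j :* c) ≡.refl i a j c ⟩
    ℤ.- i ℤ.* a ℤ.+ j ℤ.* c        ∎)

over-common-denominator : ∀ p q → let m = ℚ.ℚ.denominator-1 p; n = ℚ.ℚ.denominator-1 q in
  p ≡ fromℤ (↥ p ℤ.* ↧ q) ℚ.* (1/suc m ℚ.* 1/suc n)
over-common-denominator p q = begin
  p                                       ≡⟨ ↥*1/suc p ⟩
  fromℤ (↥ p) ℚ.* 1/suc m                 ≡⟨ ℚₚ.*-identityʳ _ ⟨
  fromℤ (↥ p) ℚ.* 1/suc m ℚ.* 1ℚ          ≡⟨ ≡.cong ((fromℤ (↥ p) ℚ.* 1/suc m) ℚ.*_) (fromℤ-1/suc n) ⟨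
  fromℤ (↥ p) ℚ.* 1/suc m ℚ.* (fromℤ (↧ q) ℚ.* 1/suc n)
    ≡⟨ solve 4 (λ a b c e → a :* b :* (c :* e) := (a :* c) :* (b :* e)) ≡.refl
         (fromℤ (↥ p)) (1/suc m) (fromℤ (↧ q)) (1/suc n) ⟩
  (fromℤ (↥ p) ℚ.* fromℤ (↧ q)) ℚ.* (1/suc m ℚ.* 1/suc n)
    ≡⟨ ≡.cong (ℚ._* (1/suc m ℚ.* 1/suc n)) (fromℤ-* (↥ p) (↧ q)) ⟨
  fromℤ (↥ p ℤ.* ↧ q) ℚ.* (1/suc m ℚ.* 1/suc n)  ∎
  where
  open ≡.≡-Reasoning
  open ℚS.+-*-Solver
  m = ℚ.ℚ.denominator-1 p
  n = ℚ.ℚ.denominator-1 q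

-- Over a common denominator both numbers are integer multiples of one rational, so the integral
-- Bézout identity applies to the numerators. This is what makes the image of a lattice under a
-- linear form cyclic; the generator `d` may be zero.
bézout-ℚ : ∀ p q → ∃₂ λ i j → ∃₂ λ k l → let d = fromℤ i ℚ.* p ℚ.+ fromℤ j ℚ.* q in
           p ≡ fromℤ k ℚ.* d × q ≡ fromℤ l ℚ.* d
bézout-ℚ p q with bézout-ℤ (↥ p ℤ.* ↧ q) (↥ q ℤ.* ↧ p)
... | d , (i , j , d≡) , ℤᵈ.divides k a≡ , ℤᵈ.divides l c≡ =
  i , j , k , l , ≡.trans (multiple k a≡ p≡) (≡.cong (fromℤ k ℚ.*_) (≡.sym d≡′)) ,
                  ≡.trans (multiple l c≡ q≡) (≡.cong (fromℤ l ℚ.*_) (≡.sym d≡′))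
  where
  open ≡.≡-Reasoning
  open ℚS.+-*-Solver
  m = ℚ.ℚ.denominator-1 p
  n = ℚ.ℚ.denominator-1 q
  u = 1/suc m ℚ.* 1/suc n

  p≡ : p ≡ fromℤ (↥ p ℤ.* ↧ q) ℚ.* u
  p≡ = over-common-denominator p q
  q≡ : q ≡ fromℤ (↥ q ℤ.* ↧ p) ℚ.* u
  q≡ = ≡.trans (over-common-denominator q p) (≡.cong (fromℤ (↥ q ℤ.* ↧ p) ℚ.*_) (ℚₚ.*-comm (1/suc n) (1/suc m)))

  d≡′ : fromℤ i ℚ.* p ℚ.+ fromℤ j ℚ.* q ≡ fromℤ d ℚ.* u
  d≡′ = begin
    fromℤ i ℚ.* p ℚ.+ fromℤ j ℚ.* q  ≡⟨ ≡.cong₂ (λ x y → fromℤ i ℚ.* x ℚ.+ fromℤ j ℚ.* y) p≡ q≡ ⟩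
    fromℤ i ℚ.* (fromℤ (↥ p ℤ.* ↧ q) ℚ.* u) ℚ.+ fromℤ j ℚ.* (fromℤ (↥ q ℤ.* ↧ p) ℚ.* u)
      ≡⟨ solve 5 (λ i a j b u → i :* (a :* u) :+ j :* (b :* u) := (i :* a :+ j :* b) :* u) ≡.refl
           (fromℤ i) (fromℤ (↥ p ℤ.* ↧ q)) (fromℤ j) (fromℤ (↥ q ℤ.* ↧ p)) u ⟩
    (fromℤ i ℚ.* fromℤ (↥ p ℤ.* ↧ q) ℚ.+ fromℤ j ℚ.* fromℤ (↥ q ℤ.* ↧ p)) ℚ.* u
      ≡⟨ ≡.cong (ℚ._* u) (≡.cong₂ ℚ._+_ (fromℤ-* i _) (fromℤ-* j _)) ⟨
    (fromℤ (i ℤ.* (↥ p ℤ.* ↧ q)) ℚ.+ fromℤ (j ℤ.* (↥ q ℤ.* ↧ p))) ℚ.* u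
      ≡⟨ ≡.cong (ℚ._* u) (≡.trans (≡.cong fromℤ d≡) (fromℤ-+ (i ℤ.* (↥ p ℤ.* ↧ q)) (j ℤ.* (↥ q ℤ.* ↧ p)))) ⟨
    fromℤ d ℚ.* u                    ∎

  multiple : ∀ {x y} k → y ≡ k ℤ.* d → x ≡ fromℤ y ℚ.* u → x ≡ fromℤ k ℚ.* (fromℤ d ℚ.* u)
  multiple {x} {y} k y≡ x≡ = begin
    x                                ≡⟨ x≡ ⟩
    fromℤ y ℚ.* u                    ≡⟨ ≡.cong (λ w → fromℤ w ℚ.* u) y≡ ⟩
    fromℤ (k ℤ.* d) ℚ.* u            ≡⟨ ≡.cong (ℚ._* u) (fromℤ-* k d) ⟩
    fromℤ k ℚ.* fromℤ d ℚ.* u        ≡⟨ ℚₚ.*-assoc (fromℤ k) (fromℤ d) u ⟩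
    fromℤ k ℚ.* (fromℤ d ℚ.* u)      ∎

inverse-ℚ : ∀ p → p ≢ 0ℚ → ∃ λ r → r ℚ.* p ≡ 1ℚ
inverse-ℚ p p≢0 = ℚ.1/_ p {{ℚ.≢-nonZero p≢0}} , ℚₚ.*-inverseˡ p {{ℚ.≢-nonZero p≢0}}

½-not-integral : ∀ z → 1/suc 1 ≢ fromℤ z
½-not-integral z ()

-- With q = 1/p the hypothesis makes d invertible, and then q = hd/p makes any h integral.
common-multiples⇒integral : ∀ p d r → r ℚ.* p ≡ 1ℚ → (∀ q → ∃ λ z → q ℚ.* p ≡ fromℤ z ℚ.* d) →
                            ∀ h → ∃ λ w → h ≡ fromℤ w
common-multiples⇒integral p d r rp≡1 multiple h with multiple r | multiple (h ℚ.* d ℚ.* r)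
... | z , rp≡zd | w , hdrp≡wd = w , (begin
  h                                          ≡⟨ ≡.trans (ℚₚ.*-identityʳ (h ℚ.* 1ℚ)) (ℚₚ.*-identityʳ h) ⟨
  h ℚ.* 1ℚ ℚ.* 1ℚ                            ≡⟨ ≡.cong₂ (λ u v → h ℚ.* u ℚ.* v) zd≡1 rp≡1 ⟨
  h ℚ.* (fromℤ z ℚ.* d) ℚ.* (r ℚ.* p)
    ≡⟨ solve 5 (λ h z d r p → h :* (z :* d) :* (r :* p) := z :* ((h :* d :* r) :* p)) ≡.refl h (fromℤ z) d r p ⟩
  fromℤ z ℚ.* (h ℚ.* d ℚ.* r ℚ.* p)          ≡⟨ ≡.cong (fromℤ z ℚ.*_) hdrp≡wd ⟩
  fromℤ z ℚ.* (fromℤ w ℚ.* d)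
    ≡⟨ solve 3 (λ z w d → z :* (w :* d) := w :* (z :* d)) ≡.refl (fromℤ z) (fromℤ w) d ⟩
  fromℤ w ℚ.* (fromℤ z ℚ.* d)                ≡⟨ ≡.cong (fromℤ w ℚ.*_) zd≡1 ⟩
  fromℤ w ℚ.* 1ℚ                             ≡⟨ ℚₚ.*-identityʳ (fromℤ w) ⟩
  fromℤ w                                    ∎)
  where
  open ≡.≡-Reasoning
  open ℚS.+-*-Solver
  zd≡1 : fromℤ z ℚ.* d ≡ 1ℚ
  zd≡1 = ≡.trans (≡.sym rp≡zd) rp≡1

-- Otherwise ½ would be an integer: a line over `ℚ` does not fit into a cyclic group. Equality of
-- rationals is decidable, so arguing by contradiction is legitimate here.
common-multiples⇒zero : ∀ p d → (∀ q → ∃ λ z → q ℚ.* p ≡ fromℤ z ℚ.* d) → p ≡ 0ℚ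
common-multiples⇒zero p d multiple = decidable-stable (p ℚₚ.≟ 0ℚ) λ p≢0 →
  let r , rp≡1 = inverse-ℚ p p≢0
      w , ½≡w  = common-multiples⇒integral p d r rp≡1 multiple (1/suc 1)
  in ½-not-integral w ½≡w

-- Additive subgroups and their generators.

module Subgroups {c ℓ : Level} (K : CommutativeRing c ℓ) where
  open CommutativeRing K hiding (zero)
  open IntegerAction K
  open Solver using (solve; con; _:+_; _:*_; :-_; _:=_; _:-_)
  open RingProperties ring using (-‿distribˡ-*)

  record IsSubgroup {h : Level} (H : Pred Carrier h) : Set (c ⊔ ℓ ⊔ h) where
    field
      resp     : ∀ {x y} → x ≈ y → x ∈ H → y ∈ H
      0∈       : 0# ∈ H
      +-closed : ∀ {x y} → x ∈ H → y ∈ H → x + y ∈ H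
      neg-closed : ∀ {x} → x ∈ H → - x ∈ H

    ℕ-closed : ∀ n {x} → x ∈ H → ⟦ + n ⟧ * x ∈ H
    ℕ-closed zero    _  = resp (sym (zeroˡ _)) 0∈
    ℕ-closed (suc n) x∈ = resp (trans (+-congʳ (sym (*-identityˡ _)))
      (trans (sym (distribʳ _ _ _)) (*-congʳ (sym (⟦⟧-homo-+ (+ 1) (+ n))))))
      (+-closed x∈ (ℕ-closed n x∈))

    ℤ-closed : ∀ z {x} → x ∈ H → ⟦ z ⟧ * x ∈ H
    ℤ-closed (+ n)    x∈ = ℕ-closed n x∈
    ℤ-closed -[1+ n ] x∈ = resp (-‿distribˡ-* _ _) (neg-closed (ℕ-closed (suc n) x∈))

  -- The preimage of `H` under multiplication by `y`. It lets statements about products be proved by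
  -- induction on the generators of one factor at a time.
  times-isSubgroup : ∀ {h : Level} {H : Pred Carrier h} → IsSubgroup H → ∀ y → IsSubgroup (λ x → x * y ∈ H)
  times-isSubgroup H-isSubgroup y = record
    { resp       = λ x≈x′ → resp (*-congʳ x≈x′)
    ; 0∈         = resp (sym (zeroˡ y)) 0∈
    ; +-closed   = λ {x} {x′} x∈ x′∈ → resp (sym (distribʳ y x x′)) (+-closed x∈ x′∈)
    ; neg-closed = λ {x} x∈ → resp (solve 2 (λ x y → :- (x :* y) := (:- x) :* y) refl x y) (neg-closed x∈)
    }
    where open IsSubgroup H-isSubgroup

  -- An inductive closure rather than a set of integer combinations: by `⟨⟩-least` a claim holds for
  -- all elements once it defines a subgroup containing the generators. Arbitrary predicates are
  -- allowed as generators, so that rational spans and products of lattices fit in.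
  data ⟨_⟩ {g : Level} (G : Pred Carrier g) : Pred Carrier (c ⊔ ℓ ⊔ g) where
    generator : ∀ {x} → x ∈ G → x ∈ ⟨ G ⟩
    ⟨⟩-0      : 0# ∈ ⟨ G ⟩
    ⟨⟩-+      : ∀ {x y} → x ∈ ⟨ G ⟩ → y ∈ ⟨ G ⟩ → x + y ∈ ⟨ G ⟩
    ⟨⟩-neg    : ∀ {x} → x ∈ ⟨ G ⟩ → - x ∈ ⟨ G ⟩
    ⟨⟩-resp   : ∀ {x y} → x ≈ y → x ∈ ⟨ G ⟩ → y ∈ ⟨ G ⟩

  ⟨⟩-isSubgroup : ∀ {g : Level} {G : Pred Carrier g} → IsSubgroup ⟨ G ⟩
  ⟨⟩-isSubgroup = record { resp = ⟨⟩-resp ; 0∈ = ⟨⟩-0 ; +-closed = ⟨⟩-+ ; neg-closed = ⟨⟩-neg }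

  ⟨⟩-least : ∀ {g h : Level} {G : Pred Carrier g} {H : Pred Carrier h} → IsSubgroup H → G ⊆ H → ⟨ G ⟩ ⊆ H
  ⟨⟩-least {G = G} {H} H-isSubgroup G⊆H = go
    where
    open IsSubgroup H-isSubgroup
    go : ⟨ G ⟩ ⊆ H
    go (generator x∈)  = G⊆H x∈
    go ⟨⟩-0            = 0∈
    go (⟨⟩-+ x∈ y∈)    = +-closed (go x∈) (go y∈)
    go (⟨⟩-neg x∈)     = neg-closed (go x∈)
    go (⟨⟩-resp x≈ x∈) = resp x≈ (go x∈)

  ⟨_⟩ₗ : List Carrier → Pred Carrier (c ⊔ ℓ)
  ⟨ gs ⟩ₗ = ⟨ _∈ₗ gs ⟩

  ⟨[]⟩-trivial : ∀ {x} → x ∈ ⟨ [] ⟩ₗ → x ≈ 0#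
  ⟨[]⟩-trivial = ⟨⟩-least {H = _≈ 0#} (record
    { resp = λ x≈y x≈0 → trans (sym x≈y) x≈0
    ; 0∈ = refl
    ; +-closed = λ x≈0 y≈0 → trans (+-cong x≈0 y≈0) (+-identityʳ 0#)
    ; neg-closed = λ x≈0 → trans (-‿cong x≈0) (solve 0 (:- con (+ 0) := con (+ 0)) refl)
    }) (λ ())

  ⟨∷⟩⁺ : ∀ {g gs} → ⟨ gs ⟩ₗ ⊆ ⟨ g ∷ gs ⟩ₗ
  ⟨∷⟩⁺ = ⟨⟩-least ⟨⟩-isSubgroup (λ x∈ → generator (there x∈))

  ⟨∷⟩⁻ : ∀ {g gs x} → x ∈ ⟨ g ∷ gs ⟩ₗ → ∃₂ λ z y → y ∈ ⟨ gs ⟩ₗ × x ≈ ⟦ z ⟧ * g + y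
  ⟨∷⟩⁻ {g} {gs} = ⟨⟩-least {H = λ x → ∃₂ λ z y → y ∈ ⟨ gs ⟩ₗ × x ≈ ⟦ z ⟧ * g + y} (record
    { resp = λ { x≈y (z , y , y∈ , x≈) → z , y , y∈ , trans (sym x≈y) x≈ }
    ; 0∈ = + 0 , 0# , ⟨⟩-0 , solve 1 (λ g → con (+ 0) := con (+ 0) :* g :+ con (+ 0)) refl g
    ; +-closed = λ { (z , y , y∈ , x≈) (z′ , y′ , y′∈ , x′≈) → z ℤ.+ z′ , y + y′ , ⟨⟩-+ y∈ y′∈ ,
        trans (+-cong x≈ x′≈) (trans
          (solve 5 (λ z z′ g y y′ → (z :* g :+ y) :+ (z′ :* g :+ y′) := (z :+ z′) :* g :+ (y :+ y′)) refl _ _ _ _ _)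
          (+-congʳ (*-congʳ (sym (⟦⟧-homo-+ z z′))))) }
    ; neg-closed = λ { (z , y , y∈ , x≈) → ℤ.- z , - y , ⟨⟩-neg y∈ ,
        trans (-‿cong x≈) (trans
          (solve 3 (λ z g y → :- (z :* g :+ y) := (:- z) :* g :+ (:- y)) refl _ _ _)
          (+-congʳ (*-congʳ (sym (⟦⟧-homo-neg z))))) }
    })
    (λ { (here ≡.refl) → + 1 , 0# , ⟨⟩-0 , trans (sym (*-identityˡ g)) (sym (+-identityʳ _))
       ; (there x∈) → + 0 , _ , generator x∈ , sym (trans (+-congʳ (zeroˡ g)) (+-identityˡ _)) })

-- Splitting a lattice along a rational linear form.

module RationalLattices {c ℓ : Level} (K : CommutativeRing c ℓ)
  (invertible : IntegerAction.PositiveIntegersInvertible K) where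
  open CommutativeRing K hiding (zero)
  open IntegerAction K
  open RationalScalars K invertible
  open Subgroups K
  open Solver using (solve; con; _:+_; _:*_; :-_; _:=_; _:-_)
  open RingProperties ring using (-‿distribˡ-*)

  record IsLinear (f : Carrier → ℚ) : Set (c ⊔ ℓ) where
    field
      cong  : ∀ {x y} → x ≈ y → f x ≡ f y
      homo-+ : ∀ x y → f (x + y) ≡ f x ℚ.+ f y
      homo-* : ∀ q x → f (φ q * x) ≡ q ℚ.* f x

    homo-0 : f 0# ≡ 0ℚ
    homo-0 = ≡.trans (cong (sym (zeroʳ (φ 0ℚ)))) (≡.trans (homo-* 0ℚ 0#) (ℚₚ.*-zeroˡ (f 0#)))

    homo-neg : ∀ x → f (- x) ≡ ℚ.- f x
    homo-neg x = ≡.trans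
      (cong (trans (-‿cong (sym (*-identityˡ x))) (trans (-‿distribˡ-* 1# x)
        (*-congʳ (trans (-‿cong (sym φ-1)) (sym (φ-homo-neg 1ℚ)))))))
      (≡.trans (homo-* (ℚ.- 1ℚ) x) (ℚRing.-1*x≈-x (f x)))

    homo-ℤ : ∀ z x → f (⟦ z ⟧ * x) ≡ fromℤ z ℚ.* f x
    homo-ℤ z x = ≡.trans (cong (*-congʳ (sym (φ-fromℤ z)))) (homo-* (fromℤ z) x)

    homo-sub : ∀ x y → f (x - y) ≡ f x ℚ.- f y
    homo-sub x y = ≡.trans (homo-+ x (- y)) (≡.cong (f x ℚ.+_) (homo-neg y))

  kernel-isSubgroup : ∀ {f} → IsLinear f → IsSubgroup (λ x → f x ≡ 0ℚ)
  kernel-isSubgroup linear = record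
    { resp       = λ x≈y fx≡0 → ≡.trans (cong (sym x≈y)) fx≡0
    ; 0∈         = homo-0
    ; +-closed   = λ {x} {y} fx≡0 fy≡0 → ≡.trans (homo-+ x y) (≡.cong₂ ℚ._+_ fx≡0 fy≡0)
    ; neg-closed = λ {x} fx≡0 → ≡.trans (homo-neg x) (≡.cong ℚ.-_ fx≡0)
    }
    where open IsLinear linear

  ℚ-span : ∀ {h : Level} → Pred Carrier h → Pred Carrier _
  ℚ-span H = ⟨ (λ x → ∃₂ λ q y → y ∈ H × x ≈ φ q * y) ⟩

  Split : (Carrier → ℚ) → Carrier → List Carrier → Carrier → Set (c ⊔ ℓ)
  Split f b gs x = ∃ λ z → f x ≡ fromℤ z ℚ.* f b × x - ⟦ z ⟧ * b ∈ ⟨ gs ⟩ₗ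

  Split-isSubgroup : ∀ {f b gs} → IsLinear f → IsSubgroup (Split f b gs)
  Split-isSubgroup {f} {b} linear = record
    { resp       = λ { x≈y (z , fx≡ , x∈) →
        z , ≡.trans (cong (sym x≈y)) fx≡ , ⟨⟩-resp (+-congʳ x≈y) x∈ }
    ; 0∈         = + 0 , ≡.trans homo-0 (≡.sym (ℚₚ.*-zeroˡ (f b))) ,
        ⟨⟩-resp (solve 1 (λ b → con (+ 0) := con (+ 0) :- con (+ 0) :* b) refl b) ⟨⟩-0
    ; +-closed   = λ { {x} {y} (z , fx≡ , x∈) (w , fy≡ , y∈) →
        z ℤ.+ w ,
        ≡.trans (homo-+ x y) (≡.trans (≡.cong₂ ℚ._+_ fx≡ fy≡)
          (≡.trans (≡.sym (ℚₚ.*-distribʳ-+ (f b) (fromℤ z) (fromℤ w)))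
            (≡.cong (ℚ._* f b) (≡.sym (fromℤ-+ z w))))) ,
        ⟨⟩-resp (trans
          (solve 5 (λ x y z w b → (x :- z :* b) :+ (y :- w :* b) := (x :+ y) :- (z :+ w) :* b)
            refl x y ⟦ z ⟧ ⟦ w ⟧ b)
          (+-congˡ (-‿cong (*-congʳ (sym (⟦⟧-homo-+ z w)))))) (⟨⟩-+ x∈ y∈) }
    ; neg-closed = λ { {x} (z , fx≡ , x∈) →
        ℤ.- z ,
        ≡.trans (homo-neg x) (≡.trans (≡.cong ℚ.-_ fx≡)
          (≡.trans (ℚₚ.neg-distribˡ-* (fromℤ z) (f b)) (≡.cong (ℚ._* f b) (≡.sym (fromℤ-neg z))))) ,
        ⟨⟩-resp (trans
          (solve 3 (λ x z b → :- (x :- z :* b) := (:- x) :- (:- z) :* b) refl x ⟦ z ⟧ b)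
          (+-congˡ (-‿cong (*-congʳ (sym (⟦⟧-homo-neg z)))))) (⟨⟩-neg x∈) }
    }
    where open IsLinear linear

  -- A section of the surjection from `⟨ gs ⟩ₗ` to its cyclic image under `f`: `f b` generates the
  -- image, and the coefficient of `f x` is also the one that moves `x` into the part of the kernel
  -- generated by `gs′`. If `f b` vanishes, so does `f` on the whole lattice.
  Splitting : (Carrier → ℚ) → List Carrier → Set (c ⊔ ℓ)
  Splitting f gs = ∃₂ λ b gs′ → b ∈ ⟨ gs ⟩ₗ ×
    (∀ {x} → x ∈ ⟨ gs′ ⟩ₗ → x ∈ ⟨ gs ⟩ₗ × f x ≡ 0ℚ) ×
    (∀ {x} → x ∈ ⟨ gs ⟩ₗ → Split f b gs′ x)

  -- One step of integral row reduction. Bézout turns `g` and the old `b` into a vector `b′` whose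
  -- value generates both of their values; the two remainders modulo `b′` have value zero and join
  -- the generators of the kernel. Nothing is asked of the generators but that they generate, so
  -- dependent remainders do no harm.
  split-∷ : ∀ {f} → IsLinear f → ∀ g gs → Splitting f gs → Splitting f (g ∷ gs)
  split-∷ {f} linear g gs (b , gs′ , b∈ , ⊆kernel , splits) =
    b′ , gs″ , b′∈ ,
    (λ x∈ → ⟨⟩-least ⟨⟩-isSubgroup (λ h∈ → proj₁ (gs″⊆ h∈)) x∈ ,
            ⟨⟩-least (kernel-isSubgroup linear) (λ h∈ → proj₂ (gs″⊆ h∈)) x∈) ,
    ⟨⟩-least (Split-isSubgroup linear) splits′
    where
    open IsLinear linear
    open IsSubgroup (⟨⟩-isSubgroup {G = _∈ₗ (g ∷ gs)}) using (ℤ-closed)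
    bézout = bézout-ℚ (f g) (f b)
    i = proj₁ bézout
    j = proj₁ (proj₂ bézout)
    k = proj₁ (proj₂ (proj₂ bézout))
    l = proj₁ (proj₂ (proj₂ (proj₂ bézout)))

    b′  = ⟦ i ⟧ * g + ⟦ j ⟧ * b
    gs″ = (g - ⟦ k ⟧ * b′) ∷ (b - ⟦ l ⟧ * b′) ∷ gs′

    b′∈ : b′ ∈ ⟨ g ∷ gs ⟩ₗ
    b′∈ = ⟨⟩-+ (ℤ-closed i (generator (here ≡.refl))) (ℤ-closed j (⟨∷⟩⁺ b∈))

    fb′≡ : f b′ ≡ fromℤ i ℚ.* f g ℚ.+ fromℤ j ℚ.* f b
    fb′≡ = ≡.trans (homo-+ (⟦ i ⟧ * g) (⟦ j ⟧ * b)) (≡.cong₂ ℚ._+_ (homo-ℤ i g) (homo-ℤ j b))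

    remainder : ∀ {x} m → f x ≡ fromℤ m ℚ.* f b′ → f (x - ⟦ m ⟧ * b′) ≡ 0ℚ
    remainder {x} m fx≡ = ≡.trans (homo-sub x (⟦ m ⟧ * b′))
      (≡.trans (≡.cong₂ ℚ._-_ fx≡ (homo-ℤ m b′)) (ℚₚ.+-inverseʳ (fromℤ m ℚ.* f b′)))

    fg≡′ : f g ≡ fromℤ k ℚ.* f b′
    fg≡′ = ≡.trans (proj₁ (proj₂ (proj₂ (proj₂ (proj₂ bézout))))) (≡.cong (fromℤ k ℚ.*_) (≡.sym fb′≡))

    fb≡′ : f b ≡ fromℤ l ℚ.* f b′
    fb≡′ = ≡.trans (proj₂ (proj₂ (proj₂ (proj₂ (proj₂ bézout))))) (≡.cong (fromℤ l ℚ.*_) (≡.sym fb′≡))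

    gs″⊆ : ∀ {x} → x ∈ₗ gs″ → x ∈ ⟨ g ∷ gs ⟩ₗ × f x ≡ 0ℚ
    gs″⊆ (here ≡.refl) =
      ⟨⟩-+ (generator (here ≡.refl)) (⟨⟩-neg (ℤ-closed k b′∈)) , remainder k fg≡′
    gs″⊆ (there (here ≡.refl)) =
      ⟨⟩-+ (⟨∷⟩⁺ b∈) (⟨⟩-neg (ℤ-closed l b′∈)) , remainder l fb≡′
    gs″⊆ (there (there x∈)) =
      ⟨∷⟩⁺ (proj₁ (⊆kernel (generator x∈))) , proj₂ (⊆kernel (generator x∈))

    shift : ∀ {x} → Split f b gs′ x → Split f b′ gs″ x
    shift {x} (z , fx≡ , x∈gs′) = z ℤ.* l ,
      ≡.trans fx≡ (≡.trans (≡.cong (fromℤ z ℚ.*_) fb≡′)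
        (≡.trans (≡.sym (ℚₚ.*-assoc (fromℤ z) (fromℤ l) (f b′)))
          (≡.cong (ℚ._* f b′) (≡.sym (fromℤ-* z l))))) ,
      ⟨⟩-resp (trans
        (solve 5 (λ x z b l b′ → (x :- z :* b) :+ z :* (b :- l :* b′) := x :- (z :* l) :* b′)
          refl x ⟦ z ⟧ b ⟦ l ⟧ b′)
        (+-congˡ (-‿cong (*-congʳ (sym (⟦⟧-homo-* z l))))))
        (⟨⟩-+ (⟨∷⟩⁺ (⟨∷⟩⁺ x∈gs′))
          (IsSubgroup.ℤ-closed ⟨⟩-isSubgroup z (generator (there (here ≡.refl)))))

    splits′ : ∀ {x} → x ∈ₗ g ∷ gs → Split f b′ gs″ x
    splits′ (here ≡.refl) = k , fg≡′ , generator (here ≡.refl)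
    splits′ (there x∈)    = shift (splits (generator x∈))

  split : ∀ {f} → IsLinear f → ∀ gs → Splitting f gs
  split linear [] = 0# , [] , ⟨⟩-0 ,
    (λ x∈ → x∈ , ⟨⟩-least (kernel-isSubgroup linear) (λ ()) x∈) ,
    ⟨⟩-least (Split-isSubgroup linear) (λ ())
  split linear (g ∷ gs) = split-∷ linear g gs (split linear gs)

  -- The image of the lattice under `f` is cyclic, generated by `f b`, whereas the values at all
  -- rational multiples of `x` fill the line through `f x`.
  divisible⇒zero : ∀ {f} → IsLinear f → ∀ gs x → (∀ q → φ q * x ∈ ⟨ gs ⟩ₗ) → f x ≡ 0ℚ
  divisible⇒zero {f} linear gs x divisible =
    let b , gs′ , _ , _ , splits = split linear gs
    in common-multiples⇒zero (f x) (f b) λ q →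
         let z , eq , _ = splits (divisible q)
         in z , ≡.trans (≡.sym (IsLinear.homo-* linear q x)) eq

-- Dual frames for a trace form.

module TraceForm {c ℓ : Level} (K : CommutativeRing c ℓ)
  (invertible : IntegerAction.PositiveIntegersInvertible K)
  (τ : CommutativeRing.Carrier K → ℚ) (linear : RationalLattices.IsLinear K invertible τ) where
  open CommutativeRing K hiding (zero)
  open IntegerAction K
  open RationalScalars K invertible
  open Subgroups K
  open RationalLattices K invertible
  open Solver using (solve; _:+_; _:*_; _:=_; _:-_)
  open IsLinear linear

  τ* : Carrier → Carrier → ℚ
  τ* y x = τ (y * x)

  τ*-isLinear : ∀ y → IsLinear (τ* y)
  τ*-isLinear y = record
    { cong   = λ x≈x′ → cong (*-congˡ x≈x′)
    ; homo-+ = λ x x′ → ≡.trans (cong (distribˡ y x x′)) (homo-+ (y * x) (y * x′))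
    ; homo-* = λ q x → ≡.trans
        (cong (solve 3 (λ y q x → y :* (q :* x) := q :* (y :* x)) refl y (φ q) x)) (homo-* q (y * x))
    }

  -- A pair `(b , y)` consists of a lattice vector and a vector of the dual lattice whose functional
  -- `τ* y` gives the coordinate at `b`. In the presence of `IsFrame` these are dual bases, except
  -- that no independence is recorded.
  Frame : Set c
  Frame = List (Carrier × Carrier)

  expand : Frame → Carrier → Carrier
  expand []              x = 0#
  expand ((b , y) ∷ fr) x = φ (τ* y x) * b + expand fr x

  record IsFrame (gs : List Carrier) (fr : Frame) : Set (c ⊔ ℓ) where
    field
      members  : All (λ (b , _) → b ∈ ⟨ gs ⟩ₗ) fr
      integral : All (λ (_ , y) → ∀ {x} → x ∈ ⟨ gs ⟩ₗ → ∃ λ z → τ* y x ≡ fromℤ z) fr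
      expands  : ∀ {x} → x ∈ ⟨ gs ⟩ₗ → x ≈ expand fr x

  frame-∷ : ∀ e gs → ((b , gs′ , _) : Splitting (τ* e) gs) (r : ℚ) → r ℚ.* τ* e b ≡ 1ℚ →
            ∃ (IsFrame gs′) → ∃ (IsFrame gs)
  frame-∷ e gs (b , gs′ , b∈ , ⊆kernel , splits) r r·eb≡1 (fr , isFrame) = (b , φ r * e) ∷ adjust fr , record
    { members  = b∈ ∷ adjust-members fr (IsFrame.members isFrame)
    ; integral = (λ x∈ → coordinate-integral (splits x∈)) ∷ adjust-integral fr (IsFrame.integral isFrame)
    ; expands  = λ x∈ → expands′ (splits x∈)
    }
    where
    -- The Gram-Schmidt correction. Since `r` inverts `τ* e b`, the corrected functional vanishes at
    -- the new vector `b`.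
    project : Carrier → Carrier
    project y = y - φ (r ℚ.* τ* y b) * e

    adjust : Frame → Frame
    adjust []             = []
    adjust ((b , y) ∷ fr) = (b , project y) ∷ adjust fr

    adjust-members : ∀ fr → All (λ (b , _) → b ∈ ⟨ gs′ ⟩ₗ) fr → All (λ (b , _) → b ∈ ⟨ gs ⟩ₗ) (adjust fr)
    adjust-members []       []         = []
    adjust-members (_ ∷ fr) (b∈ ∷ bs∈) = proj₁ (⊆kernel b∈) ∷ adjust-members fr bs∈

    coordinate : ∀ {x} → ((z , _) : Split (τ* e) b gs′ x) → τ* (φ r * e) x ≡ fromℤ z
    coordinate {x} (z , ex≡ , _) = ≡.trans (cong (*-assoc (φ r) e x)) (≡.trans (homo-* r (e * x))
      (≡.trans (≡.cong (r ℚ.*_) ex≡) (≡.trans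
        (ℚSolver.solve 3 (λ r z d → r ℚSolver.:* (z ℚSolver.:* d) ℚSolver.:= z ℚSolver.:* (r ℚSolver.:* d)) ≡.refl
          r (fromℤ z) (τ* e b))
        (≡.trans (≡.cong (fromℤ z ℚ.*_) r·eb≡1) (ℚₚ.*-identityʳ (fromℤ z))))))
      where module ℚSolver = ℚS.+-*-Solver

    coordinate-integral : ∀ {x} → Split (τ* e) b gs′ x → ∃ λ z → τ* (φ r * e) x ≡ fromℤ z
    coordinate-integral s@(z , _) = z , coordinate s

    -- The corrected functional ignores the component along `b`, so on the large lattice it behaves
    -- as `y` does on the kernel. Integrality and the expansion formula are inherited in this way.
    τ*-project : ∀ {x} y → ((z , _) : Split (τ* e) b gs′ x) → τ* (project y) x ≡ τ* y (x - ⟦ z ⟧ * b)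
    τ*-project {x} y s@(z , _) = begin
      τ* (project y) x
        ≡⟨ cong (solve 4 (λ y p e x → (y :- p :* e) :* x := y :* x :- p :* (e :* x)) refl
             y (φ (r ℚ.* τ* y b)) e x) ⟩
      τ (y * x - φ (r ℚ.* τ* y b) * (e * x))
        ≡⟨ homo-sub (y * x) (φ (r ℚ.* τ* y b) * (e * x)) ⟩
      τ* y x ℚ.- τ (φ (r ℚ.* τ* y b) * (e * x))
        ≡⟨ ≡.cong (λ w → τ* y x ℚ.- w) (homo-* (r ℚ.* τ* y b) (e * x)) ⟩
      τ* y x ℚ.- (r ℚ.* τ* y b) ℚ.* τ* e x
        ≡⟨ ≡.cong (λ w → τ* y x ℚ.- w)
             (ℚSolver.solve 3 (λ r y x → (r ℚSolver.:* y) ℚSolver.:* x ℚSolver.:= (r ℚSolver.:* x) ℚSolver.:* y)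
               ≡.refl r (τ* y b) (τ* e x)) ⟩
      τ* y x ℚ.- (r ℚ.* τ* e x) ℚ.* τ* y b
        ≡⟨ ≡.cong (λ w → τ* y x ℚ.- w ℚ.* τ* y b)
             (≡.trans (≡.sym (≡.trans (cong (*-assoc (φ r) e x)) (homo-* r (e * x)))) (coordinate s)) ⟩
      τ* y x ℚ.- fromℤ z ℚ.* τ* y b
        ≡⟨ ≡.cong (λ w → τ* y x ℚ.- w) (IsLinear.homo-ℤ (τ*-isLinear y) z b) ⟨
      τ* y x ℚ.- τ* y (⟦ z ⟧ * b)
        ≡⟨ IsLinear.homo-sub (τ*-isLinear y) x (⟦ z ⟧ * b) ⟨
      τ* y (x - ⟦ z ⟧ * b) ∎
      where
      open ≡.≡-Reasoning
      module ℚSolver = ℚS.+-*-Solver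

    adjust-integral : ∀ fr → All (λ (_ , y) → ∀ {x} → x ∈ ⟨ gs′ ⟩ₗ → ∃ λ z → τ* y x ≡ fromℤ z) fr →
      All (λ (_ , y) → ∀ {x} → x ∈ ⟨ gs ⟩ₗ → ∃ λ z → τ* y x ≡ fromℤ z) (adjust fr)
    adjust-integral []             []       = []
    adjust-integral ((_ , y) ∷ fr) (i ∷ is) = integral′ ∷ adjust-integral fr is
      where
      integral′ : ∀ {x} → x ∈ ⟨ gs ⟩ₗ → ∃ λ z → τ* (project y) x ≡ fromℤ z
      integral′ x∈ = let s@(_ , _ , x∈′) = splits x∈; w , eq = i x∈′
                     in w , ≡.trans (τ*-project y s) eq

    expand-adjust : ∀ {x} fr ((z , _) : Split (τ* e) b gs′ x) → expand (adjust fr) x ≈ expand fr (x - ⟦ z ⟧ * b)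
    expand-adjust []             s = refl
    expand-adjust ((_ , y) ∷ fr) s =
      +-cong (*-congʳ (reflexive (≡.cong φ (τ*-project y s)))) (expand-adjust fr s)

    expands′ : ∀ {x} → Split (τ* e) b gs′ x → x ≈ φ (τ* (φ r * e) x) * b + expand (adjust fr) x
    expands′ {x} s@(z , _ , x∈′) = begin
      x
        ≈⟨ solve 3 (λ x z b → x := z :* b :+ (x :- z :* b)) refl x ⟦ z ⟧ b ⟩
      ⟦ z ⟧ * b + (x - ⟦ z ⟧ * b)
        ≈⟨ +-cong (*-congʳ (trans (sym (φ-fromℤ z)) (reflexive (≡.cong φ (≡.sym (coordinate s))))))
             (IsFrame.expands isFrame x∈′) ⟩
      φ (τ* (φ r * e) x) * b + expand fr (x - ⟦ z ⟧ * b)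
        ≈⟨ +-congˡ (expand-adjust fr s) ⟨
      φ (τ* (φ r * e) x) * b + expand (adjust fr) x ∎
      where open SetoidReasoning setoid

  frame : ∀ es gs → (∀ {x} → x ∈ ⟨ gs ⟩ₗ → All (λ e → τ* e x ≡ 0ℚ) es → x ≈ 0#) → ∃ (IsFrame gs)
  frame [] gs separated = [] , record
    { members = [] ; integral = [] ; expands = λ x∈ → separated x∈ [] }
  frame (e ∷ es) gs separated = by-cases (τ* e b ℚₚ.≟ 0ℚ)
    where
    splitting = split (τ*-isLinear e) gs
    b         = proj₁ splitting
    gs′       = proj₁ (proj₂ splitting)
    ⊆kernel   = proj₁ (proj₂ (proj₂ (proj₂ splitting)))
    splits    = proj₂ (proj₂ (proj₂ (proj₂ splitting)))

    vanishes : τ* e b ≡ 0ℚ → ∀ {x} → Split (τ* e) b gs′ x → τ* e x ≡ 0ℚ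
    vanishes eb≡0 (z , ex≡ , _) =
      ≡.trans ex≡ (≡.trans (≡.cong (fromℤ z ℚ.*_) eb≡0) (ℚₚ.*-zeroʳ (fromℤ z)))

    by-cases : Dec (τ* e b ≡ 0ℚ) → ∃ (IsFrame gs)
    by-cases (yes eb≡0) = frame es gs λ x∈ orthogonal → separated x∈ (vanishes eb≡0 (splits x∈) ∷ orthogonal)
    by-cases (no eb≢0)  = frame-∷ e gs splitting (proj₁ (inverse-ℚ _ eb≢0)) (proj₂ (inverse-ℚ _ eb≢0))
      (frame es gs′ λ x∈ orthogonal → separated (proj₁ (⊆kernel x∈)) (proj₂ (⊆kernel x∈) ∷ orthogonal))

-- Coordinates in a rational basis, and the trace.

module Coordinates {c ℓ : Level} (K : CommutativeRing c ℓ)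
  (invertible : IntegerAction.PositiveIntegersInvertible K) where
  open CommutativeRing K hiding (zero)
  open IntegerAction K
  open RationalScalars K invertible
  open RationalLattices K invertible
  open Solver using (solve; con; _:+_; _:*_; :-_; _:=_; _:-_)
  open Sum semiring using (sum; sum-cong-≋; *-distribˡ-sum; ∑-distrib-+)
  open Scalars K using (IsBasis)

  infixr 8 _·_
  _·_ : ℚ → Carrier → Carrier
  q · x = φ q * x

  linear-sum : ∀ {f} → IsLinear f → ∀ {n} (q : Vector ℚ n) (v : Vector Carrier n) →
               f (sum (zipWith _·_ q v)) ≡ ℚΣ.sum (zipWith ℚ._*_ q (f ∘ v))
  linear-sum linear {zero}  q v = IsLinear.homo-0 linear
  linear-sum linear {suc n} q v = ≡.trans (homo-+ _ _)
    (≡.cong₂ ℚ._+_ (homo-* (q zero) (v zero)) (linear-sum linear (q ∘ suc) (v ∘ suc)))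
    where open IsLinear linear

  module _ {n : ℕ} {e : Vector Carrier n} (isBasis : IsBasis 0ℚ _·_ e) where
    open IsBasis isBasis
    open SetoidReasoning setoid

    combination : Vector ℚ n → Carrier
    combination k = sum (zipWith _·_ k e)

    coordinate : Fin n → Carrier → ℚ
    coordinate i x = proj₁ (spans x) i

    expansion : ∀ x → x ≈ combination (λ i → coordinate i x)
    expansion x = proj₂ (spans x)

    combination-+ : ∀ k l → combination (λ i → k i ℚ.+ l i) ≈ combination k + combination l
    combination-+ k l = trans
      (sum-cong-≋ (λ i → trans (*-congʳ (φ-homo-+ (k i) (l i))) (distribʳ (e i) (φ (k i)) (φ (l i)))))
      (∑-distrib-+ (zipWith _·_ k e) (zipWith _·_ l e))

    combination-* : ∀ q k → combination (λ i → q ℚ.* k i) ≈ φ q * combination k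
    combination-* q k = trans
      (sum-cong-≋ (λ i → trans (*-congʳ (φ-homo-* q (k i))) (*-assoc (φ q) (φ (k i)) (e i))))
      (sym (*-distribˡ-sum (φ q) (zipWith _·_ k e)))

    -- The field `spans` picks coordinates with no promise of respecting `≈` or the operations.
    -- Independence supplies this afterwards: additivity, homogeneity and even compatibility with
    -- equality all follow from uniqueness.
    coordinates-unique : ∀ {x} k → x ≈ combination k → ∀ i → coordinate i x ≡ k i
    coordinates-unique {x} k x≈ i =
      ℚRing.x∙y⁻¹≈ε⇒x≈y (coordinate i x) (k i) (≡.trans
        (≡.cong (coordinate i x ℚ.+_) (≡.sym (ℚRing.-1*x≈-x (k i))))
        (independent (λ j → coordinate j x ℚ.+ (ℚ.- 1ℚ) ℚ.* k j) difference i))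
      where
      difference : combination (λ j → coordinate j x ℚ.+ (ℚ.- 1ℚ) ℚ.* k j) ≈ 0#
      difference = begin
        combination (λ j → coordinate j x ℚ.+ (ℚ.- 1ℚ) ℚ.* k j)
          ≈⟨ combination-+ (λ j → coordinate j x) (λ j → (ℚ.- 1ℚ) ℚ.* k j) ⟩
        combination (λ j → coordinate j x) + combination (λ j → (ℚ.- 1ℚ) ℚ.* k j)
          ≈⟨ +-cong (sym (expansion x)) (combination-* (ℚ.- 1ℚ) k) ⟩
        x + φ (ℚ.- 1ℚ) * combination k
          ≈⟨ +-congˡ (*-cong (trans (φ-homo-neg 1ℚ) (-‿cong φ-1)) (sym x≈)) ⟩
        x + - 1# * x
          ≈⟨ solve 1 (λ x → x :+ :- con (+ 1) :* x := con (+ 0)) refl x ⟩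
        0# ∎

    coordinate-isLinear : ∀ i → IsLinear (coordinate i)
    coordinate-isLinear i = record
      { cong   = λ {x} {y} x≈y → coordinates-unique (λ j → coordinate j y) (trans x≈y (expansion y)) i
      ; homo-+ = λ x y → coordinates-unique (λ j → coordinate j x ℚ.+ coordinate j y)
          (trans (+-cong (expansion x) (expansion y))
          (sym (combination-+ (λ j → coordinate j x) (λ j → coordinate j y)))) i
      ; homo-* = λ q x → coordinates-unique (λ j → q ℚ.* coordinate j x) (trans (*-congˡ (expansion x))
          (sym (combination-* q (λ j → coordinate j x)))) i
      }

    trace : Carrier → ℚ
    trace x = ℚΣ.sum (λ i → coordinate i (x * e i))

    trace-isLinear : IsLinear trace
    trace-isLinear = record
      { cong   = λ x≈y → ℚΣ.sum-cong-≋ (λ i → IsLinear.cong (coordinate-isLinear i) (*-congʳ x≈y))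
      ; homo-+ = λ x y → ≡.trans
          (ℚΣ.sum-cong-≋ (λ i → ≡.trans (IsLinear.cong (coordinate-isLinear i) (distribʳ (e i) x y))
            (IsLinear.homo-+ (coordinate-isLinear i) (x * e i) (y * e i))))
          (ℚΣ.∑-distrib-+ (λ i → coordinate i (x * e i)) (λ i → coordinate i (y * e i)))
      ; homo-* = λ q x → ≡.trans
          (ℚΣ.sum-cong-≋ (λ i → ≡.trans (IsLinear.cong (coordinate-isLinear i) (*-assoc (φ q) x (e i)))
            (IsLinear.homo-* (coordinate-isLinear i) q (x * e i))))
          (≡.sym (ℚΣ.*-distribˡ-sum q (λ i → coordinate i (x * e i))))
      }

  -- Every `HasTrace` brings its own basis, so traces have to be compared across bases. Expanding
  -- `e′ j` in `e`, exchanging the two sums and contracting in `e′` is the identity tr(AB) = tr(BA)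
  -- for the two changes of basis.
  trace-unique : ∀ {m n} {e : Vector Carrier m} {e′ : Vector Carrier n}
                 (isBasis : IsBasis 0ℚ _·_ e) (isBasis′ : IsBasis 0ℚ _·_ e′) →
                 ∀ x → trace isBasis′ x ≡ trace isBasis x
  trace-unique {m} {n} {e} {e′} isBasis isBasis′ x = begin
    ℚΣ.sum (λ j → ε′ j (x * e′ j))
      ≡⟨ ℚΣ.sum-cong-≋ expand ⟩
    ℚΣ.sum (λ j → ℚΣ.sum (λ i → ε i (e′ j) ℚ.* ε′ j (x * e i)))
      ≡⟨ ℚΣ.∑-comm (λ j i → ε i (e′ j) ℚ.* ε′ j (x * e i)) ⟩
    ℚΣ.sum (λ i → ℚΣ.sum (λ j → ε i (e′ j) ℚ.* ε′ j (x * e i)))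
      ≡⟨ ℚΣ.sum-cong-≋ contract ⟩
    ℚΣ.sum (λ i → ε i (x * e i)) ∎
    where
    open ≡.≡-Reasoning
    ε : Fin m → Carrier → ℚ
    ε  = coordinate isBasis
    ε′ : Fin n → Carrier → ℚ
    ε′ = coordinate isBasis′

    expand : ∀ j → ε′ j (x * e′ j) ≡ ℚΣ.sum (λ i → ε i (e′ j) ℚ.* ε′ j (x * e i))
    expand j = ≡.trans
      (IsLinear.cong (coordinate-isLinear isBasis′ j) (trans (*-congˡ (expansion isBasis (e′ j)))
        (trans (*-distribˡ-sum x (zipWith _·_ (λ i → ε i (e′ j)) e)) (sum-cong-≋ (λ i →
          solve 3 (λ x q y → x :* (q :* y) := q :* (x :* y)) refl x (φ (ε i (e′ j))) (e i))))))
      (linear-sum (coordinate-isLinear isBasis′ j) (λ i → ε i (e′ j)) (λ i → x * e i))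

    contract : ∀ i → ℚΣ.sum (λ j → ε i (e′ j) ℚ.* ε′ j (x * e i)) ≡ ε i (x * e i)
    contract i = ≡.trans (ℚΣ.sum-cong-≋ (λ j → ℚₚ.*-comm (ε i (e′ j)) (ε′ j (x * e i))))
      (≡.trans (≡.sym (linear-sum (coordinate-isLinear isBasis i) (λ j → ε′ j (x * e i)) e′))
        (IsLinear.cong (coordinate-isLinear isBasis i) (sym (expansion isBasis′ (x * e i)))))

-- Idempotents from periodic powers.

module IdempotentPowers {c ℓ : Level} (A : CommutativeRing c ℓ) where
  open CommutativeRing A hiding (zero)
  open IntegerAction A
  open Solver using (solve; con; _:+_; _:*_; :-_; _:=_; _:-_)
  open Exp semiring using (_^_; ^-homo-*; ^-assocʳ)
  open SetoidReasoning setoid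

  HasIdempotentPower : Carrier → Set ℓ
  HasIdempotentPower a = ∃ λ n → a ^ suc n * a ^ suc n ≈ a ^ suc n

  periodic⇒idempotentPower : ∀ a i p → a ^ i ≈ a ^ (i ℕ.+ suc p) → HasIdempotentPower a
  -- The exponent is `suc i * suc p`, the successor of the witness: a multiple of the period that is
  -- past the start `i` of periodicity, and positive even for `i = 0`.
  periodic⇒idempotentPower a i p periodic = p ℕ.+ i ℕ.* suc p , (begin
    a ^ m * a ^ m
      ≈⟨ *-cong (trans (reflexive (≡.cong (a ^_) m≡)) (^-homo-* a i k)) (sym powers) ⟩
    (a ^ i * a ^ k) * b ^ suc i
      ≈⟨ solve 3 (λ x y z → (x :* y) :* z := (x :* z) :* y) refl (a ^ i) (a ^ k) (b ^ suc i) ⟩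
    (a ^ i * b ^ suc i) * a ^ k            ≈⟨ *-congʳ (absorb (suc i)) ⟩
    a ^ i * a ^ k                          ≈⟨ ^-homo-* a i k ⟨
    a ^ (i ℕ.+ k)                          ≡⟨ ≡.cong (a ^_) m≡ ⟨
    a ^ m                                  ∎)
    where
    m = suc i ℕ.* suc p
    k = suc p ℕ.+ i ℕ.* p
    b = a ^ suc p

    m≡ : m ≡ i ℕ.+ k
    m≡ = ≡.trans (≡.cong (suc p ℕ.+_) (ℕₚ.*-suc i p)) (≡.trans (≡.sym (ℕₚ.+-assoc (suc p) i (i ℕ.* p)))
      (≡.trans (≡.cong (ℕ._+ i ℕ.* p) (ℕₚ.+-comm (suc p) i)) (ℕₚ.+-assoc i (suc p) (i ℕ.* p))))

    powers : b ^ suc i ≈ a ^ m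
    powers = trans (^-assocʳ a (suc p) (suc i)) (reflexive (≡.cong (a ^_) (ℕₚ.*-comm (suc p) (suc i))))

    absorb : ∀ t → a ^ i * b ^ t ≈ a ^ i
    absorb zero    = *-identityʳ _
    absorb (suc t) = begin
      a ^ i * (b * b ^ t)   ≈⟨ *-assoc _ _ _ ⟨
      a ^ i * b * b ^ t     ≈⟨ *-congʳ (^-homo-* a i (suc p)) ⟨
      a ^ (i ℕ.+ suc p) * b ^ t  ≈⟨ *-congʳ periodic ⟨
      a ^ i * b ^ t         ≈⟨ absorb t ⟩
      a ^ i                 ∎

  -- Modulo `w` the element `a` is 1, hence so are all its powers.
  power-comaximal : ∀ {a w} → 1# ≈ a + w → ∀ m → ∃ λ s → 1# ≈ a ^ m + w * s
  power-comaximal {a} {w} 1≈ zero = 0# , sym (trans (+-congˡ (zeroʳ w)) (+-identityʳ 1#))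
  power-comaximal {a} {w} 1≈ (suc m) with power-comaximal 1≈ m
  ... | s , 1≈′ = a * s + 1# , (begin
    1#                              ≈⟨ 1≈ ⟩
    a + w                           ≈⟨ +-congʳ (trans (sym (*-identityʳ a)) (*-congˡ 1≈′)) ⟩
    a * (a ^ m + w * s) + w
      ≈⟨ solve 4 (λ a b w s → a :* (b :+ w :* s) :+ w := a :* b :+ w :* (a :* s :+ con (+ 1))) refl
           a (a ^ m) w s ⟩
    a * a ^ m + w * (a * s + 1#)    ∎)

  -- Enlarges the idempotent f by the idempotent e = (1 - f) (c s)ⁿ⁺¹, on which s is invertible.
  record Enlargement (f s w : Carrier) : Set (c ⊔ ℓ) where
    field
      e h c′     : Carrier
      idempotent : (f + e) * (f + e) ≈ f + e
      remainder  : 1# ≈ (f + e) + c′ * w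
      product    : ∀ p q r → p ≈ f →
        f * f * p + e * f * q + f * (e * h) * r + e * (e * h) * s ≈ f + e

  -- On the factor `1 - f` the hypothesis reads `1 = c s + c w`. Where the idempotent power `e₀` of
  -- `c s` is 1, `s` has the inverse `h`; on the complement comaximality of `e₀` with `f + c w`
  -- shows that `w` alone generates the unit ideal. The field `product` evaluates
  -- `(f x + e v) (f y + e h u)` with `s = v u`: its variables `p`, `q`, `r` are `x y`, `v y`,
  -- `x u`, and the mixed terms die because `e f = 0`.
  enlarge : ∀ f c s w → f * f ≈ f → 1# ≈ f + c * (s + w) →
            HasIdempotentPower (c * s) → Enlargement f s w
  enlarge f c s w ff≈f 1≈ (n , idem) = record
    { e = (1# - f) * e₀
    ; h = h
    ; c′ = (1# - f) * (c * t)
    ; idempotent = begin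
        (f + (1# - f) * e₀) * (f + (1# - f) * e₀)
          ≈⟨ solve 2 (λ f e → (f :+ (con (+ 1) :- f) :* e) :* (f :+ (con (+ 1) :- f) :* e) :=
               f :* f :+ (f :- f :* f) :* (e :+ e) :+ (con (+ 1) :- f :- f :+ f :* f) :* (e :* e)) refl f e₀ ⟩
        f * f + (f - f * f) * (e₀ + e₀) + (1# - f - f + f * f) * (e₀ * e₀)
          ≈⟨ +-cong (+-cong ff≈f (*-congʳ (+-congˡ (-‿cong ff≈f)))) (*-cong (+-congˡ ff≈f) idem) ⟩
        f + (f - f) * (e₀ + e₀) + (1# - f - f + f) * e₀
          ≈⟨ solve 2 (λ f e → f :+ (f :- f) :* (e :+ e) :+ (con (+ 1) :- f :- f :+ f) :* e :=
               f :+ (con (+ 1) :- f) :* e) refl f e₀ ⟩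
        f + (1# - f) * e₀ ∎
    ; remainder = begin
        1#
          ≈⟨ solve 2 (λ f e → con (+ 1) :=
               (f :+ (con (+ 1) :- f) :* e) :+ (con (+ 1) :- f) :* (con (+ 1) :- e)) refl f e₀ ⟩
        (f + (1# - f) * e₀) + (1# - f) * (1# - e₀)
          ≈⟨ +-congˡ (*-congˡ (+-congʳ 1≈e₀)) ⟩
        (f + (1# - f) * e₀) + (1# - f) * (e₀ + (f + c * w) * t - e₀)
          ≈⟨ +-congˡ (solve 5 (λ f e c w t → (con (+ 1) :- f) :* (e :+ (f :+ c :* w) :* t :- e) :=
               (f :- f :* f) :* t :+ (con (+ 1) :- f) :* (c :* t) :* w) refl f e₀ c w t) ⟩
        (f + (1# - f) * e₀) + ((f - f * f) * t + (1# - f) * (c * t) * w)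
          ≈⟨ +-congˡ (+-congʳ (*-congʳ (+-congˡ (-‿cong ff≈f)))) ⟩
        (f + (1# - f) * e₀) + ((f - f) * t + (1# - f) * (c * t) * w)
          ≈⟨ +-congˡ (solve 3 (λ f t x → (f :- f) :* t :+ x := x) refl f t _) ⟩
        (f + (1# - f) * e₀) + (1# - f) * (c * t) * w ∎
    ; product = λ p q r p≈f → begin
        f * f * p + (1# - f) * e₀ * f * q + f * ((1# - f) * e₀ * h) * r + (1# - f) * e₀ * ((1# - f) * e₀ * h) * s
          ≈⟨ solve 7 (λ f p q r e h s →
               f :* f :* p :+ (con (+ 1) :- f) :* e :* f :* q :+ f :* ((con (+ 1) :- f) :* e :* h) :* r :+
               (con (+ 1) :- f) :* e :* ((con (+ 1) :- f) :* e :* h) :* s :=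
               f :* f :* p :+ (f :- f :* f) :* (e :* q :+ e :* h :* r) :+
               (con (+ 1) :- f :- f :+ f :* f) :* (e :* e :* (h :* s)))
               refl f p q r e₀ h s ⟩
        f * f * p + (f - f * f) * (e₀ * q + e₀ * h * r) + (1# - f - f + f * f) * (e₀ * e₀ * (h * s))
          ≈⟨ +-cong (+-cong (*-cong ff≈f p≈f) (*-congʳ (+-congˡ (-‿cong ff≈f))))
               (*-cong (+-congˡ ff≈f) (trans (*-cong idem hs≈e₀) idem)) ⟩
        f * f + (f - f) * (e₀ * q + e₀ * h * r) + (1# - f - f + f) * e₀
          ≈⟨ +-congʳ (+-congʳ ff≈f) ⟩
        f + (f - f) * (e₀ * q + e₀ * h * r) + (1# - f - f + f) * e₀
          ≈⟨ solve 3 (λ f x e → f :+ (f :- f) :* x :+ (con (+ 1) :- f :- f :+ f) :* e :=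
               f :+ (con (+ 1) :- f) :* e)
               refl f (e₀ * q + e₀ * h * r) e₀ ⟩
        f + (1# - f) * e₀ ∎
    }
    where
    e₀ = (c * s) ^ suc n
    h  = c * (c * s) ^ n

    hs≈e₀ : h * s ≈ e₀
    hs≈e₀ = solve 3 (λ c x s → c :* x :* s := c :* s :* x) refl c ((c * s) ^ n) s

    comaximal : ∃ λ t → 1# ≈ e₀ + (f + c * w) * t
    comaximal = power-comaximal
      (trans 1≈ (solve 4 (λ f c s w → f :+ c :* (s :+ w) := c :* s :+ (f :+ c :* w)) refl f c s w)) (suc n)

    t = proj₁ comaximal

    1≈e₀ : 1# ≈ e₀ + (f + c * w) * t
    1≈e₀ = proj₂ comaximal

-- Quotient rings, and ideals that are principal modulo a submodule.

module Quotients {c ℓ : Level} (K : CommutativeRing c ℓ) where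
  open CommutativeRing K hiding (zero)
  open IntegerAction K
  open Subgroups K
  open Solver using (solve; _:+_; _:*_; :-_; _:=_; _:-_)
  open Sum semiring using (sum)

  record IsSubring {t : Level} (T : Pred Carrier t) : Set (c ⊔ ℓ ⊔ t) where
    field
      isSubgroup : IsSubgroup T
      1∈         : 1# ∈ T
      *-closed   : ∀ {x y} → x ∈ T → y ∈ T → x * y ∈ T
    open IsSubgroup isSubgroup public

  record IsModule {t m : Level} (T : Pred Carrier t) (M : Pred Carrier m) : Set (c ⊔ ℓ ⊔ t ⊔ m) where
    field
      isSubgroup : IsSubgroup M
      *-closed   : ∀ {t x} → t ∈ T → x ∈ M → t * x ∈ M
    open IsSubgroup isSubgroup public

  quotient : ∀ {t d : Level} {T : Pred Carrier t} {D : Pred Carrier d} →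
             IsSubring T → IsModule T D → CommutativeRing (c ⊔ t) d
  quotient {T = T} {D} T-isSubring D-isModule = record
    { Carrier = ∃ T
    ; _≈_     = λ (x , _) (y , _) → x - y ∈ D
    ; _+_     = λ (x , x∈) (y , y∈) → x + y , T.+-closed x∈ y∈
    ; _*_     = λ (x , x∈) (y , y∈) → x * y , T.*-closed x∈ y∈
    ; -_      = λ (x , x∈) → - x , T.neg-closed x∈
    ; 0#      = 0# , T.0∈
    ; 1#      = 1# , T.1∈
    ; isCommutativeRing = record
      { isRing = record
        { +-isAbelianGroup = record
          { isGroup = record
            { isMonoid = record
              { isSemigroup = record
                { isMagma = record
                  { isEquivalence = record
                    { refl  = λ {(x , _)} → ≈⇒∈ refl
                    ; sym   = λ {(x , _)} {(y , _)} x≡y →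
                        D.resp (solve 2 (λ x y → :- (x :- y) := y :- x) refl x y) (D.neg-closed x≡y)
                    ; trans = λ {(x , _)} {(y , _)} {(z , _)} x≡y y≡z →
                        D.resp (solve 3 (λ x y z → (x :- y) :+ (y :- z) := x :- z) refl x y z) (D.+-closed x≡y y≡z)
                    }
                  ; ∙-cong = λ {(x , _)} {(y , _)} {(u , _)} {(v , _)} x≡y u≡v →
                      D.resp (solve 4 (λ x y u v → (x :- y) :+ (u :- v) := (x :+ u) :- (y :+ v)) refl x y u v)
                        (D.+-closed x≡y u≡v)
                  }
                ; assoc = λ (x , _) (y , _) (z , _) → ≈⇒∈ (+-assoc x y z)
                }
              ; identity = (λ (x , _) → ≈⇒∈ (+-identityˡ x)) , (λ (x , _) → ≈⇒∈ (+-identityʳ x))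
              }
            ; inverse = (λ (x , _) → ≈⇒∈ (-‿inverseˡ x)) , (λ (x , _) → ≈⇒∈ (-‿inverseʳ x))
            ; ⁻¹-cong = λ {(x , _)} {(y , _)} x≡y →
                D.resp (solve 2 (λ x y → :- (x :- y) := (:- x) :- (:- y)) refl x y) (D.neg-closed x≡y)
            }
          ; comm = λ (x , _) (y , _) → ≈⇒∈ (+-comm x y)
          }
        ; *-cong = λ {(x , _)} {(y , y∈)} {(u , u∈)} {(v , _)} x≡y u≡v →
            D.resp (solve 4 (λ x y u v → u :* (x :- y) :+ y :* (u :- v) := x :* u :- y :* v) refl x y u v)
              (D.+-closed (D.*-closed u∈ x≡y) (D.*-closed y∈ u≡v))
        ; *-assoc = λ (x , _) (y , _) (z , _) → ≈⇒∈ (*-assoc x y z)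
        ; *-identity = (λ (x , _) → ≈⇒∈ (*-identityˡ x)) , (λ (x , _) → ≈⇒∈ (*-identityʳ x))
        ; distrib = (λ (x , _) (y , _) (z , _) → ≈⇒∈ (distribˡ x y z)) ,
                    (λ (x , _) (y , _) (z , _) → ≈⇒∈ (distribʳ x y z))
        }
      ; *-comm = λ (x , _) (y , _) → ≈⇒∈ (*-comm x y)
      }
    }
    where
    module T = IsSubring T-isSubring
    module D = IsModule D-isModule

    ≈⇒∈ : ∀ {x y} → x ≈ y → x - y ∈ D
    ≈⇒∈ {x} {y} x≈y = D.resp (sym (trans (+-congʳ x≈y) (-‿inverseʳ y))) D.0∈

  -- A locally principal fractional ideal is principal modulo D as soon as T/D is zero-dimensional.
  module _ {t d i m : Level} {T : Pred Carrier t} {D : Pred Carrier d} {I : Pred Carrier i} {M : Pred Carrier m}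
           (T-isSubring : IsSubring T) (D-isModule : IsModule T D)
           (I-isModule : IsModule T I) (M-isModule : IsModule T M)
           (IM⊆T : ∀ {x y} → x ∈ M → y ∈ I → x * y ∈ T)
           (idempotentPowers : ∀ a → IdempotentPowers.HasIdempotentPower (quotient T-isSubring D-isModule) a) where
    private
      module T = IsSubring T-isSubring
      module I = IsModule I-isModule
      module M = IsModule M-isModule
      module A = CommutativeRing (quotient T-isSubring D-isModule)
    open IdempotentPowers (quotient T-isSubring D-isModule)

    ≈⇒≈ᴬ : ∀ {x y} (x∈ : x ∈ T) (y∈ : y ∈ T) → x ≈ y → (x , x∈) A.≈ (y , y∈)
    ≈⇒≈ᴬ {x} {y} _ _ x≈y =
      IsModule.resp D-isModule (sym (trans (+-congʳ x≈y) (-‿inverseʳ y))) (IsModule.0∈ D-isModule)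

    pairing∈ : ∀ n (v u : Vector Carrier n) → (∀ j → v j ∈ M) → (∀ j → u j ∈ I) → sum (zipWith _*_ v u) ∈ T
    pairing∈ zero    v u v∈ u∈ = T.0∈
    pairing∈ (suc n) v u v∈ u∈ =
      T.+-closed (IM⊆T (v∈ zero) (u∈ zero)) (pairing∈ n (v ∘ suc) (u ∘ suc) (v∈ ∘ suc) (u∈ ∘ suc))

    -- The invariant of the induction: `x y` is congruent to an idempotent `f`, and the terms not
    -- yet treated generate the unit ideal together with `f`. Once no term is left, `f` is congruent
    -- to 1, and so is `x y`.
    extend-principal : ∀ n (v u : Vector Carrier n) (v∈ : ∀ j → v j ∈ M) (u∈ : ∀ j → u j ∈ I)
      (f c : A.Carrier) {x y : Carrier} (x∈ : x ∈ M) (y∈ : y ∈ I) →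
      f A.* f A.≈ f → (x * y , IM⊆T x∈ y∈) A.≈ f →
      A.1# A.≈ f A.+ c A.* (sum (zipWith _*_ v u) , pairing∈ n v u v∈ u∈) →
      ∃₂ λ x y → x ∈ M × y ∈ I × 1# - x * y ∈ D
    extend-principal zero v u v∈ u∈ f c {x} {y} x∈ y∈ _ xy≈f 1≈ = x , y , x∈ , y∈ ,
      A.trans {i = A.1#} {j = f A.+ c A.* (0# , T.0∈)} {k = x * y , IM⊆T x∈ y∈} 1≈
        (A.trans {i = f A.+ c A.* (0# , T.0∈)} {j = f} {k = x * y , IM⊆T x∈ y∈}
          (≈⇒≈ᴬ (proj₂ (f A.+ c A.* (0# , T.0∈))) (proj₂ f)
            (trans (+-congˡ (zeroʳ (proj₁ c))) (+-identityʳ (proj₁ f))))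
          (A.sym {x = x * y , IM⊆T x∈ y∈} {y = f} xy≈f))
    extend-principal (suc n) v u v∈ u∈ f c {x} {y} x∈ y∈ ff≈f xy≈f 1≈ =
      extend-principal n (v ∘ suc) (u ∘ suc) (v∈ ∘ suc) (u∈ ∘ suc) (f A.+ e) c′ x′∈ y′∈ idempotent
        (A.trans {i = x′ * y′ , IM⊆T x′∈ y′∈} {j = expanded} {k = f A.+ e}
          (≈⇒≈ᴬ (IM⊆T x′∈ y′∈) (proj₂ expanded)
            (solve 7 (λ f e h x y v u → (f :* x :+ e :* v) :* (f :* y :+ e :* h :* u) :=
                f :* f :* (x :* y) :+ e :* f :* (v :* y) :+ f :* (e :* h) :* (x :* u) :+ e :* (e :* h) :* (v :* u))
              refl (proj₁ f) (proj₁ e) (proj₁ h) x y (v zero) (u zero)))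
          (product (x * y , IM⊆T x∈ y∈) (v zero * y , IM⊆T (v∈ zero) y∈) (x * u zero , IM⊆T x∈ (u∈ zero)) xy≈f))
        remainder
      where
      s w : A.Carrier
      s = v zero * u zero , IM⊆T (v∈ zero) (u∈ zero)
      w = sum (zipWith _*_ (v ∘ suc) (u ∘ suc)) , pairing∈ n (v ∘ suc) (u ∘ suc) (v∈ ∘ suc) (u∈ ∘ suc)
      open Enlargement (enlarge f c s w ff≈f 1≈ (idempotentPowers (c A.* s)))
      -- The old pair is kept on the component of `f` and the pair `v zero`, `u zero` is glued in on
      -- the orthogonal component of `e`; the factor `h` normalises its product there to `e`.
      x′ = proj₁ f * x + proj₁ e * v zero
      y′ = proj₁ f * y + proj₁ e * proj₁ h * u zero
      x′∈ : x′ ∈ M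
      x′∈ = M.+-closed (M.*-closed (proj₂ f) x∈) (M.*-closed (proj₂ e) (v∈ zero))
      y′∈ : y′ ∈ I
      y′∈ = I.+-closed (I.*-closed (proj₂ f) y∈) (I.*-closed (proj₂ (e A.* h)) (u∈ zero))
      expanded : A.Carrier
      expanded = f A.* f A.* (x * y , IM⊆T x∈ y∈) A.+ e A.* f A.* (v zero * y , IM⊆T (v∈ zero) y∈)
        A.+ f A.* (e A.* h) A.* (x * u zero , IM⊆T x∈ (u∈ zero)) A.+ e A.* (e A.* h) A.* s

    principal-modulo : ∀ n (v u : Vector Carrier n) → (∀ j → v j ∈ M) → (∀ j → u j ∈ I) →
      1# ≈ sum (zipWith _*_ v u) → ∃₂ λ x y → x ∈ M × y ∈ I × 1# - x * y ∈ D
    principal-modulo n v u v∈ u∈ 1≈ =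
      -- The induction starts from the idempotent 0, represented by `x = y = 0`, with all terms
      -- still to be treated.
      extend-principal n v u v∈ u∈ A.0# A.1# M.0∈ I.0∈
        (≈⇒≈ᴬ (proj₂ (A.0# A.* A.0#)) (proj₂ A.0#) (zeroˡ 0#))
        (≈⇒≈ᴬ (IM⊆T M.0∈ I.0∈) (proj₂ A.0#) (zeroˡ 0#))
        (≈⇒≈ᴬ (proj₂ A.1#) (proj₂ (A.0# A.+ A.1# A.* (_ , pairing∈ n v u v∈ u∈)))
          (trans 1≈ (sym (trans (+-identityˡ _) (*-identityˡ _)))))

-- Duality of lattices under a nondegenerate form.

module DualLattices {c ℓ : Level} (K : CommutativeRing c ℓ)
  (invertible : IntegerAction.PositiveIntegersInvertible K)
  (τ : CommutativeRing.Carrier K → ℚ) (linear : RationalLattices.IsLinear K invertible τ)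
  (es : List (CommutativeRing.Carrier K))
  (nondegenerate : ∀ x → All (λ e → τ (CommutativeRing._*_ K e x) ≡ 0ℚ) es →
                   CommutativeRing._≈_ K x (CommutativeRing.0# K)) where
  open CommutativeRing K hiding (zero)
  open IntegerAction K
  open RationalScalars K invertible
  open Subgroups K
  open RationalLattices K invertible
  open TraceForm K invertible τ linear
  open Solver using (solve; con; _:+_; _:*_; :-_; _:=_; _:-_)
  open IsLinear linear
  open SetoidReasoning setoid

  Integral : ℚ → Set
  Integral q = ∃ λ z → q ≡ fromℤ z

  expand-∈ : ∀ {h : Level} {H : Pred Carrier h} → IsSubgroup H → ∀ fr x →
             All (λ (b , _) → b ∈ H) fr → All (λ (_ , y) → Integral (τ* y x)) fr → expand fr x ∈ H
  expand-∈ H-isSubgroup [] x [] [] = IsSubgroup.0∈ H-isSubgroup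
  expand-∈ H-isSubgroup ((b , y) ∷ fr) x (b∈ ∷ bs∈) ((z , eq) ∷ integrals) =
    +-closed (resp (*-congʳ (trans (sym (φ-fromℤ z)) (reflexive (≡.cong φ (≡.sym eq))))) (ℤ-closed z b∈))
      (expand-∈ H-isSubgroup fr x bs∈ integrals)
    where open IsSubgroup H-isSubgroup

  expand-cong : ∀ fr {x x′} → x ≈ x′ → expand fr x ≈ expand fr x′
  expand-cong []             x≈x′ = refl
  expand-cong ((b , y) ∷ fr) x≈x′ =
    +-cong (*-congʳ (reflexive (≡.cong φ (cong (*-congˡ x≈x′))))) (expand-cong fr x≈x′)

  expand-+ : ∀ fr x x′ → expand fr (x + x′) ≈ expand fr x + expand fr x′
  expand-+ [] x x′ = sym (+-identityˡ 0#)
  expand-+ ((b , y) ∷ fr) x x′ = trans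
    (+-cong (*-congʳ (trans (reflexive (≡.cong φ (IsLinear.homo-+ (τ*-isLinear y) x x′)))
      (φ-homo-+ (τ* y x) (τ* y x′)))) (expand-+ fr x x′))
    (solve 5 (λ p q b s t → (p :+ q) :* b :+ (s :+ t) := (p :* b :+ s) :+ (q :* b :+ t)) refl
      (φ (τ* y x)) (φ (τ* y x′)) b (expand fr x) (expand fr x′))

  expand-* : ∀ fr q x → expand fr (φ q * x) ≈ φ q * expand fr x
  expand-* [] q x = sym (zeroʳ (φ q))
  expand-* ((b , y) ∷ fr) q x = trans
    (+-cong (*-congʳ (trans (reflexive (≡.cong φ (IsLinear.homo-* (τ*-isLinear y) q x)))
      (φ-homo-* q (τ* y x)))) (expand-* fr q x))
    (solve 4 (λ q p b s → (q :* p) :* b :+ q :* s := q :* (p :* b :+ s)) refl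
      (φ q) (φ (τ* y x)) b (expand fr x))

  expand-0 : ∀ fr → expand fr 0# ≈ 0#
  expand-0 fr = trans (expand-cong fr (sym (zeroˡ 0#)))
    (trans (expand-cong fr (*-congʳ (sym φ-0))) (trans (expand-* fr 0ℚ 0#) (trans (*-congʳ φ-0) (zeroˡ _))))

  expand-neg : ∀ fr x → expand fr (- x) ≈ - expand fr x
  expand-neg fr x = trans (expand-cong fr (-1*≈ x)) (trans (expand-* fr (ℚ.- 1ℚ) x) (sym (-1*≈ (expand fr x))))
    where
    -1*≈ : ∀ x → - x ≈ φ (ℚ.- 1ℚ) * x
    -1*≈ x = trans (solve 1 (λ x → :- x := (:- con (+ 1)) :* x) refl x)
      (*-congʳ (trans (-‿cong (sym φ-1)) (sym (φ-homo-neg 1ℚ))))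

  expands-ℚ-span : ∀ {gs fr} → IsFrame gs fr → ∀ {x} → x ∈ ℚ-span ⟨ gs ⟩ₗ → x ≈ expand fr x
  expands-ℚ-span {fr = fr} isFrame = ⟨⟩-least {H = λ x → x ≈ expand fr x} (record
    { resp       = λ x≈y x≈ → trans (sym x≈y) (trans x≈ (expand-cong fr x≈y))
    ; 0∈         = sym (expand-0 fr)
    ; +-closed   = λ {x} {y} x≈ y≈ → trans (+-cong x≈ y≈) (sym (expand-+ fr x y))
    ; neg-closed = λ {x} x≈ → trans (-‿cong x≈) (sym (expand-neg fr x))
    }) λ { (q , y , y∈ , x≈) → trans x≈ (trans (*-congˡ (IsFrame.expands isFrame y∈))
             (trans (sym (expand-* fr q y)) (expand-cong fr (sym x≈)))) }

  dual-expand : Frame → Carrier → Carrier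
  dual-expand []             x = 0#
  dual-expand ((b , y) ∷ fr) x = φ (τ* b x) * y + dual-expand fr x

  -- A pair `(b , y)` contributes `τ (b x) τ (w y)` to either side. With nondegeneracy this turns
  -- the expansion of all elements in the vectors `b` into one in the dual vectors `y`.
  expand-adjoint : ∀ fr w x → τ* w (dual-expand fr x) ≡ τ* x (expand fr w)
  expand-adjoint [] w x = ≡.trans (IsLinear.homo-0 (τ*-isLinear w)) (≡.sym (IsLinear.homo-0 (τ*-isLinear x)))
  expand-adjoint ((b , y) ∷ fr) w x = ≡.trans (IsLinear.homo-+ (τ*-isLinear w) _ _) (≡.trans
    (≡.cong₂ ℚ._+_
      (≡.trans (IsLinear.homo-* (τ*-isLinear w) (τ* b x) y) (≡.trans (ℚₚ.*-comm (τ* b x) (τ* w y))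
        (≡.trans (≡.cong₂ ℚ._*_ (cong (*-comm w y)) (cong (*-comm b x)))
          (≡.sym (IsLinear.homo-* (τ*-isLinear x) (τ* y w) b)))))
      (expand-adjoint fr w x))
    (≡.sym (IsLinear.homo-+ (τ*-isLinear x) _ _)))

  τ-separates : ∀ {x x′} → (∀ w → τ* w x ≡ τ* w x′) → x ≈ x′
  τ-separates {x} {x′} equal = begin
    x               ≈⟨ solve 2 (λ x y → x := (x :- y) :+ y) refl x x′ ⟩
    (x - x′) + x′   ≈⟨ +-congʳ (nondegenerate (x - x′) (All.universal orthogonal es)) ⟩
    0# + x′         ≈⟨ +-identityˡ x′ ⟩
    x′              ∎
    where
    orthogonal : ∀ e → τ* e (x - x′) ≡ 0ℚ
    orthogonal e = ≡.trans (IsLinear.homo-sub (τ*-isLinear e) x x′)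
      (≡.trans (≡.cong (λ q → q ℚ.- τ* e x′) (equal e)) (ℚₚ.+-inverseʳ (τ* e x′)))

  -- For a full lattice I with multiplicator ring S this is Sᵗ ⊆ I Iᵗ, obtained by dualising twice.
  multiplicator-dual⊆ : ∀ gs → (∀ x → x ∈ ℚ-span ⟨ gs ⟩ₗ) → ∀ {x} →
    (∀ y → (∀ {i} → i ∈ ⟨ gs ⟩ₗ → y * i ∈ ⟨ gs ⟩ₗ) → Integral (τ (x * y))) →
    x ∈ ⟨ (λ w → ∃₂ λ b y → b ∈ ⟨ gs ⟩ₗ × (∀ i → i ∈ ⟨ gs ⟩ₗ → Integral (τ (y * i))) × w ≈ b * y) ⟩
  multiplicator-dual⊆ gs full {x} x∈Sᵗ =
    -- The dual vectors of the second frame lie in `(I Iᵗ)ᵗ`, hence stabilise `I`. The hypothesis on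
    -- `x` therefore makes the coordinates of `x` in the vectors of that frame integral, and these
    -- vectors lie in `I Iᵗ`.
    ⟨⟩-resp (sym (expands-ℚ-span isFrame₂ (ps-full x)))
      (expand-∈ ⟨⟩-isSubgroup fr₂ x (All.map ps⊆ members₂)
        (All.map (λ {(_ , y)} integral → let z , eq = x∈Sᵗ y (λ i∈ → stabilises integral i∈)
                                        in z , ≡.trans (cong (*-comm y x)) eq) integral₂))
    where
    frame₁ = frame es gs (λ {x} _ → nondegenerate x)
    fr₁ = proj₁ frame₁
    isFrame₁ = proj₂ frame₁
    open IsFrame isFrame₁ using () renaming (members to members₁; integral to integral₁)

    -- A finite set of products whose span plays the part of `I Iᵗ`: vectors of a frame of `I` times
    -- its dual vectors.
    ps = cartesianProductWith (λ (b , _) (_ , y) → b * y) fr₁ fr₁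

    frame₂ = frame es ps (λ {x} _ → nondegenerate x)
    fr₂ = proj₁ frame₂
    isFrame₂ = proj₂ frame₂
    open IsFrame isFrame₂ using () renaming (members to members₂; integral to integral₂)

    product∈ : ∀ {i v} → i ∈ ⟨ gs ⟩ₗ → v ∈ₗ fr₁ → i * proj₂ v ∈ ⟨ ps ⟩ₗ
    product∈ {i} {v} i∈ v∈ = ⟨⟩-resp (*-congʳ (sym (IsFrame.expands isFrame₁ i∈)))
      (expand-∈ (times-isSubgroup ⟨⟩-isSubgroup (proj₂ v)) fr₁ i
        (All.tabulate (λ u∈ → generator (∈-cartesianProductWith⁺ _ u∈ v∈)))
        (All.map (λ integral → integral i∈) integral₁))

    -- The coordinate of `y i` at a dual vector `v` is `τ (y (i v))`, and `i v` lies in `I Iᵗ`.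
    -- Integral coordinates put `y i` back into `I`.
    stabilises : ∀ {y} → (∀ {p} → p ∈ ⟨ ps ⟩ₗ → Integral (τ* y p)) → ∀ {i} → i ∈ ⟨ gs ⟩ₗ → y * i ∈ ⟨ gs ⟩ₗ
    stabilises {y} integral {i} i∈ = ⟨⟩-resp (sym (expands-ℚ-span isFrame₁ (full (y * i))))
      (expand-∈ ⟨⟩-isSubgroup fr₁ (y * i) members₁ (All.tabulate λ {v} v∈ →
        let z , eq = integral (product∈ i∈ v∈)
        in z , ≡.trans (cong (solve 3 (λ v y i → v :* (y :* i) := y :* (i :* v)) refl (proj₂ v) y i)) eq))

    ps⊆ : ∀ {p} → p ∈ ⟨ ps ⟩ₗ →
      p ∈ ⟨ (λ w → ∃₂ λ b y → b ∈ ⟨ gs ⟩ₗ × (∀ i → i ∈ ⟨ gs ⟩ₗ → Integral (τ (y * i))) × w ≈ b * y) ⟩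
    ps⊆ = ⟨⟩-least ⟨⟩-isSubgroup λ p∈ →
      let (u , v , u∈ , v∈ , p≡) = ∈-cartesianProductWith⁻ (λ (b , _) (_ , y) → b * y) fr₁ fr₁ p∈
      in generator (proj₁ u , proj₂ v , All.lookup members₁ u∈ , (λ _ → All.lookup integral₁ v∈) , reflexive p≡)

    ℚ-span-* : ∀ q {w} → w ∈ ℚ-span ⟨ ps ⟩ₗ → φ q * w ∈ ℚ-span ⟨ ps ⟩ₗ
    ℚ-span-* q w∈ = ⟨⟩-resp (*-comm _ _) (⟨⟩-least (times-isSubgroup ⟨⟩-isSubgroup (φ q))
      (λ { (p , y , y∈ , w≈) → generator (q ℚ.* p , y , y∈ , trans (*-congʳ w≈)
        (trans (solve 3 (λ p y q → (p :* y) :* q := (q :* p) :* y) refl (φ p) y (φ q))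
          (*-congʳ (sym (φ-homo-* q p))))) }) w∈)

    expand-full : ∀ {v} → v ∈ₗ fr₁ → ∀ w fr → (∀ {u} → u ∈ₗ fr → u ∈ₗ fr₁) → expand fr w * proj₂ v ∈ ℚ-span ⟨ ps ⟩ₗ
    expand-full v∈ w []             _   = ⟨⟩-resp (sym (zeroˡ _)) ⟨⟩-0
    expand-full v∈ w ((b , y) ∷ fr) fr⊆ = ⟨⟩-resp (sym (distribʳ _ _ _)) (⟨⟩-+
      (generator (τ* y w , _ , generator (∈-cartesianProductWith⁺ _ (fr⊆ (here ≡.refl)) v∈) , *-assoc _ _ _))
      (expand-full v∈ w fr (λ u∈ → fr⊆ (there u∈))))

    dual-expand-full : ∀ w fr → (∀ {u} → u ∈ₗ fr → u ∈ₗ fr₁) → w * dual-expand fr 1# ∈ ℚ-span ⟨ ps ⟩ₗ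
    dual-expand-full w []             _   = ⟨⟩-resp (sym (zeroʳ w)) ⟨⟩-0
    dual-expand-full w ((b , y) ∷ fr) fr⊆ = ⟨⟩-resp (sym (distribˡ w _ _)) (⟨⟩-+
      (⟨⟩-resp (trans (*-congˡ (*-congʳ (sym (expands-ℚ-span isFrame₁ (full w)))))
          (solve 3 (λ q w y → q :* (w :* y) := w :* (q :* y)) refl (φ (τ* b 1#)) w y))
        (ℚ-span-* (τ* b 1#) (expand-full (fr⊆ (here ≡.refl)) w fr₁ (λ u∈ → u∈))))
      (dual-expand-full w fr (λ u∈ → fr⊆ (there u∈))))

    -- The adjoint expansion writes 1 as a rational combination of the dual vectors `y`, so `w` is
    -- one of the elements `w y`; expanding this factor `w` in the vectors `b` leaves only the
    -- products `b y`.
    ps-full : ∀ w → w ∈ ℚ-span ⟨ ps ⟩ₗ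
    ps-full w = ⟨⟩-resp (trans (*-congˡ (sym 1≈)) (*-identityʳ w)) (dual-expand-full w fr₁ (λ u∈ → u∈))
      where
      1≈ : 1# ≈ dual-expand fr₁ 1#
      1≈ = τ-separates λ v → ≡.trans (cong (*-comm v 1#)) (≡.trans
        (cong (*-congˡ (expands-ℚ-span isFrame₁ (full v)))) (≡.sym (expand-adjoint fr₁ v 1#)))

-- Finiteness of a lattice modulo a positive integer.

module Residues {c ℓ : Level} (K : CommutativeRing c ℓ) where
  open CommutativeRing K hiding (zero)
  open IntegerAction K
  open Subgroups K
  open Quotients K
  open Solver using (solve; _:+_; _:*_; :-_; _:=_; _:-_)
  open SetoidReasoning setoid

  -- Equal labels force congruence. Congruent elements may carry different labels, because the label
  -- is computed from a membership proof and the coefficients found there are not unique.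
  FinitelyManyResidues : List Carrier → ℕ → Set (c ⊔ ℓ)
  FinitelyManyResidues gs n = ∃₂ λ m (residue : ∀ {x} → x ∈ ⟨ gs ⟩ₗ → Fin m) →
    ∀ {x y} (x∈ : x ∈ ⟨ gs ⟩ₗ) (y∈ : y ∈ ⟨ gs ⟩ₗ) → residue x∈ ≡ residue y∈ →
    ∃ λ t → t ∈ ⟨ gs ⟩ₗ × x - y ≈ ⟦ + suc n ⟧ * t

  finitelyManyResidues : ∀ gs n → FinitelyManyResidues gs n
  finitelyManyResidues [] n = 1 , (λ _ → zero) , λ {x} {y} x∈ y∈ _ → 0# , ⟨⟩-0 , (begin
    x - y                  ≈⟨ +-cong (⟨[]⟩-trivial x∈) (-‿cong (⟨[]⟩-trivial y∈)) ⟩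
    0# - 0#                ≈⟨ -‿inverseʳ 0# ⟩
    0#                     ≈⟨ zeroʳ _ ⟨
    ⟦ + suc n ⟧ * 0#       ∎)
  finitelyManyResidues (g ∷ gs) n =
    suc n ℕ.* m , (λ x∈ → residue′ (⟨∷⟩⁻ x∈)) , λ x∈ y∈ eq → congruent (⟨∷⟩⁻ x∈) (⟨∷⟩⁻ y∈) eq
    where
    finite = finitelyManyResidues gs n
    m = proj₁ finite
    residue = proj₁ (proj₂ finite)

    Decomposition : Carrier → Set (c ⊔ ℓ)
    Decomposition x = ∃₂ λ z y → y ∈ ⟨ gs ⟩ₗ × x ≈ ⟦ z ⟧ * g + y

    residueℤ : ℤ → Fin (suc n)
    residueℤ z = Fin.fromℕ< (ℤDivMod.n%ℕd<d z (suc n))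

    residue′ : ∀ {x} → Decomposition x → Fin (suc n ℕ.* m)
    residue′ (z , _ , y∈ , _) = Fin.combine (residueℤ z) (residue y∈)

    residueℤ-injective : ∀ z z′ → residueℤ z ≡ residueℤ z′ →
      ⟦ z ⟧ - ⟦ z′ ⟧ ≈ ⟦ + suc n ⟧ * (⟦ z ℤDivMod./ℕ suc n ⟧ - ⟦ z′ ℤDivMod./ℕ suc n ⟧)
    residueℤ-injective z z′ eq = begin
      ⟦ z ⟧ - ⟦ z′ ⟧
        ≈⟨ +-cong (divide z) (-‿cong (divide z′)) ⟩
      (⟦ + (z ℤDivMod.%ℕ suc n) ⟧ + ⟦ z ℤDivMod./ℕ suc n ⟧ * ⟦ + suc n ⟧) -
      (⟦ + (z′ ℤDivMod.%ℕ suc n) ⟧ + ⟦ z′ ℤDivMod./ℕ suc n ⟧ * ⟦ + suc n ⟧)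
        ≡⟨ ≡.cong (λ r → (⟦ + r ⟧ + ⟦ z ℤDivMod./ℕ suc n ⟧ * ⟦ + suc n ⟧) -
             (⟦ + (z′ ℤDivMod.%ℕ suc n) ⟧ + ⟦ z′ ℤDivMod./ℕ suc n ⟧ * ⟦ + suc n ⟧))
             (Finₚ.fromℕ<-injective _ _ (ℤDivMod.n%ℕd<d z (suc n)) (ℤDivMod.n%ℕd<d z′ (suc n)) eq) ⟩
      (⟦ + (z′ ℤDivMod.%ℕ suc n) ⟧ + ⟦ z ℤDivMod./ℕ suc n ⟧ * ⟦ + suc n ⟧) -
      (⟦ + (z′ ℤDivMod.%ℕ suc n) ⟧ + ⟦ z′ ℤDivMod./ℕ suc n ⟧ * ⟦ + suc n ⟧)
        ≈⟨ solve 4 (λ r q q′ d → (r :+ q :* d) :- (r :+ q′ :* d) := d :* (q :- q′)) refl _ _ _ _ ⟩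
      ⟦ + suc n ⟧ * (⟦ z ℤDivMod./ℕ suc n ⟧ - ⟦ z′ ℤDivMod./ℕ suc n ⟧) ∎
      where
      divide : ∀ z → ⟦ z ⟧ ≈ ⟦ + (z ℤDivMod.%ℕ suc n) ⟧ + ⟦ z ℤDivMod./ℕ suc n ⟧ * ⟦ + suc n ⟧
      divide z = trans (reflexive (≡.cong ⟦_⟧ (ℤDivMod.a≡a%ℕn+[a/ℕn]*n z (suc n))))
        (trans (⟦⟧-homo-+ (+ (z ℤDivMod.%ℕ suc n)) (z ℤDivMod./ℕ suc n ℤ.* + suc n))
          (+-congˡ (⟦⟧-homo-* (z ℤDivMod./ℕ suc n) (+ suc n))))

    congruent : ∀ {x x′} (d : Decomposition x) (d′ : Decomposition x′) → residue′ d ≡ residue′ d′ →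
                ∃ λ t → t ∈ ⟨ g ∷ gs ⟩ₗ × x - x′ ≈ ⟦ + suc n ⟧ * t
    congruent {x} {x′} (z , y , y∈ , x≈) (z′ , y′ , y′∈ , x′≈) eq =
      q * g + t , ⟨⟩-+ qg∈ (⟨∷⟩⁺ t∈) , (begin
        x - x′                                      ≈⟨ +-cong x≈ (-‿cong x′≈) ⟩
        (⟦ z ⟧ * g + y) - (⟦ z′ ⟧ * g + y′)
          ≈⟨ solve 5 (λ z z′ g y y′ → (z :* g :+ y) :- (z′ :* g :+ y′) := (z :- z′) :* g :+ (y :- y′)) refl
               _ _ g y y′ ⟩
        (⟦ z ⟧ - ⟦ z′ ⟧) * g + (y - y′)
          ≈⟨ +-cong (*-congʳ (residueℤ-injective z z′ (proj₁ equal))) (proj₂ (proj₂ step)) ⟩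
        ⟦ + suc n ⟧ * q * g + ⟦ + suc n ⟧ * t
          ≈⟨ solve 4 (λ d q g t → d :* q :* g :+ d :* t := d :* (q :* g :+ t)) refl _ q g t ⟩
        ⟦ + suc n ⟧ * (q * g + t)                   ∎)
      where
      equal = Finₚ.combine-injective (residueℤ z) (residue y∈) (residueℤ z′) (residue y′∈) eq
      step = proj₂ (proj₂ finite) y∈ y′∈ (proj₂ equal)
      t = proj₁ step
      t∈ = proj₁ (proj₂ step)
      q = ⟦ z ℤDivMod./ℕ suc n ⟧ - ⟦ z′ ℤDivMod./ℕ suc n ⟧
      g∈ : g ∈ ⟨ g ∷ gs ⟩ₗ
      g∈ = generator (here ≡.refl)
      qg∈ : q * g ∈ ⟨ g ∷ gs ⟩ₗ
      qg∈ = ⟨⟩-resp (solve 3 (λ p p′ g → p :* g :+ :- (p′ :* g) := (p :- p′) :* g) refl _ _ g)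
        (⟨⟩-+ (IsSubgroup.ℤ-closed ⟨⟩-isSubgroup (z ℤDivMod./ℕ suc n) g∈)
              (⟨⟩-neg (IsSubgroup.ℤ-closed ⟨⟩-isSubgroup (z′ ℤDivMod./ℕ suc n) g∈)))

  module _ {t : Level} {T : Pred Carrier t} (T-isSubring : IsSubring T)
           (ts : List Carrier) (ts⊆T : ⟨ ts ⟩ₗ ⊆ T) (T⊆ts : T ⊆ ⟨ ts ⟩ₗ) (n : ℕ) where
    private module T = IsSubring T-isSubring

    Multiples : Pred Carrier (c ⊔ ℓ ⊔ t)
    Multiples x = ∃ λ y → y ∈ T × x ≈ ⟦ + suc n ⟧ * y

    multiples-isModule : IsModule T Multiples
    multiples-isModule = record
      { isSubgroup = record
        { resp       = λ { x≈x′ (y , y∈ , x≈) → y , y∈ , trans (sym x≈x′) x≈ }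
        ; 0∈         = 0# , T.0∈ , sym (zeroʳ _)
        ; +-closed   = λ { (y , y∈ , x≈) (y′ , y′∈ , x′≈) →
            y + y′ , T.+-closed y∈ y′∈ , trans (+-cong x≈ x′≈) (sym (distribˡ _ y y′)) }
        ; neg-closed = λ { (y , y∈ , x≈) → - y , T.neg-closed y∈ ,
            trans (-‿cong x≈) (solve 2 (λ n y → :- (n :* y) := n :* :- y) refl _ y) }
        }
      ; *-closed = λ { {a} a∈ (y , y∈ , x≈) → a * y , T.*-closed a∈ y∈ ,
          trans (*-congˡ x≈) (solve 3 (λ a n y → a :* (n :* y) := n :* (a :* y)) refl a _ y) }
      }

    private A = quotient T-isSubring multiples-isModule
    open Exp (CommutativeRing.semiring A) using (_^_)

    -- Among `m + 1` powers of `a` two carry the same one of `m` labels, so the powers are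
    -- eventually periodic.
    quotient-idempotentPowers : ∀ a → IdempotentPowers.HasIdempotentPower A a
    quotient-idempotentPowers a = repeat (Finₚ.pigeonhole (ℕₚ.n<1+n m) f)
      where
      finite = finitelyManyResidues ts n
      m = proj₁ finite
      residue = proj₁ (proj₂ finite)

      f : Fin (suc m) → Fin m
      f i = residue (T⊆ts (proj₂ (a ^ toℕ i)))

      repeat : (∃₂ λ i j → toℕ i ℕ.< toℕ j × f i ≡ f j) → IdempotentPowers.HasIdempotentPower A a
      repeat (i , j , i<j , fi≡fj) =
        -- The period is the successor of the last argument, namely `j - i`, which is positive since
        -- `i < j`.
        IdempotentPowers.periodic⇒idempotentPower A a (toℕ i) (toℕ j ℕ.∸ suc (toℕ i))
          (≡.subst (λ k → CommutativeRing._≈_ A (a ^ toℕ i) (a ^ k))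
            (≡.trans (≡.sym (ℕₚ.m+[n∸m]≡n i<j)) (≡.sym (ℕₚ.+-suc (toℕ i) _)))
            (let t , t∈ , eq = proj₂ (proj₂ finite) (T⊆ts (proj₂ (a ^ toℕ i))) (T⊆ts (proj₂ (a ^ toℕ j))) fi≡fj
             in t , ts⊆T t∈ , eq))

-- Orders and fractional ideals in the total quotient ring.

module Orders {a r c ℓ : Level} (R : CommutativeRing a r) (isOrder : IsOrder R)
  (K : CommutativeRing c ℓ) (ι : CommutativeRing.Carrier R → CommutativeRing.Carrier K)
  (isTotalQuotientRing : IsTotalQuotientRing R K ι) where
  open InTotalQuotientRing R isOrder K ι isTotalQuotientRing
  open IsTotalQuotientRing isTotalQuotientRing
  open CommutativeRing K hiding (zero)
  open IntegerAction K
  open Subgroups K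
  open Quotients K using (IsSubring; IsModule)
  open Solver using (solve; con; _:+_; _:*_; :-_; _:=_; _:-_)
  open Sum semiring using (sum; sum-cong-≋; *-distribˡ-sum; sum-replicate-zero)
  open SetoidReasoning setoid
  private
    module R = CommutativeRing R
    module Rₘ = Mult R.semiring
    module Kₘ = Mult semiring
    module Rₛ = Sum R.semiring
    module Rᵢ = IntegerAction R
    module ι = RingMorphisms.IsRingMonomorphism isRingMonomorphism

  ι-× : ∀ n x → ι (n Rₘ.× x) ≈ ⟦ + n ⟧ * ι x
  ι-× n x = trans (go n) (×ᵤ≈⟦⟧* n (ι x))
    where
    go : ∀ n → ι (n Rₘ.× x) ≈ n Kₘ.× ι x
    go zero    = ι.0#-homo
    go (suc n) = trans (ι.+-homo x (n Rₘ.× x)) (+-congˡ (go n))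

  invertible : PositiveIntegersInvertible
  invertible = record
    { _⁻¹        = λ d → proj₁ (inverse-suc d)
    ; ⁻¹-inverse = λ d → trans
        (*-congʳ (sym (trans (ι-× (suc d) R.1#) (trans (*-congˡ ι.1#-homo) (*-identityʳ _)))))
        (proj₂ (inverse-suc d))
    }
    where
    inverse-suc = λ d → inverse (suc d Rₘ.× R.1#) (suc×1-nonZeroDivisor R isOrder d)

  open PositiveIntegersInvertible invertible
  open RationalScalars K invertible
  open RationalLattices K invertible
  open Coordinates K invertible

  ·ℚ≈· : ∀ q x → q ·ℚ x ≈ q · x
  ·ℚ≈· q@record{} x = trans (*-congʳ (·ℤ≈⟦⟧* (ℚ.↥ q) x))
    (solve 3 (λ n x d → n :* x :* d := n :* d :* x) refl ⟦ ℚ.↥ q ⟧ x _)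

  ·ℚ-basis⇒·-basis : ∀ {n} {e : Vector Carrier n} → Scalars.IsBasis K 0ℚ _·ℚ_ e → Scalars.IsBasis K 0ℚ _·_ e
  ·ℚ-basis⇒·-basis {n} {e} isBasis = record
    { spans       = λ x → proj₁ (spans x) ,
        trans (proj₂ (spans x)) (sum-cong-≋ (λ i → ·ℚ≈· (proj₁ (spans x) i) (e i)))
    ; independent = λ k eq → independent k (trans (sum-cong-≋ (λ i → ·ℚ≈· (k i) (e i))) eq)
    }
    where open Scalars.IsBasis isBasis

  module _ {n : ℕ} {e : Vector Carrier n} (isBasisℚ : Scalars.IsBasis K 0ℚ _·ℚ_ e) where
    private isBasis = ·ℚ-basis⇒·-basis isBasisℚ

    hasTrace-unique : ∀ {x q} → HasTrace x q → q ≡ trace isBasis x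
    hasTrace-unique {x} h = ≡.trans (HasTrace.trace h) (≡.trans
      (ℚΣ.sum-cong-≋ (λ i → ≡.sym (coordinates-unique isBasis′ (λ j → HasTrace.matrix h j i)
        (trans (HasTrace.columns h i) (sum-cong-≋ (λ j → ·ℚ≈· (HasTrace.matrix h j i) (HasTrace.basis h j)))) i)))
      (trace-unique isBasis isBasis′ x))
      where
      isBasis′ = ·ℚ-basis⇒·-basis (HasTrace.isBasis h)

    trace-hasTrace : ∀ x {q} → q ≡ trace isBasis x → HasTrace x q
    trace-hasTrace x q≡ = record
      { basis   = e
      ; isBasis = isBasisℚ
      ; matrix  = λ i j → coordinate isBasis i (x * e j)
      ; columns = λ j → trans (expansion isBasis (x * e j))
          (sum-cong-≋ (λ i → sym (·ℚ≈· (coordinate isBasis i (x * e j)) (e i))))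
      ; trace   = q≡
      }

  Rᴷ-isSubgroup : IsSubgroup Rᴷ
  Rᴷ-isSubgroup = record
    { resp       = λ { x≈y (lift (s , eq)) → lift (s , trans eq x≈y) }
    ; 0∈         = lift (R.0# , ι.0#-homo)
    ; +-closed   = λ { (lift (s , eq)) (lift (t , eq′)) → lift (s R.+ t , trans (ι.+-homo s t) (+-cong eq eq′)) }
    ; neg-closed = λ { (lift (s , eq)) → lift (R.- s , trans (ι.-‿homo s) (-‿cong eq)) }
    }

  1∈Rᴷ : 1# ∈ Rᴷ
  1∈Rᴷ = lift (R.1# , ι.1#-homo)

  submodule-isSubgroup : ∀ {A X} → - 1# ∈ A → IsSubmodule A X → IsSubgroup X
  submodule-isSubgroup -1∈ X-isSubmodule = record
    { resp       = resp
    ; 0∈         = 0∈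
    ; +-closed   = +-closed
    ; neg-closed = λ {x} x∈ → resp (solve 1 (λ x → (:- con (+ 1)) :* x := :- x) refl x) (*-closed -1∈ x∈)
    }
    where open IsSubmodule X-isSubmodule

  GeneratedBy : List Carrier → Subset → Set κ
  GeneratedBy gs X = ⟨ gs ⟩ₗ ⊆ X × X ⊆ ⟨ gs ⟩ₗ

  Rᴷ-generated : ∃ λ gs → GeneratedBy gs Rᴷ
  Rᴷ-generated = gs , ⟨⟩-least Rᴷ-isSubgroup members , spanned
    where
    open IsOrder isOrder
    gs = tabulate (ι ∘ basis)

    members : ∀ {x} → x ∈ₗ gs → x ∈ Rᴷ
    members x∈ = let i , x≡ = ∈-tabulate⁻ x∈ in lift (basis i , reflexive (≡.sym x≡))

    combination∈ : ∀ {n} (k : Vector ℤ n) (v : Vector R.Carrier n) → (∀ i → ι (v i) ∈ ⟨ gs ⟩ₗ) →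
                   ι (Rₛ.sum (zipWith (Scalars._·ℤ_ R) k v)) ∈ ⟨ gs ⟩ₗ
    combination∈ {zero}  k v v∈ = ⟨⟩-resp (sym ι.0#-homo) ⟨⟩-0
    combination∈ {suc n} k v v∈ = ⟨⟩-resp (sym (ι.+-homo _ _)) (⟨⟩-+
      (⟨⟩-resp (sym (ι-·ℤ (k zero) (v zero))) (IsSubgroup.ℤ-closed ⟨⟩-isSubgroup (k zero) (v∈ zero)))
      (combination∈ (k ∘ suc) (v ∘ suc) (v∈ ∘ suc)))
      where
      ι-·ℤ : ∀ z x → ι (Scalars._·ℤ_ R z x) ≈ ⟦ z ⟧ * ι x
      ι-·ℤ (+ n)    x = ι-× n x
      ι-·ℤ -[1+ n ] x = trans (ι.-‿homo _) (trans (-‿cong (ι-× (suc n) x))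
        (solve 2 (λ n x → :- (n :* x) := (:- n) :* x) refl ⟦ + suc n ⟧ (ι x)))

    spanned : Rᴷ ⊆ ⟨ gs ⟩ₗ
    spanned (lift (s , ιs≈x)) = let k , s≈ = Scalars.IsBasis.spans isBasis s in
      ⟨⟩-resp (trans (ι.⟦⟧-cong (R.sym s≈)) ιs≈x)
        (combination∈ k basis (λ i → generator (∈-tabulate⁺ i)))

  sum-closed : ∀ {h : Level} {H : Pred Carrier h} → IsSubgroup H →
               ∀ {n} (v : Vector Carrier n) → (∀ i → v i ∈ H) → sum v ∈ H
  sum-closed H-isSubgroup {zero}  v v∈ = IsSubgroup.0∈ H-isSubgroup
  sum-closed H-isSubgroup {suc n} v v∈ =
    IsSubgroup.+-closed H-isSubgroup (v∈ zero) (sum-closed H-isSubgroup (v ∘ suc) (v∈ ∘ suc))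

  -- Products of additive generators of `A` with module generators of `X` generate `X` additively.
  -- Applied along `R`, `S`, `T`, this turns every fractional ideal into a lattice given by a list.
  module-generated : ∀ {A X} → (∃ λ gs → GeneratedBy gs A) → IsSubgroup X → IsSubmodule A X →
                     FinitelyGenerated A X → ∃ λ gs → GeneratedBy gs X
  module-generated {A} {X} (as , as⊆A , A⊆as) X-isSubgroup X-isSubmodule (n , g , g∈ , spanned) =
    gs , ⟨⟩-least X-isSubgroup members , λ x∈ → let t , t∈ , x≈ = spanned x∈ in
      ⟨⟩-resp (sym x≈) (sum-closed ⟨⟩-isSubgroup (zipWith _*_ t g) (λ i → product∈ i (A⊆as (t∈ i))))
    where
    gs = cartesianProductWith _*_ as (tabulate g)

    members : ∀ {x} → x ∈ₗ gs → x ∈ X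
    members x∈ with ∈-cartesianProductWith⁻ _*_ as (tabulate g) x∈
    ... | t , y , t∈ , y∈ , ≡.refl with ∈-tabulate⁻ y∈
    ... | i , ≡.refl = IsSubmodule.*-closed X-isSubmodule (as⊆A (generator t∈)) (g∈ i)

    product∈ : ∀ i {t} → t ∈ ⟨ as ⟩ₗ → t * g i ∈ ⟨ gs ⟩ₗ
    product∈ i = ⟨⟩-least (times-isSubgroup ⟨⟩-isSubgroup (g i))
      (λ t∈ → generator (∈-cartesianProductWith⁺ _*_ t∈ (∈-tabulate⁺ i)))

  generated⇒finitelyGenerated : ∀ {X} → (∃ λ gs → GeneratedBy gs X) → FinitelyGenerated Rᴷ X
  generated⇒finitelyGenerated (gs , gs⊆X , X⊆gs) =
    length gs , lookup gs , (λ i → gs⊆X (generator (∈-lookup i))) , λ x∈ → coefficients gs (X⊆gs x∈)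
    where
    coefficients : ∀ gs {x} → x ∈ ⟨ gs ⟩ₗ → ∃ λ (t : Vector Carrier (length gs)) →
      (∀ i → t i ∈ Rᴷ) × x ≈ sum (zipWith _*_ t (lookup gs))
    coefficients []       x∈ = (λ ()) , (λ ()) , ⟨[]⟩-trivial x∈
    coefficients (g ∷ gs) x∈ = let z , y , y∈ , x≈ = ⟨∷⟩⁻ x∈; t , t∈ , y≈ = coefficients gs y∈ in
      (λ { zero → ⟦ z ⟧ ; (suc i) → t i }) ,
      (λ { zero → IsSubgroup.resp Rᴷ-isSubgroup (*-identityʳ _) (IsSubgroup.ℤ-closed Rᴷ-isSubgroup z 1∈Rᴷ)
         ; (suc i) → t∈ i }) ,
      trans x≈ (+-congˡ y≈)

  ∙-least : ∀ {I J : Subset} {h : Level} {H : Pred Carrier h} → IsSubgroup H →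
            (∀ {x y} → x ∈ I → y ∈ J → x * y ∈ H) → I ∙ J ⊆ H
  ∙-least H-isSubgroup products (n , u , v , u∈ , v∈ , x≈) = IsSubgroup.resp H-isSubgroup (sym x≈)
    (sum-closed H-isSubgroup (zipWith _*_ u v) (λ i → products (u∈ i) (v∈ i)))

  ∙-intro : ∀ {I J : Subset} {x y} → x ∈ I → y ∈ J → x * y ∈ I ∙ J
  ∙-intro {I} {J} x∈ y∈ = ∙-resp {I} {J} (+-identityʳ _)
    (∙-cons {I} {J} x∈ y∈ (0 , (λ ()) , (λ ()) , (λ ()) , (λ ()) , refl))

  ∙-isSubgroup : ∀ {I J : Subset} → IsSubgroup I → IsSubgroup (I ∙ J)
  ∙-isSubgroup {I} {J} I-isSubgroup = record
    { resp       = ∙-resp {I} {J}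
    ; 0∈         = 0 , (λ ()) , (λ ()) , (λ ()) , (λ ()) , refl
    ; +-closed   = λ { (n , u , v , u∈ , v∈ , x≈) y∈ →
        ∙-resp {I} {J} (+-congʳ (sym x≈)) (∙-+ {I} {J} n u v u∈ v∈ y∈) }
    ; neg-closed = λ { {x} (n , u , v , u∈ , v∈ , x≈) →
        n , map -_ u , v , (λ i → IsSubgroup.neg-closed I-isSubgroup (u∈ i)) , v∈ , (begin
          - x                                       ≈⟨ -‿cong x≈ ⟩
          - sum (zipWith _*_ u v)                   ≈⟨ solve 1 (λ s → :- s := (:- con (+ 1)) :* s) refl _ ⟩
          - 1# * sum (zipWith _*_ u v)              ≈⟨ *-distribˡ-sum (- 1#) (zipWith _*_ u v) ⟩
          sum (map (- 1# *_) (zipWith _*_ u v))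
            ≈⟨ sum-cong-≋ (λ i → solve 2 (λ u v → (:- con (+ 1)) :* (u :* v) := (:- u) :* v) refl (u i) (v i)) ⟩
          sum (zipWith _*_ (map -_ u) v)            ∎) }
    }

  ∶-isSubgroup : ∀ {I J : Subset} → IsSubgroup I → IsSubgroup (I ∶ J)
  ∶-isSubgroup {I} {J} I-isSubgroup = record
    { resp       = λ x≈x′ x∈ y y∈ → resp (*-congʳ x≈x′) (x∈ y y∈)
    ; 0∈         = λ y _ → resp (sym (zeroˡ y)) 0∈
    ; +-closed   = λ x∈ x′∈ y y∈ → resp (sym (distribʳ y _ _)) (+-closed (x∈ y y∈) (x′∈ y y∈))
    ; neg-closed = λ x∈ y y∈ → resp (solve 2 (λ x y → :- (x :* y) := (:- x) :* y) refl _ y) (neg-closed (x∈ y y∈))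
    }
    where open IsSubgroup I-isSubgroup

  full⇒ℚ-span : ∀ {I} → Full I → ∀ x → x ∈ ℚ-span I
  full⇒ℚ-span full x = let n , q , y , y∈ , x≈ = full x in
    ⟨⟩-resp (sym x≈) (sum-closed ⟨⟩-isSubgroup (zipWith _·ℚ_ q y)
      (λ i → generator (q i , y i , y∈ i , ·ℚ≈· (q i) (y i))))

  denominator : ∀ {X : Subset} → IsSubgroup X → ∀ {x} → x ∈ ℚ-span X → ∃ λ n → ⟦ + suc n ⟧ * x ∈ X
  denominator {X} X-isSubgroup = ⟨⟩-least {H = λ x → ∃ λ n → ⟦ + suc n ⟧ * x ∈ X} (record
    { resp       = λ { x≈y (n , x∈) → n , resp (*-congˡ x≈y) x∈ }
    ; 0∈         = 0 , resp (sym (zeroʳ _)) 0∈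
    -- The successor of this witness is the product `suc m * suc n` of the two denominators.
    ; +-closed   = λ { {x} {y} (m , x∈) (n , y∈) → n ℕ.+ m ℕ.* suc n ,
        resp (trans (solve 4 (λ m n x y → n :* (m :* x) :+ m :* (n :* y) := (m :* n) :* (x :+ y)) refl
                ⟦ + suc m ⟧ ⟦ + suc n ⟧ x y)
              (*-congʳ (sym (⟦⟧-homo-* (+ suc m) (+ suc n)))))
          (+-closed (ℤ-closed (+ suc n) x∈) (ℤ-closed (+ suc m) y∈)) }
    ; neg-closed = λ { {x} (n , x∈) → n ,
        resp (solve 2 (λ n x → :- (n :* x) := n :* (:- x)) refl _ x) (neg-closed x∈) }
    })
    λ { (q@record{} , y , y∈ , x≈) → ℚ.ℚ.denominator-1 q ,
        resp (trans (*-congʳ (sym (clear (ℚ.toℚᵘ q)))) (trans (*-assoc _ _ y) (*-congˡ (sym x≈))))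
          (ℤ-closed (ℚ.↥ q) y∈) }
    where open IsSubgroup X-isSubgroup

  common-denominator : ∀ {X : Subset} → IsSubgroup X → (∀ x → x ∈ ℚ-span X) → ∀ gs →
                       ∃ λ n → ∀ {x} → x ∈ ⟨ gs ⟩ₗ → ⟦ + suc n ⟧ * x ∈ X
  common-denominator {X} X-isSubgroup full [] = 0 , λ x∈ →
    resp (sym (trans (*-congˡ (⟨[]⟩-trivial x∈)) (zeroʳ _))) 0∈
    where open IsSubgroup X-isSubgroup
  common-denominator {X} X-isSubgroup full (g ∷ gs) =
    let m , g∈ = denominator X-isSubgroup (full g); n , gs⊆ = common-denominator X-isSubgroup full gs in
    n ℕ.+ m ℕ.* suc n , λ {x} x∈ → let z , y , y∈ , x≈ = ⟨∷⟩⁻ x∈ in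
      resp (trans (solve 5 (λ m n z g y → (n :* z) :* (m :* g) :+ m :* (n :* y) := (m :* n) :* (z :* g :+ y)) refl
              ⟦ + suc m ⟧ ⟦ + suc n ⟧ ⟦ z ⟧ g y)
            (*-cong (sym (⟦⟧-homo-* (+ suc m) (+ suc n))) (sym x≈)))
        (+-closed (resp (*-congʳ (⟦⟧-homo-* (+ suc n) z)) (ℤ-closed (+ suc n ℤ.* z) g∈))
          (ℤ-closed (+ suc m) (gs⊆ y∈)))
    where open IsSubgroup X-isSubgroup

  -1∈Rᴷ : - 1# ∈ Rᴷ
  -1∈Rᴷ = IsSubgroup.neg-closed Rᴷ-isSubgroup 1∈Rᴷ

  overOrder-isSubring : ∀ {A X} → - 1# ∈ A → IsOverOrder A X → IsSubring X
  overOrder-isSubring -1∈ X-isOverOrder = record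
    { isSubgroup = submodule-isSubgroup -1∈ (IsFractionalIdeal.isSubmodule isFractionalIdeal)
    ; 1∈         = 1∈
    ; *-closed   = *-closed
    }
    where open IsOverOrder X-isOverOrder

  base⊆overOrder : ∀ {A X} → IsOverOrder A X → A ⊆ X
  base⊆overOrder X-isOverOrder a∈ =
    IsFractionalIdeal.resp isFractionalIdeal (*-identityʳ _) (IsFractionalIdeal.*-closed isFractionalIdeal a∈ 1∈)
    where open IsOverOrder X-isOverOrder

  fractionalIdeal-generated : ∀ {A X} → (∃ λ gs → GeneratedBy gs A) → - 1# ∈ A →
                              IsFractionalIdeal A X → ∃ λ gs → GeneratedBy gs X
  fractionalIdeal-generated A-generated -1∈ X-isFractional =
    module-generated A-generated (submodule-isSubgroup -1∈ isSubmodule) isSubmodule finitelyGenerated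
    where open IsFractionalIdeal X-isFractional

  module _ {n : ℕ} {e : Vector Carrier n} (isBasis : Scalars.IsBasis K 0ℚ _·_ e) where
    coordinates-zero : ∀ {x} → (∀ i → coordinate isBasis i x ≡ 0ℚ) → x ≈ 0#
    coordinates-zero {x} zeros = trans (expansion isBasis x) (trans
      (sum-cong-≋ (λ i → trans (*-congʳ (trans (reflexive (≡.cong φ (zeros i))) φ-0)) (zeroˡ (e i))))
      (sum-replicate-zero n))

    linear-vanishes : ∀ {f} → IsLinear f → (∀ i → f (e i) ≡ 0ℚ) → ∀ x → f x ≡ 0ℚ
    linear-vanishes {f} linear zeros x = ≡.trans (IsLinear.cong linear (expansion isBasis x))
      (≡.trans (linear-sum linear (λ i → coordinate isBasis i x) e)
        (≡.trans (ℚΣ.sum-cong-≋ (λ i → ≡.trans (≡.cong (coordinate isBasis i x ℚ.*_) (zeros i))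
            (ℚₚ.*-zeroʳ (coordinate isBasis i x))))
          (ℚΣ.sum-replicate-zero n)))

  T-generated : ∀ {S T : Subset} → IsOverOrder Rᴷ S → IsOverOrder S T → ∃ λ ts → GeneratedBy ts T
  T-generated S-isOverOrder T-isOverOrder = fractionalIdeal-generated
    (fractionalIdeal-generated Rᴷ-generated -1∈Rᴷ (IsOverOrder.isFractionalIdeal S-isOverOrder))
    (base⊆overOrder S-isOverOrder -1∈Rᴷ) (IsOverOrder.isFractionalIdeal T-isOverOrder)

  -- Invertibility of the ideal extended to the larger order.

  module _ {S T J : Subset} (S-isOverOrder : IsOverOrder Rᴷ S) (T-isOverOrder : IsOverOrder S T)
           (SᵗTJ≐T : S ᵗ ∙ T ∙ J ≐ T) where
    private
      module S = IsSubring (overOrder-isSubring -1∈Rᴷ S-isOverOrder)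
      module T = IsSubring (overOrder-isSubring (S.neg-closed S.1∈) T-isOverOrder)

    1∈SᵗTJ : 1# ∈ S ᵗ ∙ T ∙ J
    1∈SᵗTJ = proj₂ SᵗTJ≐T T.1∈

    -- A basis of `K` can only come from a trace, hence from an element of `Sᵗ`. In the expression
    -- of 1 as an element of `Sᵗ T J` either all sums are empty, which gives `1 = 0`, or some term
    -- exhibits such an element.
    trivial-or-Sᵗ-inhabited : 1# ≈ 0# ⊎ ∃ λ x → x ∈ S ᵗ
    trivial-or-Sᵗ-inhabited =
      ∙-least {S ᵗ ∙ T} {J} H-isSubgroup (λ {_} {y} w∈ _ →
        scale y (∙-least {S ᵗ} {T} H-isSubgroup (λ x∈ _ → inj₂ (_ , x∈)) w∈)) 1∈SᵗTJ
      where
      H : Pred Carrier _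
      H x = x ≈ 0# ⊎ ∃ λ x → x ∈ S ᵗ

      scale : ∀ {x} y → x ∈ H → x * y ∈ H
      scale y (inj₁ x≈0) = inj₁ (trans (*-congʳ x≈0) (zeroˡ y))
      scale y (inj₂ s)   = inj₂ s

      H-isSubgroup : IsSubgroup H
      H-isSubgroup = record
        { resp       = λ { x≈y (inj₁ x≈0) → inj₁ (trans (sym x≈y) x≈0) ; _ (inj₂ s) → inj₂ s }
        ; 0∈         = inj₁ refl
        ; +-closed   = λ { (inj₁ x≈0) (inj₁ y≈0) → inj₁ (trans (+-cong x≈0 y≈0) (+-identityʳ 0#))
                         ; (inj₁ _) (inj₂ s) → inj₂ s ; (inj₂ s) _ → inj₂ s }
        ; neg-closed = λ { (inj₁ x≈0) → inj₁ (trans (-‿cong x≈0) (solve 0 (:- con (+ 0) := con (+ 0)) refl))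
                         ; (inj₂ s) → inj₂ s }
        }

    module _ {n : ℕ} {e : Vector Carrier n} (isBasisℚ : Scalars.IsBasis K 0ℚ _·ℚ_ e) where
      private
        isBasis = ·ℚ-basis⇒·-basis isBasisℚ
        τ = trace isBasis
        τ-isLinear = trace-isLinear isBasis
      open TraceForm K invertible τ τ-isLinear using (τ*-isLinear)

      -- If x is orthogonal to K then xK ⊆ Sᵗ, so x j is infinitely divisible in T for all j ∈ J, hence zero.
      trace-nondegenerate : ∀ x → All (λ y → τ (y * x) ≡ 0ℚ) (tabulate e) → x ≈ 0#
      trace-nondegenerate x orthogonal = trans (sym (*-identityʳ x))
        (∙-least {S ᵗ ∙ T} {J} {H = λ w → x * w ≈ 0#} annihilator (λ {a} {j} a∈ j∈ →
            trans (solve 3 (λ x a j → x :* (a :* j) := a :* (x :* j)) refl x a j)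
              (trans (*-congˡ (x*j≈0 j∈)) (zeroʳ a)))
          1∈SᵗTJ)
        where
        T-gens = T-generated S-isOverOrder T-isOverOrder
        ts = proj₁ T-gens

        annihilator : IsSubgroup (λ w → x * w ≈ 0#)
        annihilator = record
          { resp       = λ w≈w′ eq → trans (*-congˡ (sym w≈w′)) eq
          ; 0∈         = zeroʳ x
          ; +-closed   = λ eq eq′ → trans (distribˡ x _ _) (trans (+-cong eq eq′) (+-identityʳ 0#))
          ; neg-closed = λ {w} eq → trans (solve 2 (λ x w → x :* (:- w) := :- (x :* w)) refl x w)
              (trans (-‿cong eq) (solve 0 (:- con (+ 0) := con (+ 0)) refl))
          }

        τx≡0 : ∀ w → τ (x * w) ≡ 0ℚ
        τx≡0 = linear-vanishes isBasis (τ*-isLinear x) (λ i →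
          ≡.trans (IsLinear.cong τ-isLinear (*-comm x (e i))) (Allₚ.tabulate⁻ orthogonal i))

        xK⊆Sᵗ : ∀ w → x * w ∈ S ᵗ
        xK⊆Sᵗ w y _ = + 0 , trace-hasTrace isBasisℚ (x * w * y)
          (≡.sym (≡.trans (IsLinear.cong τ-isLinear (*-assoc x w y)) (τx≡0 (w * y))))

        x*j≈0 : ∀ {j} → j ∈ J → x * j ≈ 0#
        x*j≈0 {j} j∈ = coordinates-zero isBasis λ i →
          divisible⇒zero (coordinate-isLinear isBasis i) ts (x * j) λ q →
            ⟨⟩-resp (trans (*-congʳ (*-identityʳ _))
                (solve 3 (λ x q j → x :* q :* j := q :* (x :* j)) refl x (φ q) j))
              (proj₂ (proj₂ T-gens) (proj₁ SᵗTJ≐T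
                (∙-intro {S ᵗ ∙ T} {J} (∙-intro {S ᵗ} {T} (xK⊆Sᵗ (φ q)) T.1∈) j∈)))

      module _ (C : IdealWithMultiplicatorRing S) where
        private
          module C = IdealWithMultiplicatorRing C
          I = C.ideal
          I-isSubgroup = submodule-isSubgroup -1∈Rᴷ C.isSubmodule
          I-generated = fractionalIdeal-generated Rᴷ-generated -1∈Rᴷ C.isFractionalIdeal
          gs = proj₁ I-generated
          gs⊆I = proj₁ (proj₂ I-generated)
          I⊆gs = proj₂ (proj₂ I-generated)
        open DualLattices K invertible τ τ-isLinear (tabulate e) trace-nondegenerate

        -- The chain is `1 ∈ Sᵗ T J ⊆ I Iᵗ T J ⊆ I (T : I)`, taken apart one factor at a time by
        -- preimages under multiplication.
        invertible-over-T : 1# ∈ I ∙ (T ∶ I)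
        invertible-over-T = ∙-least {S ᵗ ∙ T} {J} P-isSubgroup (λ {w} {j} w∈ j∈ →
          ∙-least {S ᵗ} {T} (times-isSubgroup P-isSubgroup j) (λ {s} {t} s∈ t∈ →
            P.resp (sym (*-assoc s t j))
              (⟨⟩-least (times-isSubgroup P-isSubgroup (t * j)) (λ { (b , y , b∈ , y∈ , w≈) →
                  P.resp (trans (sym (*-assoc b y (t * j))) (*-congʳ (sym w≈)))
                    (∙-intro {I} {T ∶ I} (gs⊆I b∈) (dual-times y∈ t∈ j∈)) })
                (Sᵗ⊆IIᵗ s∈))) w∈) 1∈SᵗTJ
          where
          P-isSubgroup = ∙-isSubgroup {I} {T ∶ I} I-isSubgroup
          module P = IsSubgroup P-isSubgroup

          full : ∀ x → x ∈ ℚ-span ⟨ gs ⟩ₗ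
          full x = ⟨⟩-least ⟨⟩-isSubgroup
            (λ { (q , y , y∈ , x≈) → generator (q , y , I⊆gs y∈ , x≈) }) (full⇒ℚ-span C.full x)

          Sᵗ⊆IIᵗ : ∀ {s} → s ∈ S ᵗ → s ∈ ⟨ (λ w → ∃₂ λ b y → b ∈ ⟨ gs ⟩ₗ ×
            (∀ i → i ∈ ⟨ gs ⟩ₗ → Integral (τ (y * i))) × w ≈ b * y) ⟩
          Sᵗ⊆IIᵗ s∈ = multiplicator-dual⊆ gs full λ y y∈ →
            let z , hasTrace = s∈ y (proj₁ C.multiplicatorRing (λ i i∈ → gs⊆I (y∈ (I⊆gs i∈))))
            in z , ≡.sym (hasTrace-unique isBasisℚ hasTrace)

          -- For `i ∈ I` the product `y i` lies in `Sᵗ`, because `S I ⊆ I` and `y` is integral on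
          -- `I`; multiplying by `t j` then lands in `Sᵗ T J`, that is, in `T`.
          dual-times : ∀ {y t j} → (∀ i → i ∈ ⟨ gs ⟩ₗ → Integral (τ (y * i))) → t ∈ T → j ∈ J → y * (t * j) ∈ T ∶ I
          dual-times {y} {t} {j} y∈ t∈ j∈ i i∈ = T.resp
            (solve 4 (λ y t j i → y :* i :* t :* j := y :* (t :* j) :* i) refl y t j i)
            (proj₁ SᵗTJ≐T (∙-intro {S ᵗ ∙ T} {J} (∙-intro {S ᵗ} {T} (λ s s∈ →
              let z , eq = y∈ (s * i) (I⊆gs (proj₂ C.multiplicatorRing s∈ i i∈)) in
              z , trace-hasTrace isBasisℚ (y * i * s)
                (≡.trans (≡.sym eq) (IsLinear.cong τ-isLinear
                  (solve 3 (λ y s i → y :* (s :* i) := y :* i :* s) refl y s i))))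
              t∈) j∈))

  -- Construction of the bounded representative.

  module _ {S T : Subset} (S-isOverOrder : IsOverOrder Rᴷ S) (T-isOverOrder : IsOverOrder S T)
           (C : IdealWithMultiplicatorRing S) where
    private
      S-isSubring = overOrder-isSubring -1∈Rᴷ S-isOverOrder
      module S = IsSubring S-isSubring
      T-isSubring = overOrder-isSubring (S.neg-closed S.1∈) T-isOverOrder
      module T = IsSubring T-isSubring
      module C = IdealWithMultiplicatorRing C
      I = C.ideal
      M = T ∶ I
      I-isSubgroup = submodule-isSubgroup -1∈Rᴷ C.isSubmodule
      module I = IsSubgroup I-isSubgroup
      module IT = IsSubgroup (∙-isSubgroup {I} {T} I-isSubgroup)
      ts = proj₁ (T-generated S-isOverOrder T-isOverOrder)
      ts⊆T = proj₁ (proj₂ (T-generated S-isOverOrder T-isOverOrder))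
      T⊆ts = proj₂ (proj₂ (T-generated S-isOverOrder T-isOverOrder))

    S*I⊆I : ∀ {s i} → s ∈ S → i ∈ I → s * i ∈ I
    S*I⊆I s∈ = proj₂ C.multiplicatorRing s∈ _

    IT-*-closed : ∀ {t x} → t ∈ T → x ∈ I ∙ T → t * x ∈ I ∙ T
    IT-*-closed {t} t∈ x∈ = IT.resp (*-comm _ t) (∙-least {I} {T}
      (times-isSubgroup (∙-isSubgroup {I} {T} I-isSubgroup) t)
      (λ {i} {u} i∈ u∈ → IT.resp (sym (*-assoc i u t)) (∙-intro {I} {T} i∈ (T.*-closed u∈ t∈))) x∈)

    M*IT⊆T : ∀ {x y} → x ∈ M → y ∈ I ∙ T → x * y ∈ T
    M*IT⊆T {x} x∈ y∈ = T.resp (*-comm _ x) (∙-least {I} {T} (times-isSubgroup T.isSubgroup x)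
      (λ {i} {t} i∈ t∈ → T.resp (solve 3 (λ x i t → t :* (x :* i) := i :* t :* x) refl x i t)
        (T.*-closed t∈ (x∈ i i∈))) y∈)

    integer-conductor : ∃ λ n → ∀ {t} → t ∈ T → ⟦ + suc n ⟧ * t ∈ S
    integer-conductor = let n , ts⊆ = common-denominator S.isSubgroup (full⇒ℚ-span S-full) ts in n , λ t∈ → ts⊆ (T⊆ts t∈)
      where S-full = IsFractionalIdeal.full (IsOverOrder.isFractionalIdeal S-isOverOrder)

    -- The representative is J = xI + νT, where νT ⊆ S and x ∈ (T : I) generates (IT)⁻¹ modulo ν:
    -- at the primes dividing ν it equals xI, at all others it equals T = S.
    module Representative (n : ℕ) (νT⊆S : ∀ {t} → t ∈ T → ⟦ + suc n ⟧ * t ∈ S) (1∈IM : 1# ∈ I ∙ M)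
      (x y t : Carrier) (x∈ : x ∈ M) (y∈ : y ∈ I ∙ T) (t∈ : t ∈ T) (1≈ : 1# ≈ x * y + ⟦ + suc n ⟧ * t) where
      private ν = ⟦ + suc n ⟧

      J : Subset
      J z = ∃₂ λ i u → i ∈ I × u ∈ T × z ≈ x * i + ν * u

      νIT⊆I : ∀ {w} → w ∈ I ∙ T → ν * w ∈ I
      νIT⊆I w∈ = I.resp (*-comm _ ν) (∙-least {I} {T} (times-isSubgroup I-isSubgroup ν)
        (λ {i} {u} i∈ u∈ → I.resp (solve 3 (λ ν i u → ν :* u :* i := i :* u :* ν) refl ν i u)
          (S*I⊆I (νT⊆S u∈) i∈)) w∈)

      J-isSubgroup : IsSubgroup J
      J-isSubgroup = record
        { resp       = λ { z≈z′ (i , u , i∈ , u∈ , z≈) → i , u , i∈ , u∈ , trans (sym z≈z′) z≈ }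
        ; 0∈         = 0# , 0# , I.0∈ , T.0∈ , sym (trans (+-cong (zeroʳ x) (zeroʳ ν)) (+-identityʳ 0#))
        ; +-closed   = λ { (i , u , i∈ , u∈ , z≈) (i′ , u′ , i′∈ , u′∈ , z′≈) →
            i + i′ , u + u′ , I.+-closed i∈ i′∈ , T.+-closed u∈ u′∈ , trans (+-cong z≈ z′≈)
              (solve 6 (λ x ν i u i′ u′ → (x :* i :+ ν :* u) :+ (x :* i′ :+ ν :* u′) :=
                  x :* (i :+ i′) :+ ν :* (u :+ u′)) refl x ν i u i′ u′) }
        ; neg-closed = λ { (i , u , i∈ , u∈ , z≈) → - i , - u , I.neg-closed i∈ , T.neg-closed u∈ ,
            trans (-‿cong z≈)
              (solve 4 (λ x ν i u → :- (x :* i :+ ν :* u) := x :* (:- i) :+ ν :* (:- u)) refl x ν i u) }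
        }
      module J = IsSubgroup J-isSubgroup

      x*I⊆J : ∀ {i} → i ∈ I → x * i ∈ J
      x*I⊆J i∈ = _ , 0# , i∈ , T.0∈ , sym (trans (+-congˡ (zeroʳ ν)) (+-identityʳ _))

      ν*T⊆J : ∀ {u} → u ∈ T → ν * u ∈ J
      ν*T⊆J u∈ = 0# , _ , I.0∈ , u∈ , sym (trans (+-congʳ (zeroʳ x)) (+-identityˡ _))

      J-least : ∀ {h : Level} {H : Pred Carrier h} → IsSubgroup H →
                (∀ {i} → i ∈ I → x * i ∈ H) → (∀ {u} → u ∈ T → ν * u ∈ H) → J ⊆ H
      J-least H-isSubgroup xI⊆H νT⊆H (i , u , i∈ , u∈ , z≈) =
        IsSubgroup.resp H-isSubgroup (sym z≈) (IsSubgroup.+-closed H-isSubgroup (xI⊆H i∈) (νT⊆H u∈))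

      S*J⊆J : ∀ {s z} → s ∈ S → z ∈ J → s * z ∈ J
      S*J⊆J {s} s∈ z∈ = J.resp (*-comm _ s) (J-least (times-isSubgroup J-isSubgroup s)
        (λ {i} i∈ → J.resp (solve 3 (λ x s i → x :* (s :* i) := x :* i :* s) refl x s i) (x*I⊆J (S*I⊆I s∈ i∈)))
        (λ {u} u∈ → J.resp (sym (*-assoc ν u s)) (ν*T⊆J (T.*-closed u∈ (base⊆overOrder T-isOverOrder s∈)))) z∈)

      J⊆T : J ⊆ T
      J⊆T = J-least T.isSubgroup (x∈ _) (T.ℤ-closed (+ suc n))

      J-generated : ∃ λ gs → GeneratedBy gs J
      J-generated = List.map (x *_) gs ++ List.map (ν *_) ts , ⟨⟩-least J-isSubgroup members ,
        J-least ⟨⟩-isSubgroup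
          (λ i∈ → ⟨⟩-resp (*-comm _ x) (⟨⟩-least (times-isSubgroup ⟨⟩-isSubgroup x)
            (λ g∈ → ⟨⟩-resp (*-comm x _) (generator (∈-++⁺ˡ (∈-map⁺ (x *_) g∈)))) (I⊆gs i∈)))
          (λ u∈ → ⟨⟩-resp (*-comm _ ν) (⟨⟩-least (times-isSubgroup ⟨⟩-isSubgroup ν)
            (λ g∈ → ⟨⟩-resp (*-comm ν _) (generator (∈-++⁺ʳ (List.map (x *_) gs) (∈-map⁺ (ν *_) g∈)))) (T⊆ts u∈)))
        where
        I-generated = fractionalIdeal-generated Rᴷ-generated -1∈Rᴷ C.isFractionalIdeal
        gs = proj₁ I-generated
        I⊆gs = proj₂ (proj₂ I-generated)

        members : ∀ {z} → z ∈ₗ List.map (x *_) gs ++ List.map (ν *_) ts → z ∈ J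
        members z∈ with ∈-++⁻ (List.map (x *_) gs) z∈
        ... | inj₁ z∈ˡ = let g , g∈ , z≡ = ∈-map⁻ (x *_) z∈ˡ in
          J.resp (reflexive (≡.sym z≡)) (x*I⊆J (proj₁ (proj₂ I-generated) (generator g∈)))
        ... | inj₂ z∈ʳ = let g , g∈ , z≡ = ∈-map⁻ (ν *_) z∈ʳ in
          J.resp (reflexive (≡.sym z≡)) (ν*T⊆J (ts⊆T (generator g∈)))

      J-full : Full J
      J-full z = let m , q , u , u∈ , z/ν≈ = T-full (n ⁻¹ * z) in
        m , q , map (ν *_) u , (λ i → ν*T⊆J (u∈ i)) , (begin
          z                                   ≈⟨ *-identityˡ z ⟨
          1# * z                              ≈⟨ *-congʳ (⁻¹-inverse n) ⟨
          ν * n ⁻¹ * z                        ≈⟨ *-assoc ν (n ⁻¹) z ⟩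
          ν * (n ⁻¹ * z)                      ≈⟨ *-congˡ z/ν≈ ⟩
          ν * sum (zipWith _·ℚ_ q u)          ≈⟨ *-distribˡ-sum ν (zipWith _·ℚ_ q u) ⟩
          sum (map (ν *_) (zipWith _·ℚ_ q u))
            ≈⟨ sum-cong-≋ (λ i → trans (*-congˡ (·ℚ≈· (q i) (u i))) (trans
                 (solve 3 (λ ν q u → ν :* (q :* u) := q :* (ν :* u)) refl ν (φ (q i)) (u i))
                 (sym (·ℚ≈· (q i) (ν * u i))))) ⟩
          sum (zipWith _·ℚ_ q (map (ν *_) u)) ∎)
        where T-full = IsFractionalIdeal.full (IsOverOrder.isFractionalIdeal T-isOverOrder)

      ν*M⊆J∶I : ∀ {m} → m ∈ M → ν * m ∈ J ∶ I
      ν*M⊆J∶I {m} m∈ i i∈ = J.resp (sym (*-assoc ν m i)) (ν*T⊆J (m∈ i i∈))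

      -- On `x I` the multiplier becomes `x y = 1 - ν t`, an element of `S` as `ν T ⊆ S`; on `ν T`
      -- the products fall into `ν I T`, which is contained in `I`.
      y∈I∶J : y ∈ I ∶ J
      y∈I∶J z z∈ = I.resp (*-comm z y) (J-least (times-isSubgroup I-isSubgroup y)
        (λ {i} i∈ → I.resp (trans (*-congʳ 1-νt≈xy) (solve 3 (λ x y i → x :* y :* i := x :* i :* y) refl x y i))
          (S*I⊆I (S.+-closed S.1∈ (S.neg-closed (νT⊆S t∈))) i∈))
        (λ {u} u∈ → I.resp (sym (*-assoc ν u y)) (νIT⊆I (IT-*-closed u∈ y∈))) z∈)
        where
        1-νt≈xy : 1# - ν * t ≈ x * y
        1-νt≈xy = trans (+-congʳ 1≈) (solve 2 (λ a b → (a :+ b) :- b := a) refl (x * y) (ν * t))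

      νIT⊆I∶J : ∀ {w} → w ∈ I ∙ T → ν * w ∈ I ∶ J
      νIT⊆I∶J {w} w∈ z z∈ = I.resp (*-comm z (ν * w)) (J-least (times-isSubgroup I-isSubgroup (ν * w))
        (λ {i} i∈ → I.resp (solve 4 (λ ν x w i → ν :* (x :* w) :* i := x :* i :* (ν :* w)) refl ν x w i)
          (S*I⊆I (νT⊆S (M*IT⊆T x∈ w∈)) i∈))
        (λ {u} u∈ → I.resp (solve 3 (λ ν u w → ν :* (ν :* (u :* w)) := ν :* u :* (ν :* w)) refl ν u w)
          (I.ℤ-closed (+ suc n) (νIT⊆I (IT-*-closed u∈ w∈)))) z∈)

      -- 1 = x y + ν t with ν t = x (ν t y) + ν² t², and ν² t² ∈ (ν M)(ν I T) because 1 ∈ I M.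
      J-weaklyEquivalent : WeaklyEquivalent J I
      J-weaklyEquivalent = P.resp (sym 1≈′) (P.+-closed (P.+-closed
          (∙-intro {J ∶ I} {I ∶ J} x∈J∶I y∈I∶J)
          (∙-intro {J ∶ I} {I ∶ J} x∈J∶I (νIT⊆I∶J (IT-*-closed t∈ y∈))))
          (P.resp (*-identityˡ _) (∙-least {I} {M} (times-isSubgroup P-isSubgroup (ν * ν * (t * t)))
            (λ {i} {m} i∈ m∈ → P.resp
              (solve 4 (λ ν t i m → ν :* m :* (ν :* (t :* t :* i)) := i :* m :* (ν :* ν :* (t :* t))) refl ν t i m)
              (∙-intro {J ∶ I} {I ∶ J} (ν*M⊆J∶I m∈) (νIT⊆I∶J (IT-*-closed (T.*-closed t∈ t∈) (I⊆IT i∈))))) 1∈IM)))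
        where
        P-isSubgroup = ∙-isSubgroup {J ∶ I} {I ∶ J} (∶-isSubgroup {J} {I} J-isSubgroup)
        module P = IsSubgroup P-isSubgroup

        I⊆IT : ∀ {i} → i ∈ I → i ∈ I ∙ T
        I⊆IT i∈ = IT.resp (*-identityʳ _) (∙-intro {I} {T} i∈ T.1∈)

        x∈J∶I : x ∈ J ∶ I
        x∈J∶I i i∈ = x*I⊆J i∈

        1≈′ : 1# ≈ x * y + x * (ν * (t * y)) + ν * ν * (t * t)
        1≈′ = begin
          1#                                             ≈⟨ 1≈ ⟩
          x * y + ν * t                                  ≈⟨ +-congˡ (*-identityʳ (ν * t)) ⟨
          x * y + ν * t * 1#                             ≈⟨ +-congˡ (*-congˡ 1≈) ⟩
          x * y + ν * t * (x * y + ν * t)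
            ≈⟨ solve 4 (λ x y ν t → x :* y :+ ν :* t :* (x :* y :+ ν :* t) :=
                 x :* y :+ x :* (ν :* (t :* y)) :+ ν :* ν :* (t :* t)) refl x y ν t ⟩
          x * y + x * (ν * (t * y)) + ν * ν * (t * t)    ∎

      -- A consequence of weak equivalence alone: `(I : J) (J : J) (J : I) ⊆ (I : I)`, and 1 lies in
      -- `(J : I) (I : J)`.
      J∶J⊆S : J ∶ J ⊆ S
      J∶J⊆S {z} z∈ = proj₁ C.multiplicatorRing (∶I.resp (*-identityˡ z)
        (∙-least {J ∶ I} {I ∶ J} (times-isSubgroup (∶-isSubgroup {I} {I} I-isSubgroup) z)
          (λ {v} {w} v∈ w∈ i i∈ → I.resp
            (solve 4 (λ v w z i → w :* (z :* (v :* i)) := v :* w :* z :* i) refl v w z i)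
            (w∈ _ (z∈ _ (v∈ i i∈)))) J-weaklyEquivalent))
        where module ∶I = IsSubgroup (∶-isSubgroup {I} {I} I-isSubgroup)

      representative : IdealWithMultiplicatorRing S
      representative = record
        { ideal             = J
        ; isFractionalIdeal = record
          { isSubmodule       = record
            { resp     = J.resp
            ; 0∈       = J.0∈
            ; +-closed = J.+-closed
            ; *-closed = λ r∈ → S*J⊆J (base⊆overOrder S-isOverOrder r∈)
            }
          ; finitelyGenerated = generated⇒finitelyGenerated J-generated
          ; full              = J-full
          }
        ; multiplicatorRing = J∶J⊆S , λ s∈ z z∈ → S*J⊆J s∈ z∈
        }

      -- Multiplying `1 = x y + ν t` by `f` gives `f = x (y f) + ν (t f)`. The factor from `T` in
      -- `y ∈ I T` is absorbed by `T 𝔣 ⊆ 𝔣 ⊆ S`, so `y f` stays in `I`.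
      𝔣⊆J : ∀ {𝔣} → IsIdeal S 𝔣 → T ⊆ 𝔣 ∶ 𝔣 → 𝔣 ⊆ J
      𝔣⊆J {𝔣} 𝔣-isIdeal T⊆𝔣∶𝔣 {f} f∈ = J.resp
        (trans (solve 5 (λ x y ν t f → x :* (y :* f) :+ ν :* (t :* f) := (x :* y :+ ν :* t) :* f) refl x y ν t f)
          (trans (*-congʳ (sym 1≈)) (*-identityˡ f)))
        (J.+-closed (x*I⊆J y*f∈I) (ν*T⊆J (T.*-closed t∈ (base⊆overOrder T-isOverOrder (contained f∈)))))
        where
        open IsIdeal 𝔣-isIdeal using (contained)
        y*f∈I : y * f ∈ I
        y*f∈I = ∙-least {I} {T} (times-isSubgroup I-isSubgroup f)
          (λ {i} {u} i∈ u∈ → I.resp (solve 3 (λ i u f → u :* f :* i := i :* u :* f) refl i u f)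
            (S*I⊆I (contained (T⊆𝔣∶𝔣 u∈ f f∈)) i∈)) y∈

    representative-exists : 1# ∈ I ∙ M → ∀ {𝔣} → IsIdeal S 𝔣 → T ⊆ 𝔣 ∶ 𝔣 →
      ∃ λ (D : IdealWithMultiplicatorRing S) → let open IdealWithMultiplicatorRing using (ideal) in
        WeaklyEquivalent (ideal D) I × 𝔣 ⊆ ideal D × ideal D ⊆ T
    representative-exists 1∈IM@(m , u , v , u∈ , v∈ , 1≈uv) 𝔣-isIdeal T⊆𝔣∶𝔣 =
      representative , J-weaklyEquivalent , 𝔣⊆J 𝔣-isIdeal T⊆𝔣∶𝔣 , J⊆T
      where
      n = proj₁ integer-conductor
      open Residues K

      IT-isModule : IsModule T (I ∙ T)
      IT-isModule = record { isSubgroup = ∙-isSubgroup {I} {T} I-isSubgroup ; *-closed = IT-*-closed }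

      M-isModule : IsModule T M
      M-isModule = record { isSubgroup = ∶-isSubgroup {T} {I} T.isSubgroup
        ; *-closed = λ t∈ x∈ i i∈ → T.resp (sym (*-assoc _ _ i)) (T.*-closed t∈ (x∈ i i∈)) }

      generates : ∃₂ λ x y → x ∈ M × y ∈ I ∙ T × 1# - x * y ∈ Multiples T-isSubring ts ts⊆T T⊆ts n
      generates = Quotients.principal-modulo K T-isSubring (multiples-isModule T-isSubring ts ts⊆T T⊆ts n)
        IT-isModule M-isModule M*IT⊆T (quotient-idempotentPowers T-isSubring ts ts⊆T T⊆ts n)
        m v u v∈ (λ j → IT.resp (*-identityʳ _) (∙-intro {I} {T} (u∈ j) T.1∈))
        (trans 1≈uv (sum-cong-≋ (λ j → *-comm (u j) (v j))))

      x = proj₁ generates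
      y = proj₁ (proj₂ generates)
      x∈ = proj₁ (proj₂ (proj₂ generates))
      y∈ = proj₁ (proj₂ (proj₂ (proj₂ generates)))
      1-xy = proj₂ (proj₂ (proj₂ (proj₂ generates)))

      open Representative n (proj₂ integer-conductor) 1∈IM x y (proj₁ 1-xy) x∈ y∈ (proj₁ (proj₂ 1-xy))
        (trans (solve 2 (λ o a → o := a :+ (o :- a)) refl 1# (x * y)) (+-congˡ (proj₂ (proj₂ 1-xy))))

  bounded-representative : ∀ {S T J 𝔣 : Subset} → IsOverOrder Rᴷ S → IsOverOrder S T → S ᵗ ∙ T ∙ J ≐ T →
    IsIdeal S 𝔣 → T ⊆ 𝔣 ∶ 𝔣 → (C : IdealWithMultiplicatorRing S) →
    ∃ λ (D : IdealWithMultiplicatorRing S) → let open IdealWithMultiplicatorRing using (ideal) in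
      WeaklyEquivalent (ideal D) (ideal C) × 𝔣 ⊆ ideal D × ideal D ⊆ T
  bounded-representative {S} {T} {J} {𝔣} S-isOverOrder T-isOverOrder SᵗTJ≐T 𝔣-isIdeal T⊆𝔣∶𝔣 C =
    by-cases (trivial-or-Sᵗ-inhabited {S} {T} {J} S-isOverOrder T-isOverOrder SᵗTJ≐T)
    where
    open IdealWithMultiplicatorRing C
    Result = ∃ λ (D : IdealWithMultiplicatorRing S) →
      WeaklyEquivalent (IdealWithMultiplicatorRing.ideal D) ideal ×
      𝔣 ⊆ IdealWithMultiplicatorRing.ideal D × IdealWithMultiplicatorRing.ideal D ⊆ T

    by-cases : 1# ≈ 0# ⊎ ∃ (_∈ S ᵗ) → Result
    -- In the zero ring any set containing 0 is everything, so the given ideal represents itself.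
    by-cases (inj₁ 1≈0) = C , weaklyEquivalent-refl C ,
      (λ _ → resp (≈0 _) 0∈) , λ _ → IsSubgroup.resp T-isSubgroup (≈0 _) (IsSubgroup.0∈ T-isSubgroup)
      where
      ≈0 : ∀ x → 0# ≈ x
      ≈0 x = trans (sym (zeroˡ x)) (trans (*-congʳ (sym 1≈0)) (*-identityˡ x))
      T-isSubgroup = IsSubring.isSubgroup (overOrder-isSubring (base⊆overOrder S-isOverOrder -1∈Rᴷ) T-isOverOrder)
    -- As `1 ∈ S`, the element `s * 1` has an integral trace, and the evidence for it carries a
    -- basis of `K`.
    by-cases (inj₂ (s , s∈)) = representative-exists S-isOverOrder T-isOverOrder C
      (invertible-over-T {S} {T} {J} S-isOverOrder T-isOverOrder SᵗTJ≐T
        (HasTrace.isBasis (proj₂ (s∈ 1# (IsOverOrder.1∈ S-isOverOrder)))) C)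
      𝔣-isIdeal T⊆𝔣∶𝔣

proposition5p1 :
  ∀ {a r c ℓ : Level}
  (R : CommutativeRing a r) (isOrder : IsOrder R)
  (K : CommutativeRing c ℓ)
  (ι : CommutativeRing.Carrier R → CommutativeRing.Carrier K)
  (isTotalQuotientRing : IsTotalQuotientRing R K ι) →
  let open InTotalQuotientRing R isOrder K ι isTotalQuotientRing
      open IdealWithMultiplicatorRing using (ideal) in
  (S : Subset) → IsOverOrder Rᴷ S →
  (T : Subset) → IsOverOrder S T →
  Invertible T (S ᵗ ∙ T) →
  (𝔣 : Subset) → IsIdeal S 𝔣 → T ⊆ (𝔣 ∶ 𝔣) →
  (C : Setoid.Carrier (𝒲 S)) →
  ∃ λ (I : Setoid.Carrier (𝒲 S)) →
    Setoid._≈_ (𝒲 S) I C × 𝔣 ⊆ ideal I × ideal I ⊆ T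
proposition5p1 R isOrder K ι isTotalQuotientRing S S-isOverOrder T T-isOverOrder
  (J , _ , SᵗTJ≐T) 𝔣 𝔣-isIdeal T⊆𝔣∶𝔣 =
  Orders.bounded-representative R isOrder K ι isTotalQuotientRing {S} {T} {J}
    S-isOverOrder T-isOverOrder SᵗTJ≐T 𝔣-isIdeal T⊆𝔣∶𝔣
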